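{- Let $G=(V,E)$ be an undirected graph on $n$ vertices with maximum degree $\Delta$, whose edges are presented as a data stream in arbitrary order. For any constant $\eta\in(0,1)$, there is a deterministic streaming algorithm that computes a proper vertex coloring of $G$ using at most $(1+\eta)\Delta$ colors (i.e. an assignment of colors from $[(1+\eta)\Delta]$ to all vertices such that no edge has both endpoints of the same color), using $O\!\left(\frac{1}{\eta}\sqrt{\log \Delta}\right)$ passes over the stream and $\tilde{O}(n)$ bits of space.
   Context: Semi-streaming model: the edges of the input graph arrive one by one in an arbitrary (adversarial) order; the algorithm may make several sequential passes over this stream and is allowed working memory of $\tilde O(n)$ bits, where $\tilde O$ hides polylogarithmic factors in $n$. Logarithms are base $2$. $\eta\Delta$ is assumed to be an integer (rounded down).
   Formalization: The formal statement assumes ηΔ ≥ 1, since for ⌊ηΔ⌋ = 0 the claim fails (the complete graph on Δ+1 vertices needs Δ+1 colors), and takes η rational, from which real η follows by choosing a rational slightly below it. -}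

module Defs where

open import Data.Nat using (ℕ; zero; suc; _+_; _*_; _^_; _≤_; _<_; _⊔_)
open import Data.Nat.Logarithm using (⌊log₂_⌋; ⌈log₂_⌉)
open import Data.Bool using (Bool; true; false; if_then_else_; _∨_)
open import Data.Fin using (Fin; _≟_)
open import Data.Vec using (Vec)
open import Data.List using (List; []; _∷_; foldl; foldr; map; allFin)
open import Data.Nat.ListAction using (sum)
open import Data.List.Membership.Propositional using (_∈_)
open import Data.List.Relation.Unary.All using (All)
open import Data.List.Relation.Unary.AllPairs using (AllPairs)
open import Data.Product using (_×_; _,_; proj₁; proj₂; Σ)
open import Data.Sum using (_⊎_)
open import Relation.Binary.PropositionalEquality using (_≡_; _≢_)
open import Relation.Nullary using (¬_)
open import Relation.Nullary.Decidable using (⌊_⌋)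

Edge : ℕ → Set
Edge n = Fin n × Fin n

SameEdge : ∀ {n} → Edge n → Edge n → Set
SameEdge (u , v) (x , y) = (u ≡ x × v ≡ y) ⊎ (u ≡ y × v ≡ x)

SimpleStream : ∀ {n} → List (Edge n) → Set
SimpleStream s = All (λ e → proj₁ e ≢ proj₂ e) s × AllPairs (λ e f → ¬ SameEdge e f) s

deg : ∀ {n} → List (Edge n) → Fin n → ℕ
deg s v = sum (map (λ e → if ⌊ v ≟ proj₁ e ⌋ ∨ ⌊ v ≟ proj₂ e ⌋ then 1 else 0) s)

maxDeg : ∀ {n} → List (Edge n) → ℕ
maxDeg {n} s = foldr _⊔_ 0 (map (deg s) (allFin n))

-- A deterministic streaming algorithm on n-vertex graphs with S bits of
-- working memory.  The whole state between stream items is a bit string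
-- of length S.  Per item it applies `step`; at the end of each pass it
-- applies `endPass`; after each pass (and initially) it may halt, and
-- then the output colouring is read off its memory.
record StreamAlg (n S : ℕ) : Set where
  field
    init    : Vec Bool S
    step    : Vec Bool S → Edge n → Vec Bool S
    endPass : Vec Bool S → Vec Bool S
    halted  : Vec Bool S → Bool
    output  : Vec Bool S → Fin n → ℕ

open StreamAlg public

afterPasses : ∀ {n S} → StreamAlg n S → List (Edge n) → ℕ → Vec Bool S
afterPasses A s zero    = init A
afterPasses A s (suc p) = endPass A (foldl (step A) (afterPasses A s p) s)

HaltsAfter : ∀ {n S} → StreamAlg n S → List (Edge n) → ℕ → Set
HaltsAfter A s p =
  halted A (afterPasses A s p) ≡ true ×
  (∀ q → q < p → halted A (afterPasses A s q) ≡ false)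

-- col is a proper colouring of the stream graph with colours from
-- {0, …, C-1} where C = ⌊(1 + a/b) Δ⌋; the colour bound  col v < ⌊(1+a/b)Δ⌋
-- is written division-free as  (col v + 1) * b ≤ (b + a) * Δ.
ProperColoring : ∀ {n} → List (Edge n) → (a b Δ : ℕ) → (Fin n → ℕ) → Set
ProperColoring {n} s a b Δ col =
  (∀ {e} → e ∈ s → col (proj₁ e) ≢ col (proj₂ e)) ×
  (∀ (v : Fin n) → suc (col v) * b ≤ (b + a) * Δ)

{-# OPTIONS --safe #-}
module Submission where

-- A round tries to colour the set U of uncoloured vertices by descending a tree of nested blocks of
-- colours: an active vertex owns a block, moves to one of its sub-blocks at each level, and drops out
-- until the next round when it shares the sub-block with too many neighbours.  Two kinds of rounds
-- are used, with t = ⌈√(log Δ)⌉ and η = a/b.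
--
-- In a sampled round there is one level.  The colours are taken from a member of a fixed family of
-- Õ(n) functions in which any two vertices collide with probability at most (1 + 1/z)/C; the best
-- member is found by counting conflicts.  This shrinks U by a factor 1 - Ω(η), so O(t/η) rounds give
-- |U| ≤ n/2^{4t}.
--
-- In a sketched round with |U| ≤ n/2^{4s} the branching is 2^s and there are O(log Δ / s) levels.  The
-- sub-blocks minimise the number of monochromatic edges of a sketch of the graph, so by Lovász's
-- argument every vertex meets in its sub-block at most its average share of sketched neighbours.
-- The sketch is obtained by merge-and-reduce: a buffer of edges is halved so that all counts
-- "edges at Y that are monochromatic under g" are preserved, by the Chernoff potential
-- Σ (1 + 1/d)^P (1 - 1/d)^M.  Only a 2^{-s} fraction of U drops out, so four rounds double s;
-- hence s = t, 2t, 4t, … costs O(t + t/2 + t/4 + …) levels until |U| Δ ≤ n, when the sketch is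
-- lossless and no vertex drops out.

open import Defs
open import Data.Bool using (Bool; true; false; if_then_else_; _∧_; _∨_; not; T)
open import Data.Empty using (⊥; ⊥-elim)
open import Data.Fin using (Fin; zero; suc; _≟_; toℕ; fromℕ<)
open import Data.Fin.Properties using (toℕ<n; fromℕ<-toℕ)
open import Data.List using (List; []; _∷_; _++_; length; map; foldl; foldr; upTo; applyUpTo; allFin; cartesianProductWith)
open import Data.List.Extrema.Nat using (argmin; f[argmin]≤f[xs]; argmin-all)
open import Data.List.Membership.Propositional using (_∈_)
open import Data.List.Membership.Propositional.Properties using (∈-map⁺; ∈-map⁻; ∈-++⁺ˡ; ∈-++⁺ʳ; ∈-++⁻; ∈-upTo⁺; ∈-upTo⁻; ∈-allFin; ∈-cartesianProductWith⁺; ∈-cartesianProductWith⁻)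
open import Data.List.Properties using (length-++; length-map; length-upTo; length-tabulate; map-cong; map-tabulate; ++-assoc; ++-identityʳ)
import Data.List.Relation.Unary.All as LAll
open import Data.List.Relation.Unary.AllPairs using (AllPairs; []; _∷_)
open import Data.List.Relation.Unary.Any using (here; there)
open import Data.Maybe using (Maybe; just; nothing; _>>=_; fromMaybe)
open import Data.Maybe.Properties using (just-injective)
open import Data.Nat using (ℕ; zero; suc; _+_; _*_; _^_; _∸_; _⊔_; _≤_; _<_; z≤n; s≤s; NonZero; >-nonZero; _/_; _≤?_; _<?_; _≡ᵇ_; _≤ᵇ_; ⌊_/2⌋) renaming (_≟_ to _≟ℕ_)
open import Data.Nat.DivMod using (m/n*n≤m; m≡m%n+[m/n]*n; m%n<n; m/n/o≡m/[n*o]; m*n/n≡m; n/1≡n; m/n≤m; m<n⇒m/n≡0; m<n*o⇒m/o<n; m≥n⇒m/n>0; /-monoˡ-≤; +-distrib-/-∣ˡ)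
open import Data.Nat.Divisibility using (n∣m*n)
open import Data.Nat.Logarithm using (⌊log₂_⌋; ⌈log₂_⌉; ⌊log₂⌋-mono-≤; ⌊log₂[2^n]⌋≡n; ⌈log₂⌉-mono-≤; ⌈log₂2^n⌉≡n)
open import Data.Nat.Properties hiding (_≟_; _≤?_; _<?_)
open import Data.Nat.Tactic.RingSolver using (solve-∀)
open import Data.Product using (Σ; _×_; _,_; proj₁; proj₂)
open import Data.Sum using (_⊎_; inj₁; inj₂)
open import Data.Unit using (⊤; tt)
open import Data.Vec as Vec using (Vec; []; _∷_; lookup; tabulate; replicate; _[_]≔_)
open import Data.Vec.Properties using (lookup∘tabulate; lookup∘update; lookup∘update′; lookup-replicate; lookup-map; lookup-zipWith)
import Data.Vec.Relation.Unary.All as VAll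
import Data.Vec.Relation.Unary.All.Properties as VAllP
open import Relation.Binary.PropositionalEquality using (_≡_; _≢_; refl; sym; trans; cong; cong₂; subst; subst₂)
open import Relation.Nullary using (¬_; Dec; yes; no)
open import Relation.Nullary.Decidable using (⌊_⌋)

-- The value of t balances two prices. Halving U by sampling costs Θ(1/η) passes at any size of U. A
-- sketched round costs about (log Δ)/s passes, but s is limited by memory. The relative error of
-- the sketch has to be about 1/4^s: one factor 2^s because the error on monochromatic edges is
-- multiplied by the branching, one because only a 2^(-s) fraction may fail. Halving with error 1/d
-- needs buffers of d² times the logarithm of the number of tests, which is O(s |U|). With d about
-- 4^s this is Õ(16^s |U|), hence the condition on |U|. The sub-blocks are computed from the sketch,
-- so the sketch must be accurate for every choice g and every set Y of failing vertices at once;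
-- therefore the tests are indexed by all of them. On the true graph Lovász's argument then controls
-- only sums over Y. Single vertices are handled by slack: the surplus of the palette over Δ is
-- shared among the levels, so a vertex that misses its threshold overshoots its average share by a
-- fixed gap, and few vertices can do so.

⟦_⟧ : Bool → ℕ
⟦ true ⟧  = 1
⟦ false ⟧ = 0

⟦⟧≤1 : ∀ b → ⟦ b ⟧ ≤ 1
⟦⟧≤1 true  = ≤-refl
⟦⟧≤1 false = z≤n

-- Finite sums over lists and averaging

module _ {A : Set} where

  ∑ : List A → (A → ℕ) → ℕ
  ∑ []       f = 0
  ∑ (x ∷ xs) f = f x + ∑ xs f

  ∑-cong-∈ : ∀ xs {f g : A → ℕ} → (∀ x → x ∈ xs → f x ≡ g x) → ∑ xs f ≡ ∑ xs g
  ∑-cong-∈ []       h = refl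
  ∑-cong-∈ (x ∷ xs) h = cong₂ _+_ (h x (here refl)) (∑-cong-∈ xs (λ y y∈ → h y (there y∈)))

  ∑-cong : ∀ xs {f g : A → ℕ} → (∀ x → f x ≡ g x) → ∑ xs f ≡ ∑ xs g
  ∑-cong xs h = ∑-cong-∈ xs (λ x _ → h x)

  ∑-mono-∈ : ∀ xs {f g : A → ℕ} → (∀ x → x ∈ xs → f x ≤ g x) → ∑ xs f ≤ ∑ xs g
  ∑-mono-∈ []       h = z≤n
  ∑-mono-∈ (x ∷ xs) h = +-mono-≤ (h x (here refl)) (∑-mono-∈ xs (λ y y∈ → h y (there y∈)))

  ∑-mono : ∀ xs {f g : A → ℕ} → (∀ x → f x ≤ g x) → ∑ xs f ≤ ∑ xs g
  ∑-mono xs h = ∑-mono-∈ xs (λ x _ → h x)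

  ∑-+ : ∀ xs (f g : A → ℕ) → ∑ xs (λ x → f x + g x) ≡ ∑ xs f + ∑ xs g
  ∑-+ []       f g = refl
  ∑-+ (x ∷ xs) f g rewrite ∑-+ xs f g = lem (f x) (g x) (∑ xs f) (∑ xs g)
    where lem : ∀ a b c d → a + b + (c + d) ≡ a + c + (b + d)
          lem = solve-∀

  ∑-*ˡ : ∀ xs k (f : A → ℕ) → ∑ xs (λ x → k * f x) ≡ k * ∑ xs f
  ∑-*ˡ []       k f = sym (*-zeroʳ k)
  ∑-*ˡ (x ∷ xs) k f = trans (cong (k * f x +_) (∑-*ˡ xs k f)) (sym (*-distribˡ-+ k (f x) (∑ xs f)))

  ∑-const : ∀ xs k → ∑ xs (λ _ → k) ≡ length xs * k
  ∑-const []       k = refl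
  ∑-const (x ∷ xs) k = cong (k +_) (∑-const xs k)

  ∑-++ : ∀ xs ys (f : A → ℕ) → ∑ (xs ++ ys) f ≡ ∑ xs f + ∑ ys f
  ∑-++ []       ys f = refl
  ∑-++ (x ∷ xs) ys f = trans (cong (f x +_) (∑-++ xs ys f)) (sym (+-assoc (f x) _ _))

  ∑-∈ : ∀ xs (f : A → ℕ) {x} → x ∈ xs → f x ≤ ∑ xs f
  ∑-∈ (x ∷ xs) f (here refl) = m≤m+n (f x) _
  ∑-∈ (y ∷ xs) f (there x∈)  = ≤-trans (∑-∈ xs f x∈) (m≤n+m _ (f y))

  ∃≤⊎∑≥ : ∀ xs (f : A → ℕ) B → (Σ A λ x → x ∈ xs × f x ≤ B) ⊎ length xs * suc B ≤ ∑ xs f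
  ∃≤⊎∑≥ []       f B = inj₂ z≤n
  ∃≤⊎∑≥ (x ∷ xs) f B with f x ≤? B | ∃≤⊎∑≥ xs f B
  ... | yes p | _                  = inj₁ (x , here refl , p)
  ... | no _  | inj₁ (y , y∈ , q)  = inj₁ (y , there y∈ , q)
  ... | no ¬p | inj₂ q             = inj₂ (+-mono-≤ (≰⇒> ¬p) q)

  ∃≤average : ∀ xs (f : A → ℕ) B → 0 < length xs → ∑ xs f ≤ length xs * B → Σ A λ x → x ∈ xs × f x ≤ B
  ∃≤average xs@(_ ∷ _) f B _ h with ∃≤⊎∑≥ xs f B
  ... | inj₁ r = r
  ... | inj₂ q = ⊥-elim (1+n≰n (*-cancelˡ-≤ (length xs) (≤-trans q h)))

∑-swap : ∀ {A B : Set} (xs : List A) (ys : List B) (f : A → B → ℕ) →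
         ∑ xs (λ x → ∑ ys (f x)) ≡ ∑ ys (λ y → ∑ xs (λ x → f x y))
∑-swap []       ys f = sym (trans (∑-const ys 0) (*-zeroʳ (length ys)))
∑-swap (x ∷ xs) ys f = trans (cong (∑ ys (f x) +_) (∑-swap xs ys f)) (sym (∑-+ ys (f x) _))

-- Exponential inequalities

-- Bernoulli's inequality `(1 + 1/x)^k ≥ 1 + k/x` with denominators cleared.
bernoulli : ∀ x k → x ^ k * (x + k) ≤ suc x ^ k * x
bernoulli x zero    = ≤-reflexive (cong (1 *_) (+-identityʳ x))
bernoulli x (suc k) = begin
  x * x ^ k * (x + suc k)         ≡⟨ lem₁ x (x ^ k) k ⟩
  x ^ k * (x * (x + k) + x)       ≤⟨ *-monoʳ-≤ (x ^ k) (+-monoʳ-≤ (x * (x + k)) (m≤m+n x k)) ⟩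
  x ^ k * (x * (x + k) + (x + k)) ≡⟨ lem₂ x (x ^ k) k ⟩
  suc x * (x ^ k * (x + k))       ≤⟨ *-monoʳ-≤ (suc x) (bernoulli x k) ⟩
  suc x * (suc x ^ k * x)         ≡⟨ sym (*-assoc (suc x) (suc x ^ k) x) ⟩
  suc x * suc x ^ k * x           ∎
  where
  open ≤-Reasoning
  lem₁ : ∀ x p k → x * p * (x + suc k) ≡ p * (x * (x + k) + x)
  lem₁ = solve-∀
  lem₂ : ∀ x p k → p * (x * (x + k) + (x + k)) ≡ suc x * (p * (x + k))
  lem₂ = solve-∀

2*x^x≤[1+x]^x : ∀ x → 0 < x → 2 * x ^ x ≤ suc x ^ x
2*x^x≤[1+x]^x x@(suc _) _ = *-cancelʳ-≤ _ _ x (subst (_≤ suc x ^ x * x) (lem (x ^ x) x) (bernoulli x x))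
  where lem : ∀ p x → p * (x + x) ≡ 2 * p * x
        lem = solve-∀

-- Bernoulli's inequality `(1 - 1/y)^k ≥ 1 - k/y` for `y = x + 1`, multiplied by `y^(k+1)`; the
-- negative term is moved to the other side.
bernoulli⁻ : ∀ x k → suc x ^ k * suc x ≤ x ^ k * suc x + k * suc x ^ k
bernoulli⁻ x zero    = ≤-reflexive (sym (+-identityʳ _))
bernoulli⁻ x (suc k) = begin
  y * p * y                          ≡⟨ lem₁ x p ⟩
  x * (p * y) + p * y                ≤⟨ +-monoˡ-≤ (p * y) (*-monoʳ-≤ x (bernoulli⁻ x k)) ⟩
  x * (x ^ k * y + k * p) + p * y    ≡⟨ lem₂ x (x ^ k) k p ⟩
  x * x ^ k * y + (k * (x * p) + p * y) ≤⟨ +-monoʳ-≤ (x * x ^ k * y) (+-monoˡ-≤ (p * y) (*-monoʳ-≤ k (*-monoˡ-≤ p (n≤1+n x)))) ⟩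
  x * x ^ k * y + (k * (y * p) + p * y) ≡⟨ cong (x * x ^ k * y +_) (lem₃ k y p) ⟩
  x * x ^ k * y + suc k * (y * p)    ∎
  where
  open ≤-Reasoning
  y = suc x
  p = suc x ^ k
  lem₁ : ∀ x p → suc x * p * suc x ≡ x * (p * suc x) + p * suc x
  lem₁ = solve-∀
  lem₂ : ∀ x q k p → x * (q * suc x + k * p) + p * suc x ≡ x * q * suc x + (k * (x * p) + p * suc x)
  lem₂ = solve-∀
  lem₃ : ∀ k y p → k * (y * p) + p * y ≡ suc k * (y * p)
  lem₃ = solve-∀

-- The case `k = y/2` of the previous estimate: `(1 - 1/y)^(y/2) ≥ 1/2`.
half-power : ∀ x k → suc x ≡ 2 * k → suc x ^ k ≤ 2 * x ^ k
half-power x (suc k′) e = *-cancelˡ-≤ k (+-cancelʳ-≤ (k * Y) _ _ (begin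
  k * Y + k * Y                ≡⟨ lem₁ k Y ⟩
  Y * (2 * k)                  ≡⟨ cong (Y *_) (sym e) ⟩
  Y * suc x                    ≤⟨ bernoulli⁻ x k ⟩
  x ^ k * suc x + k * Y        ≡⟨ cong (λ z → x ^ k * z + k * Y) e ⟩
  x ^ k * (2 * k) + k * Y      ≡⟨ cong (_+ k * Y) (lem₂ (x ^ k) k) ⟩
  k * (2 * x ^ k) + k * Y      ∎))
  where
  open ≤-Reasoning
  k = suc k′
  Y = suc x ^ k
  lem₁ : ∀ k y → k * y + k * y ≡ y * (2 * k)
  lem₁ = solve-∀
  lem₂ : ∀ p k → p * (2 * k) ≡ k * (2 * p)
  lem₂ = solve-∀

*-^ : ∀ x y k → (x * y) ^ k ≡ x ^ k * y ^ k
*-^ x y zero    = refl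
*-^ x y (suc k) rewrite *-^ x y k = lem x y (x ^ k) (y ^ k)
  where lem : ∀ x y p q → x * y * (p * q) ≡ x * p * (y * q)
        lem = solve-∀

m<[1+m/n]*n : ∀ m n .{{_ : NonZero n}} → m < suc (m / n) * n
m<[1+m/n]*n m n = subst (_< suc (m / n) * n) (sym (m≡m%n+[m/n]*n m n)) (+-monoˡ-< (m / n * n) (m%n<n m n))

^-pos : ∀ x k → 0 < x → 0 < x ^ k
^-pos x@(suc _) k _ = m^n>0 x k

-- The exponent `m` is padded to `R * k` by `r` factors `x`, which may be replaced by `y` on the
-- left. Then the hypothesis is raised to the power `R` and `x ^ r` cancels.
power-ratio : ∀ x y k R m → x ≤ y → 0 < x → y ^ k ≤ 2 * x ^ k → m ≤ R * k → y ^ m ≤ 2 ^ R * x ^ m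
power-ratio x y k R m x≤y 0<x h m≤Rk = *-cancelʳ-≤ _ _ (x ^ r) {{>-nonZero (^-pos x r 0<x)}} (begin
  y ^ m * x ^ r              ≤⟨ *-monoʳ-≤ (y ^ m) (^-monoˡ-≤ r x≤y) ⟩
  y ^ m * y ^ r              ≡⟨ sym (^-distribˡ-+-* y m r) ⟩
  y ^ (m + r)                ≡⟨ cong (y ^_) e ⟩
  y ^ (k * R)                ≡⟨ sym (^-*-assoc y k R) ⟩
  (y ^ k) ^ R                ≤⟨ ^-monoˡ-≤ R h ⟩
  (2 * x ^ k) ^ R            ≡⟨ *-^ 2 (x ^ k) R ⟩
  2 ^ R * (x ^ k) ^ R        ≡⟨ cong (2 ^ R *_) (^-*-assoc x k R) ⟩
  2 ^ R * x ^ (k * R)        ≡⟨ cong (λ z → 2 ^ R * x ^ z) (sym e) ⟩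
  2 ^ R * x ^ (m + r)        ≡⟨ cong (2 ^ R *_) (^-distribˡ-+-* x m r) ⟩
  2 ^ R * (x ^ m * x ^ r)    ≡⟨ sym (*-assoc (2 ^ R) _ _) ⟩
  2 ^ R * x ^ m * x ^ r      ∎)
  where
  open ≤-Reasoning
  r = R * k ∸ m
  e : m + r ≡ k * R
  e = trans (m+[n∸m]≡n m≤Rk) (*-comm R k)

2^-cancel-≤ : ∀ m n → 2 ^ m ≤ 2 ^ n → m ≤ n
2^-cancel-≤ m n h = ≮⇒≥ (λ n<m → <⇒≱ (^-monoʳ-< 2 (s≤s (s≤s z≤n)) n<m) h)

n<2^n : ∀ n → n < 2 ^ n
n<2^n zero    = s≤s z≤n
n<2^n (suc n) = ≤-trans (+-mono-≤ (m^n>0 2 n) (n<2^n n)) (≤-reflexive (cong (2 ^ n +_) (sym (+-identityʳ _))))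

-- Each group of `d` factors `1 + 1/d` contributes at least 2, so `d (r + 1)` factors already exceed
-- `2^r`.
power-bound : ∀ d p r → 0 < d → suc d ^ p ≤ 2 ^ r * d ^ p → p ≤ d * suc r
power-bound d@(suc _) p r 0<d h = ≮⇒≥ λ lt → 1+n≰n (2^-cancel-≤ (suc r) r
  (*-cancelʳ-≤ _ _ (d ^ p) {{>-nonZero (^-pos d p 0<d)}} (≤-trans (low (<⇒≤ lt)) h)))
  where
  open ≤-Reasoning
  low : d * suc r ≤ p → 2 ^ suc r * d ^ p ≤ suc d ^ p
  low le = begin
    2 ^ suc r * d ^ p                              ≡⟨ cong (2 ^ suc r *_) (cong (d ^_) (sym (m+[n∸m]≡n le))) ⟩
    2 ^ suc r * d ^ (d * suc r + k)                ≡⟨ cong (2 ^ suc r *_) (^-distribˡ-+-* d (d * suc r) k) ⟩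
    2 ^ suc r * (d ^ (d * suc r) * d ^ k)          ≡⟨ sym (*-assoc (2 ^ suc r) _ _) ⟩
    2 ^ suc r * d ^ (d * suc r) * d ^ k            ≡⟨ cong (λ z → 2 ^ suc r * z * d ^ k) (sym (^-*-assoc d d (suc r))) ⟩
    2 ^ suc r * (d ^ d) ^ suc r * d ^ k            ≡⟨ cong (_* d ^ k) (sym (*-^ 2 (d ^ d) (suc r))) ⟩
    (2 * d ^ d) ^ suc r * d ^ k                    ≤⟨ *-mono-≤ (^-monoˡ-≤ (suc r) (2*x^x≤[1+x]^x d 0<d)) (^-monoˡ-≤ k (n≤1+n d)) ⟩
    (suc d ^ d) ^ suc r * suc d ^ k                ≡⟨ cong (_* suc d ^ k) (^-*-assoc (suc d) d (suc r)) ⟩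
    suc d ^ (d * suc r) * suc d ^ k                ≡⟨ sym (^-distribˡ-+-* (suc d) (d * suc r) k) ⟩
    suc d ^ (d * suc r + k)                        ≡⟨ cong (suc d ^_) (m+[n∸m]≡n le) ⟩
    suc d ^ p                                      ∎
    where k = p ∸ d * suc r

-- With `P = M + p` the hypothesis reads `(1 + 1/d)^p (1 - 1/d²)^M ≤ 2^λ′`. The second factor is at
-- least `2^(-R)`, since `d²/2` copies of `1 - 1/d²` multiply to at least 1/2; the first is then
-- handled by `power-bound`.
discrepancy : ∀ d′ k P M λ′ R → let d = suc d′ in d * d ≡ 2 * k → 0 < d′ → M ≤ R * k →
              suc d ^ P * d′ ^ M ≤ 2 ^ λ′ * d ^ (P + M) → P ≤ M + d * suc (R + λ′)
discrepancy d′ k P M λ′ R dd 0<d′ M≤Rk h with ≤-total P M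
... | inj₁ P≤M = ≤-trans P≤M (m≤m+n M _)
... | inj₂ M≤P = subst (_≤ M + d * suc (R + λ′)) (m+[n∸m]≡n M≤P)
                   (+-monoʳ-≤ M (power-bound d p (R + λ′) (s≤s z≤n) main))
  where
  open ≤-Reasoning
  d = suc d′
  p = P ∸ M
  x = d′ * suc d
  sx : suc x ≡ d * d
  sx = lem d′ where lem : ∀ a → suc (a * suc (suc a)) ≡ suc a * suc a
                    lem = solve-∀
  0<x : 0 < x
  0<x = *-mono-≤ 0<d′ (s≤s z≤n)
  q : (d * d) ^ M ≤ 2 ^ R * x ^ M
  q = power-ratio x (d * d) k R M (subst (x ≤_) sx (n≤1+n x)) 0<x
        (subst (λ z → z ^ k ≤ 2 * x ^ k) sx (half-power x k (trans sx dd))) M≤Rk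
  main : suc d ^ p ≤ 2 ^ (R + λ′) * d ^ p
  main = *-cancelʳ-≤ _ _ ((d * d) ^ M) {{>-nonZero (^-pos (d * d) M (s≤s z≤n))}} (begin
    suc d ^ p * (d * d) ^ M                     ≤⟨ *-monoʳ-≤ (suc d ^ p) q ⟩
    suc d ^ p * (2 ^ R * x ^ M)                 ≡⟨ cong (λ z → suc d ^ p * (2 ^ R * z)) (*-^ d′ (suc d) M) ⟩
    suc d ^ p * (2 ^ R * (d′ ^ M * suc d ^ M))  ≡⟨ l₁ (suc d ^ p) (2 ^ R) (d′ ^ M) (suc d ^ M) ⟩
    2 ^ R * ((suc d ^ M * suc d ^ p) * d′ ^ M)  ≡⟨ cong (λ z → 2 ^ R * (z * d′ ^ M)) (trans (sym (^-distribˡ-+-* (suc d) M p)) (cong (suc d ^_) (m+[n∸m]≡n M≤P))) ⟩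
    2 ^ R * (suc d ^ P * d′ ^ M)                ≤⟨ *-monoʳ-≤ (2 ^ R) h ⟩
    2 ^ R * (2 ^ λ′ * d ^ (P + M))              ≡⟨ cong (λ z → 2 ^ R * (2 ^ λ′ * d ^ (z + M))) (sym (m+[n∸m]≡n M≤P)) ⟩
    2 ^ R * (2 ^ λ′ * d ^ (M + p + M))          ≡⟨ cong (λ z → 2 ^ R * (2 ^ λ′ * d ^ z)) (l₂ M p) ⟩
    2 ^ R * (2 ^ λ′ * d ^ (p + (M + M)))        ≡⟨ cong (λ z → 2 ^ R * (2 ^ λ′ * z)) (trans (^-distribˡ-+-* d p (M + M)) (cong (d ^ p *_) (trans (^-distribˡ-+-* d M M) (sym (*-^ d d M))))) ⟩
    2 ^ R * (2 ^ λ′ * (d ^ p * (d * d) ^ M))    ≡⟨ l₃ (2 ^ R) (2 ^ λ′) (d ^ p) ((d * d) ^ M) ⟩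
    2 ^ R * 2 ^ λ′ * d ^ p * (d * d) ^ M        ≡⟨ cong (λ z → z * d ^ p * (d * d) ^ M) (sym (^-distribˡ-+-* 2 R λ′)) ⟩
    2 ^ (R + λ′) * d ^ p * (d * d) ^ M          ∎)
    where
    l₁ : ∀ a b c e → a * (b * (c * e)) ≡ b * ((e * a) * c)
    l₁ = solve-∀
    l₂ : ∀ M p → M + p + M ≡ p + (M + M)
    l₂ = solve-∀
    l₃ : ∀ a b c e → a * (b * (c * e)) ≡ a * b * c * e
    l₃ = solve-∀

-- The 5 comes from `d² (1 + R + λ′)` with `R = 1 + N/k`: the term `d² (N/k)` is at most `2 N`, and
-- the terms `d²`, `d²` and `d² λ′` are at most `N` each.
discrepancy-scaled : ∀ d′ k P M λ′ N → let d = suc d′ in d * d ≡ 2 * k → 0 < d′ → M ≤ N → 0 < λ′ → d * d * λ′ ≤ N →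
                     suc d ^ P * d′ ^ M ≤ 2 ^ λ′ * d ^ (P + M) → d * P ≤ d * M + 5 * N
discrepancy-scaled d′ k@(suc _) P M λ′ N dd 0<d′ M≤N 0<λ N≥ h = begin
  d * P                                   ≤⟨ *-monoʳ-≤ d (discrepancy d′ k P M λ′ R dd 0<d′ (≤-trans M≤N (<⇒≤ (m<[1+m/n]*n N k))) h) ⟩
  d * (M + d * suc (R + λ′))              ≡⟨ l₁ d M (N / k) λ′ ⟩
  d * M + (d * d * (N / k) + d * d + d * d + d * d * λ′) ≤⟨ +-monoʳ-≤ (d * M) (+-mono-≤ (+-mono-≤ (+-mono-≤ a₁ a₂) a₂) N≥) ⟩
  d * M + (2 * N + N + N + N)             ≡⟨ l₂ (d * M) N ⟩
  d * M + 5 * N                           ∎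
  where
  open ≤-Reasoning
  d = suc d′
  R = suc (N / k)
  a₂ : d * d ≤ N
  a₂ = ≤-trans (≤-trans (≤-reflexive (sym (*-identityʳ (d * d)))) (*-monoʳ-≤ (d * d) 0<λ)) N≥
  a₁ : d * d * (N / k) ≤ 2 * N
  a₁ = begin
    d * d * (N / k)   ≡⟨ cong (_* (N / k)) dd ⟩
    2 * k * (N / k)   ≡⟨ l₃ k (N / k) ⟩
    2 * (N / k * k)   ≤⟨ *-monoʳ-≤ 2 (m/n*n≤m N k) ⟩
    2 * N             ∎
    where l₃ : ∀ k x → 2 * k * x ≡ 2 * (x * k)
          l₃ = solve-∀
  l₁ : ∀ d M x l → d * (M + d * suc (suc x + l)) ≡ d * M + (d * d * x + d * d + d * d + d * d * l)
  l₁ = solve-∀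
  l₂ : ∀ a N → a + (2 * N + N + N + N) ≡ a + 5 * N
  l₂ = solve-∀
discrepancy-scaled d′ zero P M λ′ N dd = λ _ _ _ _ _ → ⊥-elim (1+n≢0 (trans dd refl))

-- Halving a list while preserving all test counts

cnt : ∀ {A : Set} → (A → Bool) → List A → ℕ
cnt T xs = ∑ xs (λ x → ⟦ T x ⟧)

cnt≤length : ∀ {A : Set} (T : A → Bool) xs → cnt T xs ≤ length xs
cnt≤length T xs = ≤-trans (∑-mono xs (λ x → ⟦⟧≤1 (T x))) (≤-reflexive (trans (∑-const xs 1) (*-identityʳ _)))

module Halving {A : Set} (Ts : List (A → Bool)) (d′ : ℕ) where

  private
    d = suc d′

  -- The factors `1 + 1/d` and `1 - 1/d` of the potential, scaled by `d`; an item outside the test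
  -- contributes the neutral factor.
  up dn : (A → Bool) → A → ℕ
  up T x = if T x then suc d else d
  dn T x = if T x then d′ else d

  up+dn : ∀ T x → up T x + dn T x ≡ 2 * d
  up+dn T x with T x
  ... | true  = lem d′ where lem : ∀ d → suc (suc d) + d ≡ 2 * suc d
                             lem = solve-∀
  ... | false = cong (d +_) (sym (+-identityʳ d))

  ∏ : (A → ℕ) → List A → ℕ
  ∏ f []       = 1
  ∏ f (x ∷ xs) = f x * ∏ f xs

  -- Both signs are tracked for every test, since the error is needed in both directions and either
  -- part may be the one that is kept.
  potential : (α β : (A → Bool) → ℕ) → List A → List A → ℕ
  potential α β K D = ∑ Ts (λ T → α T * (∏ (up T) K * ∏ (dn T) D) + β T * (∏ (dn T) K * ∏ (up T) D))

  -- Method of conditional expectations. The potentials after the two possible placements of an item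
  -- sum to `2 d` times the present one, so one placement multiplies it by at most `d`. The factors
  -- of items already placed are stored in `α` and `β`.
  signs : ∀ xs α β → Σ (List A) λ K → Σ (List A) λ D →
          length K + length D ≡ length xs × (∀ T → cnt T K + cnt T D ≡ cnt T xs) ×
          (∀ {x} → x ∈ K ⊎ x ∈ D → x ∈ xs) ×
          potential α β K D ≤ d ^ length xs * ∑ Ts (λ T → α T + β T)
  signs [] α β = [] , [] , refl , (λ T → refl) , (λ { (inj₁ ()) ; (inj₂ ()) }) ,
    ≤-reflexive (trans (∑-cong Ts (λ T → cong₂ _+_ (*-identityʳ (α T)) (*-identityʳ (β T)))) (sym (*-identityˡ _)))
  signs (x ∷ xs) α β with ≤-total (∑ Ts (λ T → α T * up T x + β T * dn T x)) (d * ∑ Ts (λ T → α T + β T))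
  ... | inj₁ le with signs xs (λ T → α T * up T x) (λ T → β T * dn T x)
  ... | K , D , len , ct , sub , pot = x ∷ K , D , cong suc len , (λ T → trans (+-assoc ⟦ T x ⟧ _ _) (cong (⟦ T x ⟧ +_) (ct T))) ,
    (λ { (inj₁ (here e)) → here e ; (inj₁ (there p)) → there (sub (inj₁ p)) ; (inj₂ p) → there (sub (inj₂ p)) }) , (begin
    potential α β (x ∷ K) D ≡⟨ ∑-cong Ts (λ T → l₁ (α T) (up T x) (∏ (up T) K) (∏ (dn T) D) (β T) (dn T x) (∏ (dn T) K) (∏ (up T) D)) ⟩
    potential (λ T → α T * up T x) (λ T → β T * dn T x) K D ≤⟨ pot ⟩
    d ^ length xs * ∑ Ts (λ T → α T * up T x + β T * dn T x) ≤⟨ *-monoʳ-≤ (d ^ length xs) le ⟩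
    d ^ length xs * (d * ∑ Ts (λ T → α T + β T)) ≡⟨ l₂ (d ^ length xs) d _ ⟩
    d * d ^ length xs * ∑ Ts (λ T → α T + β T) ∎)
    where
    open ≤-Reasoning
    l₁ : ∀ a u p q b v r t → a * (u * p * q) + b * (v * r * t) ≡ a * u * (p * q) + b * v * (r * t)
    l₁ = solve-∀
    l₂ : ∀ p d s → p * (d * s) ≡ d * p * s
    l₂ = solve-∀
  signs (x ∷ xs) α β | inj₂ ge with signs xs (λ T → α T * dn T x) (λ T → β T * up T x)
  ... | K , D , len , ct , sub , pot = K , x ∷ D , trans (+-suc (length K) _) (cong suc len) ,
    (λ T → trans (l₃ (cnt T K) ⟦ T x ⟧ (cnt T D)) (cong (⟦ T x ⟧ +_) (ct T))) ,
    (λ { (inj₂ (here e)) → here e ; (inj₂ (there p)) → there (sub (inj₂ p)) ; (inj₁ p) → there (sub (inj₁ p)) }) , (begin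
    potential α β K (x ∷ D) ≡⟨ ∑-cong Ts (λ T → l₁ (α T) (dn T x) (∏ (up T) K) (∏ (dn T) D) (β T) (up T x) (∏ (dn T) K) (∏ (up T) D)) ⟩
    potential (λ T → α T * dn T x) (λ T → β T * up T x) K D ≤⟨ pot ⟩
    d ^ length xs * ∑ Ts (λ T → α T * dn T x + β T * up T x) ≤⟨ *-monoʳ-≤ (d ^ length xs) le ⟩
    d ^ length xs * (d * ∑ Ts (λ T → α T + β T)) ≡⟨ l₂ (d ^ length xs) d _ ⟩
    d * d ^ length xs * ∑ Ts (λ T → α T + β T) ∎)
    where
    open ≤-Reasoning
    l₁ : ∀ a u p q b v r t → a * (p * (u * q)) + b * (r * (v * t)) ≡ a * u * (p * q) + b * v * (r * t)
    l₁ = solve-∀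
    l₂ : ∀ p d s → p * (d * s) ≡ d * p * s
    l₂ = solve-∀
    l₃ : ∀ a b c → a + (b + c) ≡ b + (a + c)
    l₃ = solve-∀
    S⁺ = ∑ Ts (λ T → α T * up T x + β T * dn T x)
    S⁻ = ∑ Ts (λ T → α T * dn T x + β T * up T x)
    S = ∑ Ts (λ T → α T + β T)
    both : S⁻ + S⁺ ≡ d * S + d * S
    both = trans (sym (∑-+ Ts _ _)) (trans (∑-cong Ts pt) (trans (∑-*ˡ Ts (2 * d) _) (l₅ d S)))
      where
      l₄ : ∀ a b u v → a * v + b * u + (a * u + b * v) ≡ (u + v) * (a + b)
      l₄ = solve-∀
      l₅ : ∀ d s → 2 * d * s ≡ d * s + d * s
      l₅ = solve-∀
      pt : ∀ T → α T * dn T x + β T * up T x + (α T * up T x + β T * dn T x) ≡ 2 * d * (α T + β T)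
      pt T = trans (l₄ (α T) (β T) (up T x) (dn T x)) (cong (_* (α T + β T)) (up+dn T x))
    le : S⁻ ≤ d * S
    le = +-cancelʳ-≤ (d * S) _ _ (≤-trans (+-monoʳ-≤ S⁻ ge) (≤-reflexive both))

  ∏-up : ∀ T K → ∏ (up T) K * d ^ cnt T K ≡ suc d ^ cnt T K * d ^ length K
  ∏-up T [] = refl
  ∏-up T (x ∷ K) with T x
  ... | true  = trans (l₁ (suc d) (∏ (up T) K) d (d ^ cnt T K)) (trans (cong (suc d * d *_) (∏-up T K)) (l₁ (suc d) d (suc d ^ cnt T K) (d ^ length K)))
    where l₁ : ∀ a b c e → a * b * (c * e) ≡ a * c * (b * e)
          l₁ = solve-∀
  ... | false = trans (*-assoc d (∏ (up T) K) (d ^ cnt T K)) (trans (cong (d *_) (∏-up T K)) (l₂ d (suc d ^ cnt T K) (d ^ length K)))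
    where l₂ : ∀ a b c → a * (b * c) ≡ b * (a * c)
          l₂ = solve-∀

  ∏-dn : ∀ T K → ∏ (dn T) K * d ^ cnt T K ≡ d′ ^ cnt T K * d ^ length K
  ∏-dn T [] = refl
  ∏-dn T (x ∷ K) with T x
  ... | true  = trans (l₁ d′ (∏ (dn T) K) d (d ^ cnt T K)) (trans (cong (d′ * d *_) (∏-dn T K)) (l₁ d′ d (d′ ^ cnt T K) (d ^ length K)))
    where l₁ : ∀ a b c e → a * b * (c * e) ≡ a * c * (b * e)
          l₁ = solve-∀
  ... | false = trans (*-assoc d (∏ (dn T) K) (d ^ cnt T K)) (trans (cong (d *_) (∏-dn T K)) (l₂ d (d′ ^ cnt T K) (d ^ length K)))
    where l₂ : ∀ a b c → a * (b * c) ≡ b * (a * c)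
          l₂ = solve-∀

  -- The potential of one test after cancelling the items outside it; `2 * length Ts` is the initial
  -- value of the whole potential.
  Balanced : (A → Bool) → List A → List A → Set
  Balanced T K D = suc d ^ cnt T K * d′ ^ cnt T D ≤ 2 * length Ts * d ^ (cnt T K + cnt T D)

  to-balanced : ∀ T K D → ∏ (up T) K * ∏ (dn T) D ≤ d ^ (length K + length D) * (2 * length Ts) → Balanced T K D
  to-balanced T K D h = *-cancelʳ-≤ _ _ (d ^ l) {{>-nonZero (^-pos d l (s≤s z≤n))}} (begin
    suc d ^ P * d′ ^ M * d ^ l                            ≡⟨ cong (suc d ^ P * d′ ^ M *_) (^-distribˡ-+-* d (length K) (length D)) ⟩
    suc d ^ P * d′ ^ M * (d ^ length K * d ^ length D)    ≡⟨ l₁ (suc d ^ P) (d′ ^ M) (d ^ length K) (d ^ length D) ⟩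
    suc d ^ P * d ^ length K * (d′ ^ M * d ^ length D)    ≡⟨ cong₂ _*_ (sym (∏-up T K)) (sym (∏-dn T D)) ⟩
    ∏ (up T) K * d ^ P * (∏ (dn T) D * d ^ M)             ≡⟨ l₁ (∏ (up T) K) (d ^ P) (∏ (dn T) D) (d ^ M) ⟩
    ∏ (up T) K * ∏ (dn T) D * (d ^ P * d ^ M)             ≤⟨ *-monoˡ-≤ _ h ⟩
    d ^ l * (2 * length Ts) * (d ^ P * d ^ M)             ≡⟨ cong (d ^ l * (2 * length Ts) *_) (sym (^-distribˡ-+-* d P M)) ⟩
    d ^ l * (2 * length Ts) * d ^ (P + M)                 ≡⟨ l₂ (d ^ l) (2 * length Ts) _ ⟩
    2 * length Ts * d ^ (P + M) * d ^ l                   ∎)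
    where
    open ≤-Reasoning
    l = length K + length D
    P = cnt T K
    M = cnt T D
    l₁ : ∀ a b c e → a * b * (c * e) ≡ a * c * (b * e)
    l₁ = solve-∀
    l₂ : ∀ a b c → a * b * c ≡ b * c * a
    l₂ = solve-∀

  Half : List A → Set
  Half xs = Σ (List A) λ K → 2 * length K ≤ length xs × (∀ {x} → x ∈ K → x ∈ xs) ×
            (∀ T → T ∈ Ts → Σ ℕ λ M → cnt T K + M ≡ cnt T xs ×
              suc d ^ cnt T K * d′ ^ M ≤ 2 * length Ts * d ^ (cnt T K + M) ×
              suc d ^ M * d′ ^ cnt T K ≤ 2 * length Ts * d ^ (M + cnt T K))

  potential-bounds : ∀ K D → potential (λ _ → 1) (λ _ → 1) K D ≤ d ^ (length K + length D) * (2 * length Ts) →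
                     ∀ T → T ∈ Ts → Balanced T K D × Balanced T D K
  potential-bounds K D total T T∈ =
    to-balanced T K D (≤-trans (≤-trans (≤-reflexive (sym (*-identityˡ _))) (m≤m+n _ _)) all) ,
    to-balanced T D K (≤-trans (≤-trans (≤-reflexive (trans (*-comm (∏ (up T) D) _) (sym (*-identityˡ _)))) (m≤n+m _ (1 * (∏ (up T) K * ∏ (dn T) D))))
      (subst (λ z → val T ≤ d ^ z * (2 * length Ts)) (+-comm (length K) (length D)) all))
    where
    val : (A → Bool) → ℕ
    val T = 1 * (∏ (up T) K * ∏ (dn T) D) + 1 * (∏ (dn T) K * ∏ (up T) D)
    all : val T ≤ d ^ (length K + length D) * (2 * length Ts)
    all = ≤-trans (∑-∈ Ts val T∈) total

  half′ : ∀ xs → Half xs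
  half′ xs with signs xs (λ _ → 1) (λ _ → 1)
  ... | K , D , len , ct , sub , pot = choice (≤-total (length K) (length D))
    where
    balanced = potential-bounds K D
      (≤-trans pot (≤-reflexive (cong₂ (λ z y → d ^ z * y) (sym len) (trans (∑-const Ts 2) (*-comm (length Ts) 2)))))
    -- The shorter part is kept. The potential is symmetric in `K` and `D`, so the bounds hold for
    -- either.
    choice : length K ≤ length D ⊎ length D ≤ length K → Half xs
    choice (inj₁ K≤D) =
      K , ≤-trans (≤-reflexive (cong (length K +_) (+-identityʳ _))) (≤-trans (+-monoʳ-≤ _ K≤D) (≤-reflexive len)) ,
      (λ p → sub (inj₁ p)) , λ T T∈ → cnt T D , ct T , balanced T T∈
    choice (inj₂ D≤K) =
      D , ≤-trans (≤-reflexive (cong (length D +_) (+-identityʳ _))) (≤-trans (+-monoˡ-≤ _ D≤K) (≤-reflexive len)) ,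
      (λ p → sub (inj₂ p)) , λ T T∈ → cnt T K , trans (+-comm (cnt T D) _) (ct T) , proj₂ (balanced T T∈) , proj₁ (balanced T T∈)

  abstract
    half : ∀ xs → Half xs
    half = half′

  halve : List A → List A
  halve xs = proj₁ (half xs)

  2*length-halve : ∀ xs → 2 * length (halve xs) ≤ length xs
  2*length-halve xs = proj₁ (proj₂ (half xs))

  halve⊆ : ∀ xs {x} → x ∈ halve xs → x ∈ xs
  halve⊆ xs = proj₁ (proj₂ (proj₂ (half xs)))

  -- Kept items count double, and `2 P - (P + M) = P - M`, so the error is the discrepancy between
  -- kept and discarded items.
  halve-error : ∀ k λ′ → d * d ≡ 2 * k → 0 < d′ → 0 < λ′ → 2 * length Ts ≤ 2 ^ λ′ →
                ∀ T → T ∈ Ts → ∀ xs → d * d * λ′ ≤ length xs →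
                d * (2 * cnt T (halve xs)) ≤ d * cnt T xs + 5 * length xs ×
                d * cnt T xs ≤ d * (2 * cnt T (halve xs)) + 5 * length xs
  halve-error k λ′ dd 0<d′ 0<λ lenTs T T∈ xs big with proj₂ (proj₂ (proj₂ (half xs))) T T∈
  ... | M , eq , bal₁ , bal₂ = first , second
    where
    open ≤-Reasoning
    P = cnt T (halve xs)
    N = length xs
    P+M≤N : P + M ≤ N
    P+M≤N = subst (_≤ N) (sym eq) (cnt≤length T xs)
    b₁ : d * P ≤ d * M + 5 * N
    b₁ = discrepancy-scaled d′ k P M λ′ N dd 0<d′ (≤-trans (m≤n+m M P) P+M≤N) 0<λ big (≤-trans bal₁ (*-monoˡ-≤ _ lenTs))
    b₂ : d * M ≤ d * P + 5 * N
    b₂ = discrepancy-scaled d′ k M P λ′ N dd 0<d′ (≤-trans (m≤m+n P M) P+M≤N) 0<λ big (≤-trans bal₂ (*-monoˡ-≤ _ lenTs))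
    l₁ : ∀ d p → d * (2 * p) ≡ d * p + d * p
    l₁ = solve-∀
    l₂ : ∀ d p m n → d * p + (d * m + n) ≡ d * (p + m) + n
    l₂ = solve-∀
    l₃ : ∀ d p n → d * p + (d * p + n) ≡ d * (2 * p) + n
    l₃ = solve-∀
    first : d * (2 * P) ≤ d * cnt T xs + 5 * N
    first = begin
      d * (2 * P)              ≡⟨ l₁ d P ⟩
      d * P + d * P            ≤⟨ +-monoʳ-≤ (d * P) b₁ ⟩
      d * P + (d * M + 5 * N)  ≡⟨ l₂ d P M (5 * N) ⟩
      d * (P + M) + 5 * N      ≡⟨ cong (λ z → d * z + 5 * N) eq ⟩
      d * cnt T xs + 5 * N     ∎
    second : d * cnt T xs ≤ d * (2 * P) + 5 * N
    second = begin
      d * cnt T xs             ≡⟨ cong (d *_) (sym eq) ⟩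
      d * (P + M)              ≡⟨ *-distribˡ-+ d P M ⟩
      d * P + d * M            ≤⟨ +-monoʳ-≤ (d * P) b₂ ⟩
      d * P + (d * P + 5 * N)  ≡⟨ l₃ d P (5 * N) ⟩
      d * (2 * P) + 5 * N      ∎

-- Merge-and-reduce sketches: the items in the j-th buffer stand for 2^j items each.
module Sketch {A : Set} (halve : List A → List A) (N : ℕ) where

  -- Beyond the last buffer items are dropped. In `push-error` the bound `2 ^ L` on the number of
  -- represented items excludes this.
  push : ∀ {L} → List A → Vec (List A) L → Vec (List A) L
  push xs []       = []
  push xs (b ∷ bs) with length (xs ++ b) <? N
  ... | yes _ = (xs ++ b) ∷ bs
  ... | no  _ = [] ∷ push (halve (xs ++ b)) bs

  push-short : ∀ {L} xs (bs : Vec (List A) L) → 0 < N → VAll.All (λ b → length b < N) bs → VAll.All (λ b → length b < N) (push xs bs)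
  push-short xs []       0<N VAll.[] = VAll.[]
  push-short xs (b ∷ bs) 0<N (_ VAll.∷ ps) with length (xs ++ b) <? N
  ... | yes p = p VAll.∷ ps
  ... | no  _ = 0<N VAll.∷ push-short _ bs 0<N ps

  -- Weights become multiplicities, so that weighted counts on the sketch are plain counts on a
  -- list.
  flat : ∀ {L} → Vec (List A) L → List A
  flat []       = []
  flat (b ∷ bs) = b ++ flat bs ++ flat bs

  -- Each represented item pays 5/d for every buffer it has yet to pass; this bounds the accumulated error.
  credit : ∀ {L} → Vec (List A) L → ℕ
  credit []                  = 0
  credit {suc L} (b ∷ bs) = suc L * length b + 2 * credit bs

  length-flat : ∀ {L} b (bs : Vec (List A) L) → length (flat (b ∷ bs)) ≡ length b + 2 * length (flat bs)
  length-flat b bs = trans (length-++ b) (cong (length b +_) (trans (length-++ (flat bs)) (cong (length (flat bs) +_) (sym (+-identityʳ _)))))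

  cnt-flat : ∀ {L} T b (bs : Vec (List A) L) → cnt T (flat (b ∷ bs)) ≡ cnt T b + 2 * cnt T (flat bs)
  cnt-flat T b bs = trans (∑-++ b _ _) (cong (cnt T b +_) (trans (∑-++ (flat bs) _ _) (cong (cnt T (flat bs) +_) (sym (+-identityʳ _)))))

  module Error (2*length-halve : ∀ xs → 2 * length (halve xs) ≤ length xs) (d : ℕ) where

    HalveError : (A → Bool) → Set
    HalveError T = ∀ xs → N ≤ length xs →
                   d * (2 * cnt T (halve xs)) ≤ d * cnt T xs + 5 * length xs ×
                   d * cnt T xs ≤ d * (2 * cnt T (halve xs)) + 5 * length xs

    -- No equality, as the part kept by `halve` may be less than half.
    push-mass : ∀ {L} xs (bs : Vec (List A) L) → length (flat (push xs bs)) ≤ length xs + length (flat bs)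
    push-mass xs []       = z≤n
    push-mass xs (b ∷ bs) with length (xs ++ b) <? N
    ... | yes _ = ≤-reflexive (trans (length-flat (xs ++ b) bs) (trans (cong (_+ 2 * length (flat bs)) (length-++ xs)) (trans (+-assoc (length xs) _ _) (cong (length xs +_) (sym (length-flat b bs))))))
    ... | no  _ = begin
      length (flat ([] ∷ push h bs))            ≡⟨ length-flat [] (push h bs) ⟩
      2 * length (flat (push h bs))             ≤⟨ *-monoʳ-≤ 2 (push-mass h bs) ⟩
      2 * (length h + length (flat bs))         ≡⟨ *-distribˡ-+ 2 (length h) _ ⟩
      2 * length h + 2 * length (flat bs)       ≤⟨ +-monoˡ-≤ _ (2*length-halve (xs ++ b)) ⟩
      length (xs ++ b) + 2 * length (flat bs)   ≡⟨ cong (_+ 2 * length (flat bs)) (length-++ xs) ⟩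
      length xs + length b + 2 * length (flat bs) ≡⟨ +-assoc (length xs) _ _ ⟩
      length xs + (length b + 2 * length (flat bs)) ≡⟨ cong (length xs +_) (sym (length-flat b bs)) ⟩
      length xs + length (flat (b ∷ bs))        ∎
      where open ≤-Reasoning
            h = halve (xs ++ b)

    -- Amortised analysis: halving `l` items moves at most `l` represented items one buffer further,
    -- which releases `5 l` of credit. This is exactly the error allowed to one halving.
    push-error : ∀ {L} T → HalveError T → ∀ xs (bs : Vec (List A) L) → length xs + length (flat bs) < 2 ^ L →
      d * cnt T (flat (push xs bs)) + 5 * credit (push xs bs) ≤ d * (cnt T xs + cnt T (flat bs)) + 5 * (L * length xs + credit bs) ×
      d * (cnt T xs + cnt T (flat bs)) + 5 * credit (push xs bs) ≤ d * cnt T (flat (push xs bs)) + 5 * (L * length xs + credit bs)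
    push-error T he [] [] lt = ≤-refl , ≤-refl
    push-error T he (x ∷ xs) [] (s≤s ())
    push-error {suc L} T he xs (b ∷ bs) lt with length (xs ++ b) <? N
    ... | yes _ = ≤-reflexive (cong₂ (λ y z → d * y + 5 * z) ec el) , ≤-reflexive (cong₂ (λ y z → d * y + 5 * z) (sym ec) el)
      where
      l₁ : ∀ L a b c → suc L * (a + b) + c ≡ suc L * a + (suc L * b + c)
      l₁ = solve-∀
      ec : cnt T (flat ((xs ++ b) ∷ bs)) ≡ cnt T xs + cnt T (flat (b ∷ bs))
      ec = trans (∑-++ (xs ++ b) _ _) (trans (cong (_+ _) (∑-++ xs b _)) (trans (+-assoc (cnt T xs) _ _) (cong (cnt T xs +_) (sym (∑-++ b _ _)))))
      el : credit ((xs ++ b) ∷ bs) ≡ suc L * length xs + credit (b ∷ bs)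
      el = trans (cong (λ z → suc L * z + 2 * credit bs) (length-++ xs)) (l₁ L (length xs) (length b) _)
    ... | no ¬p = first , second
      where
      open ≤-Reasoning
      ys = xs ++ b
      h = halve ys
      l = length ys
      F = cnt T (flat bs)
      C = credit bs
      C′ = credit (push h bs)
      V = cnt T (flat (push h bs))
      hs = he ys (≮⇒≥ ¬p)
      -- In units of the next buffer the represented mass halves, and so does the remaining
      -- capacity.
      small : length h + length (flat bs) < 2 ^ L
      small = *-cancelˡ-< 2 _ _ (begin-strict
        2 * (length h + length (flat bs))            ≡⟨ *-distribˡ-+ 2 (length h) _ ⟩
        2 * length h + 2 * length (flat bs)          ≤⟨ +-monoˡ-≤ _ (2*length-halve ys) ⟩
        l + 2 * length (flat bs)                     ≡⟨ cong (_+ 2 * length (flat bs)) (length-++ xs) ⟩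
        length xs + length b + 2 * length (flat bs)  ≡⟨ +-assoc (length xs) _ _ ⟩
        length xs + (length b + 2 * length (flat bs)) ≡⟨ cong (length xs +_) (sym (length-flat b bs)) ⟩
        length xs + length (flat (b ∷ bs))           <⟨ lt ⟩
        2 * 2 ^ L                                    ∎)
      ih = push-error T he h bs small
      eqc : cnt T ys + 2 * F ≡ cnt T xs + cnt T (flat (b ∷ bs))
      eqc = trans (cong (_+ 2 * F) (∑-++ xs b _)) (trans (+-assoc (cnt T xs) _ _) (cong (cnt T xs +_) (sym (cnt-flat T b bs))))
      eql : suc L * l + 2 * C ≡ suc L * length xs + credit (b ∷ bs)
      eql = trans (cong (λ z → suc L * z + 2 * C) (length-++ xs)) (l₁ L (length xs) (length b) _)
        where l₁ : ∀ L a b c → suc L * (a + b) + c ≡ suc L * a + (suc L * b + c)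
              l₁ = solve-∀
      cr : L * (2 * length h) ≤ L * l
      cr = *-monoʳ-≤ L (2*length-halve ys)
      first : d * cnt T (flat ([] ∷ push h bs)) + 5 * credit ([] ∷ push h bs) ≤ _
      first = begin
        d * cnt T (flat ([] ∷ push h bs)) + 5 * (suc L * 0 + 2 * C′)   ≡⟨ cong (λ z → d * z + 5 * (suc L * 0 + 2 * C′)) (cnt-flat T [] (push h bs)) ⟩
        d * (2 * V) + 5 * (suc L * 0 + 2 * C′)                         ≡⟨ l₁ d V L C′ ⟩
        2 * (d * V + 5 * C′)                                           ≤⟨ *-monoʳ-≤ 2 (proj₁ ih) ⟩
        2 * (d * (cnt T h + F) + 5 * (L * length h + C))               ≡⟨ l₂ d (cnt T h) F L (length h) C ⟩
        d * (2 * cnt T h) + (d * (2 * F) + 5 * (L * (2 * length h) + 2 * C)) ≤⟨ +-mono-≤ (proj₁ hs) (+-monoʳ-≤ (d * (2 * F)) (*-monoʳ-≤ 5 (+-monoˡ-≤ (2 * C) cr))) ⟩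
        d * cnt T ys + 5 * l + (d * (2 * F) + 5 * (L * l + 2 * C))     ≡⟨ l₃ d (cnt T ys) l F L C ⟩
        d * (cnt T ys + 2 * F) + 5 * (suc L * l + 2 * C)               ≡⟨ cong₂ (λ y z → d * y + 5 * z) eqc eql ⟩
        d * (cnt T xs + cnt T (flat (b ∷ bs))) + 5 * (suc L * length xs + credit (b ∷ bs)) ∎
        where
        l₁ : ∀ d V L C → d * (2 * V) + 5 * (suc L * 0 + 2 * C) ≡ 2 * (d * V + 5 * C)
        l₁ = solve-∀
        l₂ : ∀ d h F L k C → 2 * (d * (h + F) + 5 * (L * k + C)) ≡ d * (2 * h) + (d * (2 * F) + 5 * (L * (2 * k) + 2 * C))
        l₂ = solve-∀
        l₃ : ∀ d y l F L C → d * y + 5 * l + (d * (2 * F) + 5 * (L * l + 2 * C)) ≡ d * (y + 2 * F) + 5 * (suc L * l + 2 * C)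
        l₃ = solve-∀
      second : d * (cnt T xs + cnt T (flat (b ∷ bs))) + 5 * credit ([] ∷ push h bs) ≤ _
      second = begin
        d * (cnt T xs + cnt T (flat (b ∷ bs))) + 5 * (suc L * 0 + 2 * C′) ≡⟨ cong (λ z → d * z + 5 * (suc L * 0 + 2 * C′)) (sym eqc) ⟩
        d * (cnt T ys + 2 * F) + 5 * (suc L * 0 + 2 * C′)              ≡⟨ l₁ d (cnt T ys) F L C′ ⟩
        d * cnt T ys + (d * (2 * F) + 5 * (2 * C′))                    ≤⟨ +-monoˡ-≤ _ (proj₂ hs) ⟩
        d * (2 * cnt T h) + 5 * l + (d * (2 * F) + 5 * (2 * C′))       ≡⟨ l₂ d (cnt T h) l F C′ ⟩
        5 * l + 2 * (d * (cnt T h + F) + 5 * C′)                       ≤⟨ +-monoʳ-≤ (5 * l) (*-monoʳ-≤ 2 (proj₂ ih)) ⟩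
        5 * l + 2 * (d * V + 5 * (L * length h + C))                   ≡⟨ l₃ l d V L (length h) C ⟩
        d * (2 * V) + (5 * l + 5 * (L * (2 * length h) + 2 * C))       ≤⟨ +-monoʳ-≤ (d * (2 * V)) (+-monoʳ-≤ (5 * l) (*-monoʳ-≤ 5 (+-monoˡ-≤ (2 * C) cr))) ⟩
        d * (2 * V) + (5 * l + 5 * (L * l + 2 * C))                    ≡⟨ cong (d * (2 * V) +_) (l₄ l L C) ⟩
        d * (2 * V) + 5 * (suc L * l + 2 * C)                          ≡⟨ cong₂ (λ y z → d * y + 5 * z) (sym (cnt-flat T [] (push h bs))) eql ⟩
        d * cnt T (flat ([] ∷ push h bs)) + 5 * (suc L * length xs + credit (b ∷ bs)) ∎
        where
        l₁ : ∀ d y F L C → d * (y + 2 * F) + 5 * (suc L * 0 + 2 * C) ≡ d * y + (d * (2 * F) + 5 * (2 * C))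
        l₁ = solve-∀
        l₂ : ∀ d h l F C → d * (2 * h) + 5 * l + (d * (2 * F) + 5 * (2 * C)) ≡ 5 * l + 2 * (d * (h + F) + 5 * C)
        l₂ = solve-∀
        l₃ : ∀ l d V L k C → 5 * l + 2 * (d * V + 5 * (L * k + C)) ≡ d * (2 * V) + (5 * l + 5 * (L * (2 * k) + 2 * C))
        l₃ = solve-∀
        l₄ : ∀ l L C → 5 * l + 5 * (L * l + 2 * C) ≡ 5 * (suc L * l + 2 * C)
        l₄ = solve-∀

  sketchFrom : ∀ {L} → (A → Bool) → Vec (List A) L → List A → Vec (List A) L
  sketchFrom rel = foldl (λ bs e → if rel e then push (e ∷ []) bs else bs)

  module _ (2*length-halve : ∀ xs → 2 * length (halve xs) ≤ length xs) (d : ℕ) (rel : A → Bool) where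
    open Error 2*length-halve d

    sketchFrom-error : ∀ {L} T → HalveError T → ∀ s (bs : Vec (List A) L) → cnt rel s + length (flat bs) < 2 ^ L →
      let bs′ = sketchFrom rel bs s ; t = ∑ s (λ e → if rel e then ⟦ T e ⟧ else 0) in
      d * cnt T (flat bs′) + 5 * credit bs′ ≤ d * (t + cnt T (flat bs)) + 5 * (L * cnt rel s + credit bs) ×
      d * (t + cnt T (flat bs)) + 5 * credit bs′ ≤ d * cnt T (flat bs′) + 5 * (L * cnt rel s + credit bs)
    sketchFrom-error {L} T he [] bs lt = ≤-reflexive (cong (λ z → d * cnt T (flat bs) + 5 * (z + credit bs)) (sym (*-zeroʳ L))) ,
                                     ≤-reflexive (cong (λ z → d * cnt T (flat bs) + 5 * (z + credit bs)) (sym (*-zeroʳ L)))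
    sketchFrom-error {L} T he (e ∷ s) bs lt with rel e
    ... | false = sketchFrom-error T he s bs lt
    ... | true  = first , second
      where
      open ≤-Reasoning
      bs₁ = push (e ∷ []) bs
      bs′ = sketchFrom rel bs₁ s
      t = ∑ s (λ e → if rel e then ⟦ T e ⟧ else 0)
      c = cnt rel s
      x = ⟦ T e ⟧
      F = cnt T (flat bs)
      pushed = push-error T he (e ∷ []) bs (≤-<-trans (+-monoˡ-≤ (length (flat bs)) (m≤m+n 1 c)) lt)
      ih = sketchFrom-error T he s bs₁ (≤-<-trans (≤-trans (+-monoʳ-≤ c (push-mass (e ∷ []) bs)) (≤-reflexive (+-suc c _))) lt)
      X = d * cnt T (flat bs′)
      l₁ : ∀ d t V L c C → d * (t + V) + 5 * (L * c + C) ≡ d * t + 5 * (L * c) + (d * V + 5 * C)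
      l₁ = solve-∀
      l₂ : ∀ d t x F L c C → d * t + 5 * (L * c) + (d * (x + 0 + F) + 5 * (L * 1 + C)) ≡ d * (x + t + F) + 5 * (L * suc c + C)
      l₂ = solve-∀
      first : X + 5 * credit bs′ ≤ d * (x + t + F) + 5 * (L * suc c + credit bs)
      first = begin
        X + 5 * credit bs′                                                     ≤⟨ proj₁ ih ⟩
        d * (t + cnt T (flat bs₁)) + 5 * (L * c + credit bs₁)                  ≡⟨ l₁ d t _ L c _ ⟩
        d * t + 5 * (L * c) + (d * cnt T (flat bs₁) + 5 * credit bs₁)          ≤⟨ +-monoʳ-≤ (d * t + 5 * (L * c)) (proj₁ pushed) ⟩
        d * t + 5 * (L * c) + (d * (x + 0 + F) + 5 * (L * 1 + credit bs))      ≡⟨ l₂ d t x F L c _ ⟩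
        d * (x + t + F) + 5 * (L * suc c + credit bs)                          ∎
      -- The estimates for push and for the remaining stream are added, and the intermediate state cancels.
      second : d * (x + t + F) + 5 * credit bs′ ≤ X + 5 * (L * suc c + credit bs)
      second = +-cancelʳ-≤ (d * cnt T (flat bs₁) + 5 * credit bs₁) _ _ (begin
        d * (x + t + F) + 5 * credit bs′ + (d * V + 5 * C₁)                    ≡⟨ m₁ d x t F (5 * credit bs′) V (5 * C₁) ⟩
        d * (t + V) + 5 * credit bs′ + (d * (x + 0 + F) + 5 * C₁)              ≤⟨ +-mono-≤ (proj₂ ih) (proj₂ pushed) ⟩
        X + 5 * (L * c + C₁) + (d * V + 5 * (L * 1 + credit bs))               ≡⟨ m₂ X L c C₁ (d * V) (credit bs) ⟩
        X + 5 * (L * suc c + credit bs) + (d * V + 5 * C₁)                     ∎)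
        where
        V = cnt T (flat bs₁)
        C₁ = credit bs₁
        m₁ : ∀ d x t F a V b → d * (x + t + F) + a + (d * V + b) ≡ d * (t + V) + a + (d * (x + 0 + F) + b)
        m₁ = solve-∀
        m₂ : ∀ X L c a b e → X + 5 * (L * c + a) + (b + 5 * (L * 1 + e)) ≡ X + 5 * (L * suc c + e) + (b + 5 * a)
        m₂ = solve-∀

  sketchFrom-short : ∀ {L} rel s (bs : Vec (List A) L) → 0 < N → VAll.All (λ b → length b < N) bs → VAll.All (λ b → length b < N) (sketchFrom rel bs s)
  sketchFrom-short rel []      bs 0<N ps = ps
  sketchFrom-short rel (e ∷ s) bs 0<N ps with rel e
  ... | true  = sketchFrom-short rel s _ 0<N (push-short (e ∷ []) bs 0<N ps)
  ... | false = sketchFrom-short rel s bs 0<N ps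

  -- As long as fewer than `N` items arrive, everything stays in the first buffer and nothing is
  -- halved.
  sketchFrom-exact : ∀ {L} rel T s b (bs : Vec (List A) L) → cnt rel s + length b < N →
    cnt T (flat (sketchFrom rel (b ∷ bs) s)) ≡ ∑ s (λ e → if rel e then ⟦ T e ⟧ else 0) + cnt T (flat (b ∷ bs))
  sketchFrom-exact rel T []      b bs lt = refl
  sketchFrom-exact rel T (e ∷ s) b bs lt with rel e
  ... | false = sketchFrom-exact rel T s b bs lt
  ... | true with suc (length b) <? N
  ...   | yes _ = trans (sketchFrom-exact rel T s (e ∷ b) bs (subst (_< N) (sym (+-suc (cnt rel s) (length b))) lt))
                    (l (∑ s (λ e → if rel e then ⟦ T e ⟧ else 0)) ⟦ T e ⟧ (cnt T (flat (b ∷ bs))))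
    where l : ∀ a b c → a + (b + c) ≡ b + a + c
          l = solve-∀
  ...   | no ¬p = ⊥-elim (¬p (≤-<-trans (+-monoˡ-≤ (length b) (s≤s (z≤n {cnt rel s}))) lt))

  module _ (halve⊆ : ∀ xs {x} → x ∈ halve xs → x ∈ xs) (P : A → Set) where

    push-all : ∀ {L} xs (bs : Vec (List A) L) → (∀ {x} → x ∈ xs → P x) → (∀ {x} → x ∈ flat bs → P x) → ∀ {x} → x ∈ flat (push xs bs) → P x
    push-all xs []       pxs pbs ()
    push-all xs (b ∷ bs) pxs pbs x∈ with length (xs ++ b) <? N
    ... | yes _ = cases (∈-++⁻ (xs ++ b) x∈)
      where
      cases : _ ∈ (xs ++ b) ⊎ _ ∈ (flat bs ++ flat bs) → P _
      cases (inj₂ p) = pbs (∈-++⁺ʳ b p)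
      cases (inj₁ p) with ∈-++⁻ xs p
      ... | inj₁ q = pxs q
      ... | inj₂ q = pbs (∈-++⁺ˡ q)
    ... | no _ = cases (∈-++⁻ (flat (push h bs)) x∈)
      where
      h = halve (xs ++ b)
      ph : ∀ {x} → x ∈ h → P x
      ph q with ∈-++⁻ xs (halve⊆ (xs ++ b) q)
      ... | inj₁ r = pxs r
      ... | inj₂ r = pbs (∈-++⁺ˡ r)
      rec = push-all h bs ph (λ q → pbs (∈-++⁺ʳ b (∈-++⁺ˡ q)))
      cases : _ ∈ flat (push h bs) ⊎ _ ∈ flat (push h bs) → P _
      cases (inj₁ p) = rec p
      cases (inj₂ p) = rec p

    sketchFrom-all : ∀ {L} rel s (bs : Vec (List A) L) → (∀ {x} → x ∈ s → P x) → (∀ {x} → x ∈ flat bs → P x) → ∀ {x} → x ∈ flat (sketchFrom rel bs s) → P x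
    sketchFrom-all rel []      bs ps pbs x∈ = pbs x∈
    sketchFrom-all rel (e ∷ s) bs ps pbs x∈ with rel e
    ... | true  = sketchFrom-all rel s _ (λ q → ps (there q)) (push-all (e ∷ []) bs (λ { (here refl) → ps (here refl) }) pbs) x∈
    ... | false = sketchFrom-all rel s bs (λ q → ps (there q)) pbs x∈

  flat-empty : ∀ L → flat (replicate L []) ≡ []
  flat-empty zero    = refl
  flat-empty (suc L) = cong (λ z → z ++ z) (flat-empty L)

  credit-empty : ∀ L → credit (replicate L []) ≡ 0
  credit-empty zero    = refl
  credit-empty (suc L) = trans (cong₂ _+_ (*-zeroʳ (suc L)) (cong (2 *_) (credit-empty L))) refl

-- Sums over products and enumeration of vectors

∑-map : ∀ {A B : Set} (f : A → B) xs (g : B → ℕ) → ∑ (map f xs) g ≡ ∑ xs (λ x → g (f x))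
∑-map f []       g = refl
∑-map f (x ∷ xs) g = cong (g (f x) +_) (∑-map f xs g)

∑-product : ∀ {A B C : Set} (f : A → B → C) xs ys (g : C → ℕ) →
            ∑ (cartesianProductWith f xs ys) g ≡ ∑ xs (λ x → ∑ ys (λ y → g (f x y)))
∑-product f []       ys g = refl
∑-product f (x ∷ xs) ys g = trans (∑-++ (map (f x) ys) _ g) (cong₂ _+_ (∑-map (f x) ys g) (∑-product f xs ys g))

length-∑ : ∀ {A : Set} (xs : List A) → length xs ≡ ∑ xs (λ _ → 1)
length-∑ xs = sym (trans (∑-const xs 1) (*-identityʳ _))

module _ {A : Set} where

  allVecs : ∀ {n} → Vec (List A) n → List (Vec A n)
  allVecs []       = [] ∷ []
  allVecs (o ∷ os) = cartesianProductWith _∷_ o (allVecs os)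

  ∈-allVecs⁺ : ∀ {n} (os : Vec (List A) n) (g : Vec A n) → (∀ i → lookup g i ∈ lookup os i) → g ∈ allVecs os
  ∈-allVecs⁺ []       []      h = here refl
  ∈-allVecs⁺ (o ∷ os) (x ∷ g) h = ∈-cartesianProductWith⁺ _∷_ (h zero) (∈-allVecs⁺ os g (λ i → h (suc i)))

  ∈-allVecs⁻ : ∀ {n} (os : Vec (List A) n) {g : Vec A n} → g ∈ allVecs os → ∀ i → lookup g i ∈ lookup os i
  ∈-allVecs⁻ (o ∷ os) g∈ i with ∈-cartesianProductWith⁻ _∷_ o (allVecs os) g∈
  ∈-allVecs⁻ (o ∷ os) g∈ zero    | x , g , x∈ , g∈′ , refl = x∈
  ∈-allVecs⁻ (o ∷ os) g∈ (suc i) | x , g , x∈ , g∈′ , refl = ∈-allVecs⁻ os g∈′ i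

  length-allVecs-∷ : ∀ {n} o (os : Vec (List A) n) → length (allVecs (o ∷ os)) ≡ length o * length (allVecs os)
  length-allVecs-∷ o os = trans (length-∑ (allVecs (o ∷ os))) (trans (∑-product _∷_ o (allVecs os) _)
    (trans (∑-cong o (λ _ → sym (length-∑ (allVecs os)))) (∑-const o _)))

-- Almost uniform, almost pairwise independent families of functions

-- The full sample space, exactly uniform and pairwise independent. It is only averaged over;
-- `family` replaces it by a few of its members.
functions : ∀ n → ℕ → List (Vec ℕ n)
functions n C = allVecs (Vec.replicate n (upTo C))

length-functions : ∀ n C → length (functions (suc n) C) ≡ C * length (functions n C)
length-functions n C = trans (length-allVecs-∷ (upTo C) (Vec.replicate n (upTo C))) (cong (_* length (functions n C)) (length-upTo C))

functions-pos : ∀ n C → 0 < C → 0 < length (functions n C)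
functions-pos zero    C 0<C = s≤s z≤n
functions-pos (suc n) C 0<C = subst (0 <_) (sym (length-functions n C)) (*-mono-≤ 0<C (functions-pos n C 0<C))

functions-bound : ∀ n C {g} → g ∈ functions n C → ∀ i → lookup g i < C
functions-bound n C {g} g∈ i = ∈-upTo⁻ (subst (lookup g i ∈_) (rep n i) (∈-allVecs⁻ (Vec.replicate n (upTo C)) g∈ i))
  where rep : ∀ n (i : Fin n) → lookup (Vec.replicate n (upTo C)) i ≡ upTo C
        rep (suc n) zero    = refl
        rep (suc n) (suc i) = rep n i

≡ᵇ-sym : ∀ a b → (a ≡ᵇ b) ≡ (b ≡ᵇ a)
≡ᵇ-sym zero    zero    = refl
≡ᵇ-sym zero    (suc b) = refl
≡ᵇ-sym (suc a) zero    = refl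
≡ᵇ-sym (suc a) (suc b) = ≡ᵇ-sym a b

∑-applyUpTo : ∀ C (f g h : ℕ → ℕ) → (∀ i → f i ≡ g (h i)) → (φ : ℕ → ℕ) →
              ∑ (applyUpTo f C) φ ≡ ∑ (applyUpTo h C) (λ x → φ (g x))
∑-applyUpTo zero    f g h e φ = refl
∑-applyUpTo (suc C) f g h e φ = cong₂ _+_ (cong φ (e 0)) (∑-applyUpTo C (λ i → f (suc i)) g (λ i → h (suc i)) (λ i → e (suc i)) φ)

-- The offset `k` carries the induction; later it is the first sub-block of a block.
∑-upTo-≡ᵇ : ∀ C k c → ∑ (upTo C) (λ x → ⟦ k + x ≡ᵇ c ⟧) ≤ 1
∑-upTo-≡ᵇ zero    k c = z≤n
∑-upTo-≡ᵇ (suc C) k c with k + 0 ≡ᵇ c in eq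
... | false = subst (_≤ 1) (sym (trans (∑-applyUpTo C suc suc (λ x → x) (λ _ → refl) (λ x → ⟦ k + x ≡ᵇ c ⟧))
                (∑-cong (upTo C) (λ x → cong (λ y → ⟦ y ≡ᵇ c ⟧) (+-suc k x))))) (∑-upTo-≡ᵇ C (suc k) c)
... | true  = s≤s (≤-reflexive (trans (∑-applyUpTo C suc suc (λ x → x) (λ _ → refl) (λ x → ⟦ k + x ≡ᵇ c ⟧))
                (trans (∑-cong (upTo C) (λ x → cong ⟦_⟧ (later x))) (trans (∑-const (upTo C) 0) (*-zeroʳ (length (upTo C)))))))
  where
  k≡c : k + 0 ≡ c
  k≡c = ≡ᵇ⇒≡ (k + 0) c (subst T (sym eq) _)
  later : ∀ x → (k + suc x ≡ᵇ c) ≡ false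
  later x with k + suc x ≡ᵇ c in e
  ... | false = refl
  ... | true  = ⊥-elim (1+n≢0 (+-cancelˡ-≡ k (suc x) 0 (trans (≡ᵇ⇒≡ (k + suc x) c (subst T (sym e) _)) (sym k≡c))))

∑-upTo-const : ∀ C k → ∑ (upTo C) (λ _ → k) ≡ C * k
∑-upTo-const C k = trans (∑-const (upTo C) k) (cong (_* k) (length-upTo C))

uniform : ∀ n C (v : Fin n) c → C * cnt (λ g → lookup g v ≡ᵇ c) (functions n C) ≤ length (functions n C)
uniform (suc n) C zero c = ≤-trans (*-monoʳ-≤ C (begin
  cnt (λ g → lookup g zero ≡ᵇ c) (functions (suc n) C)       ≡⟨ ∑-product _∷_ (upTo C) Ω _ ⟩
  ∑ (upTo C) (λ x → ∑ Ω (λ _ → ⟦ x ≡ᵇ c ⟧))                  ≡⟨ ∑-cong (upTo C) (λ x → ∑-const Ω _) ⟩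
  ∑ (upTo C) (λ x → length Ω * ⟦ x ≡ᵇ c ⟧)                   ≡⟨ ∑-*ˡ (upTo C) (length Ω) _ ⟩
  length Ω * ∑ (upTo C) (λ x → ⟦ x ≡ᵇ c ⟧)                   ≤⟨ *-monoʳ-≤ (length Ω) (∑-upTo-≡ᵇ C 0 c) ⟩
  length Ω * 1                                               ≡⟨ *-identityʳ _ ⟩
  length Ω                                                   ∎)) (≤-reflexive (sym (length-functions n C)))
  where open ≤-Reasoning
        Ω = functions n C
uniform (suc n) C (suc v) c = begin
  C * cnt (λ g → lookup g (suc v) ≡ᵇ c) (functions (suc n) C)  ≡⟨ cong (C *_) (∑-product _∷_ (upTo C) Ω _) ⟩
  C * ∑ (upTo C) (λ x → cnt (λ g → lookup g v ≡ᵇ c) Ω)         ≡⟨ cong (C *_) (∑-upTo-const C _) ⟩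
  C * (C * cnt (λ g → lookup g v ≡ᵇ c) Ω)                      ≤⟨ *-monoʳ-≤ C (uniform n C v c) ⟩
  C * length Ω                                                 ≡⟨ sym (length-functions n C) ⟩
  length (functions (suc n) C)                                 ∎
  where open ≤-Reasoning
        Ω = functions n C

pairwise : ∀ n C (u v : Fin n) → u ≢ v → C * cnt (λ g → lookup g u ≡ᵇ lookup g v) (functions n C) ≤ length (functions n C)
pairwise (suc n) C zero zero u≢v = ⊥-elim (u≢v refl)
pairwise (suc n) C zero (suc v) u≢v = begin
  C * cnt (λ g → lookup g zero ≡ᵇ lookup g (suc v)) (functions (suc n) C) ≡⟨ cong (C *_) (∑-product _∷_ (upTo C) Ω _) ⟩
  C * ∑ (upTo C) (λ x → cnt (λ g → x ≡ᵇ lookup g v) Ω)           ≡⟨ sym (∑-*ˡ (upTo C) C _) ⟩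
  ∑ (upTo C) (λ x → C * cnt (λ g → x ≡ᵇ lookup g v) Ω)           ≤⟨ ∑-mono (upTo C) (λ x → ≤-trans (≤-reflexive (cong (C *_) (∑-cong Ω (λ g → cong ⟦_⟧ (≡ᵇ-sym x (lookup g v)))))) (uniform n C v x)) ⟩
  ∑ (upTo C) (λ x → length Ω)                                    ≡⟨ ∑-upTo-const C _ ⟩
  C * length Ω                                                   ≡⟨ sym (length-functions n C) ⟩
  length (functions (suc n) C)                                   ∎
  where open ≤-Reasoning
        Ω = functions n C
pairwise (suc n) C (suc u) zero u≢v =
  ≤-trans (≤-reflexive (cong (C *_) (∑-cong (functions (suc n) C) (λ g → cong ⟦_⟧ (≡ᵇ-sym (lookup g (suc u)) (lookup g zero))))))
          (pairwise (suc n) C zero (suc u) (λ e → u≢v (sym e)))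
pairwise (suc n) C (suc u) (suc v) u≢v = begin
  C * cnt (λ g → lookup g (suc u) ≡ᵇ lookup g (suc v)) (functions (suc n) C) ≡⟨ cong (C *_) (∑-product _∷_ (upTo C) Ω _) ⟩
  C * ∑ (upTo C) (λ x → cnt (λ g → lookup g u ≡ᵇ lookup g v) Ω)  ≡⟨ cong (C *_) (∑-upTo-const C _) ⟩
  C * (C * cnt (λ g → lookup g u ≡ᵇ lookup g v) Ω)               ≤⟨ *-monoʳ-≤ C (pairwise n C u v (λ e → u≢v (cong suc e))) ⟩
  C * length Ω                                                   ≡⟨ sym (length-functions n C) ⟩
  length (functions (suc n) C)                                   ∎
  where open ≤-Reasoning
        Ω = functions n C

vcnt : ∀ {A : Set} {m} → (A → Bool) → Vec A m → ℕ
vcnt T []       = 0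
vcnt T (x ∷ xs) = ⟦ T x ⟧ + vcnt T xs

-- Derandomised sampling by the method of exponential potentials.
module Sampling {A : Set} (Ω : List A) (0<Ω : 0 < length Ω) (Ts : List (A → Bool)) (C X : ℕ)
                (rare : ∀ T → T ∈ Ts → C * cnt T Ω ≤ length Ω) where

  fac : (A → Bool) → A → ℕ
  fac T x = if T x then suc X else X

  fac-⟦⟧ : ∀ T x → fac T x ≡ X + ⟦ T x ⟧
  fac-⟦⟧ T x with T x
  ... | true  = sym (+-comm X 1)
  ... | false = sym (+-identityʳ X)

  -- Equals `(1 + 1/X)^c` scaled by `X^m`, where `c` is the number of members passing the test.
  weight : ∀ {m} → (A → Bool) → Vec A m → ℕ
  weight T []       = 1
  weight T (x ∷ xs) = fac T x * weight T xs

  Sample : ℕ → Set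
  Sample m = Σ (Vec A m) λ xs → VAll.All (_∈ Ω) xs × C ^ m * ∑ Ts (λ T → weight T xs) ≤ suc (X * C) ^ m * length Ts

  -- A member drawn uniformly from `Ω` multiplies each weight by at most `X + 1/C` on average, so
  -- some member does this to the total weight. It is chosen, and the process repeated.
  sample′ : ∀ m → Sample m
  sample′ zero = [] , VAll.[] , ≤-reflexive (trans (*-identityˡ _) (trans (∑-const Ts 1) (trans (*-identityʳ _) (sym (*-identityˡ _)))))
  sample′ (suc m) with sample′ m
  ... | xs , xs∈ , h = ω ∷ xs , ω∈ VAll.∷ xs∈ , (begin
    C * C ^ m * ∑ Ts (λ T → fac T ω * weight T xs)      ≡⟨ l₁ C (C ^ m) _ ⟩
    C ^ m * (C * ∑ Ts (λ T → fac T ω * weight T xs))    ≤⟨ *-monoʳ-≤ (C ^ m) le ⟩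
    C ^ m * (suc (X * C) * W)                           ≡⟨ l₂ (C ^ m) (suc (X * C)) W ⟩
    suc (X * C) * (C ^ m * W)                           ≤⟨ *-monoʳ-≤ (suc (X * C)) h ⟩
    suc (X * C) * (suc (X * C) ^ m * length Ts)         ≡⟨ sym (*-assoc (suc (X * C)) (suc (X * C) ^ m) (length Ts)) ⟩
    suc (X * C) * suc (X * C) ^ m * length Ts           ∎)
    where
    open ≤-Reasoning
    W = ∑ Ts (λ T → weight T xs)
    l₁ : ∀ a b c → a * b * c ≡ b * (a * c)
    l₁ = solve-∀
    l₂ : ∀ a b c → a * (b * c) ≡ b * (a * c)
    l₂ = solve-∀
    one : ∀ T → T ∈ Ts → C * ∑ Ω (λ x → fac T x * weight T xs) ≤ length Ω * suc (X * C) * weight T xs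
    one T T∈ = begin
      C * ∑ Ω (λ x → fac T x * weight T xs)                    ≡⟨ cong (C *_) (trans (∑-cong Ω (λ x → trans (*-comm (fac T x) w) (cong (w *_) (fac-⟦⟧ T x)))) (∑-*ˡ Ω w _)) ⟩
      C * (w * ∑ Ω (λ x → X + ⟦ T x ⟧))                        ≡⟨ cong (λ z → C * (w * z)) (trans (∑-+ Ω _ _) (cong (_+ cnt T Ω) (∑-const Ω X))) ⟩
      C * (w * (length Ω * X + cnt T Ω))                       ≡⟨ l₃ C w (length Ω) X (cnt T Ω) ⟩
      w * (length Ω * X * C + C * cnt T Ω)                     ≤⟨ *-monoʳ-≤ w (+-monoʳ-≤ (length Ω * X * C) (rare T T∈)) ⟩
      w * (length Ω * X * C + length Ω)                        ≡⟨ l₄ w (length Ω) X C ⟩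
      length Ω * suc (X * C) * w                               ∎
      where
      w = weight T xs
      l₃ : ∀ C w o X c → C * (w * (o * X + c)) ≡ w * (o * X * C + C * c)
      l₃ = solve-∀
      l₄ : ∀ w o X C → w * (o * X * C + o) ≡ o * suc (X * C) * w
      l₄ = solve-∀
    avg : ∑ Ω (λ x → C * ∑ Ts (λ T → fac T x * weight T xs)) ≤ length Ω * (suc (X * C) * W)
    avg = begin
      ∑ Ω (λ x → C * ∑ Ts (λ T → fac T x * weight T xs))       ≡⟨ trans (∑-*ˡ Ω C _) (cong (C *_) (∑-swap Ω Ts _)) ⟩
      C * ∑ Ts (λ T → ∑ Ω (λ x → fac T x * weight T xs))       ≡⟨ sym (∑-*ˡ Ts C _) ⟩
      ∑ Ts (λ T → C * ∑ Ω (λ x → fac T x * weight T xs))       ≤⟨ ∑-mono-∈ Ts one ⟩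
      ∑ Ts (λ T → length Ω * suc (X * C) * weight T xs)        ≡⟨ ∑-*ˡ Ts (length Ω * suc (X * C)) _ ⟩
      length Ω * suc (X * C) * W                               ≡⟨ *-assoc (length Ω) _ _ ⟩
      length Ω * (suc (X * C) * W)                             ∎
    pick = ∃≤average Ω (λ x → C * ∑ Ts (λ T → fac T x * weight T xs)) (suc (X * C) * W) 0<Ω avg
    ω = proj₁ pick
    ω∈ = proj₁ (proj₂ pick)
    le = proj₂ (proj₂ pick)

  abstract
    sample : ∀ m → Sample m
    sample = sample′

  weight-vcnt : ∀ {m} T (xs : Vec A m) → weight T xs * X ^ vcnt T xs ≡ suc X ^ vcnt T xs * X ^ m
  weight-vcnt T [] = refl
  weight-vcnt {suc m} T (x ∷ xs) with T x
  ... | true  = trans (l₁ (suc X) (weight T xs) X (X ^ vcnt T xs)) (trans (cong (suc X * X *_) (weight-vcnt T xs)) (l₁ (suc X) X (suc X ^ vcnt T xs) (X ^ m)))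
    where l₁ : ∀ a b c e → a * b * (c * e) ≡ a * c * (b * e)
          l₁ = solve-∀
  ... | false = trans (*-assoc X (weight T xs) (X ^ vcnt T xs)) (trans (cong (X *_) (weight-vcnt T xs)) (l₂ X (suc X ^ vcnt T xs) (X ^ m)))
    where l₂ : ∀ a b c → a * (b * c) ≡ b * (a * c)
          l₂ = solve-∀

-- (1 + 1/(XC))^{Cj} ≤ (1 + 1/X)^{j+1} for X = 2j, compared through X/(X-1).
module Chernoff (j C X X⁻ : ℕ) (0<j : 0 < j) (0<C : 0 < C) (X≡2j : X ≡ 2 * j) (X≡ : X ≡ suc X⁻) where
  private
    Y = X * C
    0<X : 0 < X
    0<X = subst (0 <_) (sym X≡) (s≤s z≤n)
    0<X⁻ : 0 < X⁻
    0<X⁻ = ≤-pred (subst (2 ≤_) (trans (sym X≡2j) X≡) (*-monoʳ-≤ 2 0<j))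
    0<Y : 0 < Y
    0<Y = *-mono-≤ 0<X 0<C
    nz : ∀ {x} k → 0 < x → NonZero (x ^ k)
    nz {x} k 0<x = >-nonZero (^-pos x k 0<x)

  -- Bernoulli for `1 - 1/(Y + 1)` gives `(1 + 1/Y)^C ≤ (Y + 1)/(Y + 1 - C)`, and for `Y = X C` this
  -- is at most `X/(X - 1)`.
  ratio-C : suc Y ^ C * X⁻ ≤ Y ^ C * X
  ratio-C = *-cancelʳ-≤ _ _ (suc (X⁻ * C)) (begin
    suc Y ^ C * X⁻ * suc (X⁻ * C)           ≡⟨ l₁ (suc Y ^ C) X⁻ (suc (X⁻ * C)) ⟩
    suc Y ^ C * suc (X⁻ * C) * X⁻           ≤⟨ *-monoˡ-≤ X⁻ key ⟩
    Y ^ C * suc Y * X⁻                      ≡⟨ l₂ (Y ^ C) (suc Y) X⁻ ⟩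
    Y ^ C * (suc Y * X⁻)                    ≤⟨ *-monoʳ-≤ (Y ^ C) cross ⟩
    Y ^ C * (X * suc (X⁻ * C))              ≡⟨ sym (l₂ (Y ^ C) X (suc (X⁻ * C))) ⟩
    Y ^ C * X * suc (X⁻ * C)                ∎)
    where
    open ≤-Reasoning
    l₁ : ∀ a b c → a * b * c ≡ a * c * b
    l₁ = solve-∀
    l₂ : ∀ a b c → a * b * c ≡ a * (b * c)
    l₂ = solve-∀
    sY : suc Y ≡ suc (X⁻ * C) + C
    sY = trans (cong (λ z → suc (z * C)) X≡) (lem X⁻ C)
      where lem : ∀ x c → suc (suc x * c) ≡ suc (x * c) + c
            lem = solve-∀
    key : suc Y ^ C * suc (X⁻ * C) ≤ Y ^ C * suc Y
    key = +-cancelʳ-≤ (C * suc Y ^ C) _ _ (begin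
      suc Y ^ C * suc (X⁻ * C) + C * suc Y ^ C ≡⟨ l₃ (suc Y ^ C) (suc (X⁻ * C)) C ⟩
      suc Y ^ C * (suc (X⁻ * C) + C)           ≡⟨ cong (suc Y ^ C *_) (sym sY) ⟩
      suc Y ^ C * suc Y                        ≤⟨ bernoulli⁻ Y C ⟩
      Y ^ C * suc Y + C * suc Y ^ C            ∎)
      where l₃ : ∀ a b c → a * b + c * a ≡ a * (b + c)
            l₃ = solve-∀
    cross : suc Y * X⁻ ≤ X * suc (X⁻ * C)
    cross = begin
      suc Y * X⁻                 ≡⟨ l₄ X C X⁻ ⟩
      X⁻ + X * (X⁻ * C)          ≤⟨ +-monoˡ-≤ (X * (X⁻ * C)) (≤-trans (n≤1+n X⁻) (≤-reflexive (sym X≡))) ⟩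
      X + X * (X⁻ * C)           ≡⟨ sym (*-suc X (X⁻ * C)) ⟩
      X * suc (X⁻ * C)           ∎
      where l₄ : ∀ X C x → suc (X * C) * x ≡ x + X * (x * C)
            l₄ = solve-∀

  -- Dividing by `(1 + 1/X)^j` leaves `(1 - 1/X²)^(-j) ≤ 1 + 1/X`, and Bernoulli bounds the left
  -- side by `X²/(X² - j)`.
  ratio-j : X ^ j * X ^ suc j ≤ X⁻ ^ j * suc X ^ suc j
  ratio-j = *-cancelʳ-≤ _ _ Z (begin
    X ^ j * (X * X ^ j) * Z                ≡⟨ l₀ (X ^ j) X Z ⟩
    X ^ j * X ^ j * Z * X                  ≡⟨ cong (λ p → p * Z * X) (trans (sym (*-^ X X j)) (cong (_^ j) (sym sx))) ⟩
    suc x ^ j * Z * X                      ≤⟨ *-monoˡ-≤ X key ⟩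
    x ^ j * suc x * X                      ≡⟨ cong (λ p → x ^ j * p * X) sx ⟩
    x ^ j * (X * X) * X                    ≤⟨ ≤-trans (≤-reflexive (l₁ (x ^ j) X)) (*-monoʳ-≤ (x ^ j) cross) ⟩
    x ^ j * (suc X * Z)                    ≡⟨ cong (_* (suc X * Z)) (*-^ X⁻ (suc X) j) ⟩
    X⁻ ^ j * suc X ^ j * (suc X * Z)       ≡⟨ l₂ (X⁻ ^ j) (suc X ^ j) (suc X) Z ⟩
    X⁻ ^ j * (suc X * suc X ^ j) * Z       ∎)
    where
    open ≤-Reasoning
    x = X⁻ * suc X
    -- This is `X² - j`, written without subtraction.
    Z = j * (2 * X⁻ + 1)
    instance
      Z≢0 : NonZero Z
      Z≢0 = >-nonZero (*-mono-≤ 0<j (m≤n+m 1 (2 * X⁻)))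
    Z+j : Z + j ≡ X * X
    Z+j = trans (lem j X⁻) (sym (cong₂ _*_ X≡2j X≡))
      where lem : ∀ j x → j * (2 * x + 1) + j ≡ 2 * j * suc x
            lem = solve-∀
    sx : suc x ≡ X * X
    sx = trans (cong (λ z → suc (X⁻ * suc z)) X≡) (trans (lem X⁻) (sym (cong₂ _*_ X≡ X≡)))
      where lem : ∀ k → suc (k * suc (suc k)) ≡ suc k * suc k
            lem = solve-∀
    l₀ : ∀ p X z → p * (X * p) * z ≡ p * p * z * X
    l₀ = solve-∀
    l₁ : ∀ p X → p * (X * X) * X ≡ p * (X * (X * X))
    l₁ = solve-∀
    l₂ : ∀ a b c e → a * b * (c * e) ≡ a * (c * b) * e
    l₂ = solve-∀
    key : suc x ^ j * Z ≤ x ^ j * suc x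
    key = +-cancelʳ-≤ (j * suc x ^ j) _ _ (≤-trans (≤-reflexive (trans (l₃ (suc x ^ j) Z j) (cong (suc x ^ j *_) (trans Z+j (sym sx))))) (bernoulli⁻ x j))
      where l₃ : ∀ a b c → a * b + c * a ≡ a * (b + c)
            l₃ = solve-∀
    cross : X * (X * X) ≤ suc X * Z
    cross = ≤-trans (m≤m+n _ (j * X⁻)) (≤-reflexive (trans (cong (_+ j * X⁻) (cong₂ _*_ X≡2j (cong₂ _*_ X≡ X≡)))
              (trans (lem j X⁻) (cong (λ z → suc z * Z) (sym X≡)))))
      where lem : ∀ j x → 2 * j * (suc x * suc x) + j * x ≡ suc (suc x) * (j * (2 * x + 1))
            lem = solve-∀

  ratio-Cj : suc Y ^ (C * j) * X ^ suc j ≤ Y ^ (C * j) * suc X ^ suc j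
  ratio-Cj = *-cancelʳ-≤ _ _ (X⁻ ^ j) {{nz j 0<X⁻}} (begin
    suc Y ^ (C * j) * X ^ suc j * X⁻ ^ j      ≡⟨ l₁ (suc Y ^ (C * j)) (X ^ suc j) (X⁻ ^ j) ⟩
    suc Y ^ (C * j) * X⁻ ^ j * X ^ suc j      ≡⟨ cong (_* X ^ suc j) (trans (cong (_* X⁻ ^ j) (sym (^-*-assoc (suc Y) C j))) (sym (*-^ (suc Y ^ C) X⁻ j))) ⟩
    (suc Y ^ C * X⁻) ^ j * X ^ suc j          ≤⟨ *-monoˡ-≤ (X ^ suc j) (^-monoˡ-≤ j ratio-C) ⟩
    (Y ^ C * X) ^ j * X ^ suc j               ≡⟨ cong (_* X ^ suc j) (trans (*-^ (Y ^ C) X j) (cong (_* X ^ j) (^-*-assoc Y C j))) ⟩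
    Y ^ (C * j) * X ^ j * X ^ suc j           ≡⟨ *-assoc (Y ^ (C * j)) (X ^ j) (X ^ suc j) ⟩
    Y ^ (C * j) * (X ^ j * X ^ suc j)         ≤⟨ *-monoʳ-≤ (Y ^ (C * j)) ratio-j ⟩
    Y ^ (C * j) * (X⁻ ^ j * suc X ^ suc j)    ≡⟨ l₂ (Y ^ (C * j)) (X⁻ ^ j) (suc X ^ suc j) ⟩
    Y ^ (C * j) * suc X ^ suc j * X⁻ ^ j      ∎)
    where
    open ≤-Reasoning
    l₁ : ∀ a b c → a * b * c ≡ a * c * b
    l₁ = solve-∀
    l₂ : ∀ a b c → a * (b * c) ≡ a * c * b
    l₂ = solve-∀

  -- The Chernoff estimate: c successes out of m trials of probability at most 1/C.
  chernoff : ∀ c m λ′ R → m ≤ R * (C * j) → C ^ m * (suc X ^ c * X ^ m) ≤ suc Y ^ m * 2 ^ λ′ * X ^ c → c ≤ R * suc j + X * λ′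
  chernoff c m λ′ R m≤ h = ≮⇒≥ λ lt → <⇒≱ (*-monoʳ-< _ {{nz m 0<Y}} (contra lt)) final
    where
    open ≤-Reasoning
    E = R * suc j + X * λ′
    contra : E < c → suc X ^ E * X ^ c < suc X ^ c * X ^ E
    contra lt = begin-strict
      suc X ^ E * X ^ c                   ≡⟨ cong (λ k → suc X ^ E * X ^ k) (sym c≡) ⟩
      suc X ^ E * X ^ (E + r)             ≡⟨ cong (suc X ^ E *_) (^-distribˡ-+-* X E r) ⟩
      suc X ^ E * (X ^ E * X ^ r)         <⟨ *-monoʳ-< (suc X ^ E) {{m^n≢0 (suc X) E}} (*-monoʳ-< (X ^ E) {{nz E 0<X}} (^-monoˡ-< r {{>-nonZero (m<n⇒0<n∸m lt)}} (n<1+n X))) ⟩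
      suc X ^ E * (X ^ E * suc X ^ r)     ≡⟨ l₁ (suc X ^ E) (X ^ E) (suc X ^ r) ⟩
      suc X ^ E * suc X ^ r * X ^ E       ≡⟨ cong (_* X ^ E) (trans (sym (^-distribˡ-+-* (suc X) E r)) (cong (suc X ^_) c≡)) ⟩
      suc X ^ c * X ^ E                   ∎
      where
      r = c ∸ E
      c≡ : E + r ≡ c
      c≡ = m+[n∸m]≡n (<⇒≤ lt)
      l₁ : ∀ a b c → a * (b * c) ≡ a * c * b
      l₁ = solve-∀
    Ym : Y ^ m ≡ X ^ m * C ^ m
    Ym = *-^ X C m
    grow : suc Y ^ m * X ^ (R * suc j) ≤ Y ^ m * suc X ^ (R * suc j)
    grow = *-cancelʳ-≤ _ _ (suc Y ^ r) {{m^n≢0 (suc Y) r}} (begin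
      suc Y ^ m * X ^ (R * suc j) * suc Y ^ r    ≡⟨ l₁ (suc Y ^ m) (X ^ (R * suc j)) (suc Y ^ r) ⟩
      suc Y ^ m * suc Y ^ r * X ^ (R * suc j)    ≡⟨ cong₂ _*_ (trans (sym (^-distribˡ-+-* (suc Y) m r)) (trans (cong (suc Y ^_) m≡) (sym (^-*-assoc (suc Y) (C * j) R)))) (trans (cong (X ^_) (*-comm R (suc j))) (sym (^-*-assoc X (suc j) R))) ⟩
      (suc Y ^ (C * j)) ^ R * (X ^ suc j) ^ R    ≡⟨ sym (*-^ (suc Y ^ (C * j)) (X ^ suc j) R) ⟩
      (suc Y ^ (C * j) * X ^ suc j) ^ R          ≤⟨ ^-monoˡ-≤ R ratio-Cj ⟩
      (Y ^ (C * j) * suc X ^ suc j) ^ R          ≡⟨ *-^ (Y ^ (C * j)) (suc X ^ suc j) R ⟩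
      (Y ^ (C * j)) ^ R * (suc X ^ suc j) ^ R    ≡⟨ cong₂ _*_ (trans (^-*-assoc Y (C * j) R) (trans (cong (Y ^_) (sym m≡)) (^-distribˡ-+-* Y m r))) (trans (^-*-assoc (suc X) (suc j) R) (cong (suc X ^_) (*-comm (suc j) R))) ⟩
      Y ^ m * Y ^ r * suc X ^ (R * suc j)        ≡⟨ l₁ (Y ^ m) (Y ^ r) (suc X ^ (R * suc j)) ⟩
      Y ^ m * suc X ^ (R * suc j) * Y ^ r        ≤⟨ *-monoʳ-≤ (Y ^ m * suc X ^ (R * suc j)) (^-monoˡ-≤ r (n≤1+n Y)) ⟩
      Y ^ m * suc X ^ (R * suc j) * suc Y ^ r    ∎)
      where
      r = R * (C * j) ∸ m
      m≡ : m + r ≡ C * j * R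
      m≡ = trans (m+[n∸m]≡n m≤) (*-comm R (C * j))
      l₁ : ∀ a b c → a * b * c ≡ a * c * b
      l₁ = solve-∀
    two : 2 ^ λ′ * X ^ (X * λ′) ≤ suc X ^ (X * λ′)
    two = begin
      2 ^ λ′ * X ^ (X * λ′)     ≡⟨ trans (cong (2 ^ λ′ *_) (sym (^-*-assoc X X λ′))) (sym (*-^ 2 (X ^ X) λ′)) ⟩
      (2 * X ^ X) ^ λ′          ≤⟨ ^-monoˡ-≤ λ′ (2*x^x≤[1+x]^x X 0<X) ⟩
      (suc X ^ X) ^ λ′          ≡⟨ ^-*-assoc (suc X) X λ′ ⟩
      suc X ^ (X * λ′)          ∎
    final : Y ^ m * (suc X ^ c * X ^ E) ≤ Y ^ m * (suc X ^ E * X ^ c)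
    final = begin
      Y ^ m * (suc X ^ c * X ^ E)                                     ≡⟨ trans (cong (_* (suc X ^ c * X ^ E)) Ym) (l₁ (X ^ m) (C ^ m) (suc X ^ c) (X ^ E)) ⟩
      C ^ m * (suc X ^ c * X ^ m) * X ^ E                             ≤⟨ *-monoˡ-≤ (X ^ E) h ⟩
      suc Y ^ m * 2 ^ λ′ * X ^ c * X ^ E                              ≡⟨ cong (suc Y ^ m * 2 ^ λ′ * X ^ c *_) (^-distribˡ-+-* X (R * suc j) (X * λ′)) ⟩
      suc Y ^ m * 2 ^ λ′ * X ^ c * (X ^ (R * suc j) * X ^ (X * λ′))   ≡⟨ l₂ (suc Y ^ m) (2 ^ λ′) (X ^ c) (X ^ (R * suc j)) (X ^ (X * λ′)) ⟩
      suc Y ^ m * X ^ (R * suc j) * (2 ^ λ′ * X ^ (X * λ′)) * X ^ c   ≤⟨ *-monoˡ-≤ (X ^ c) (*-mono-≤ grow two) ⟩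
      Y ^ m * suc X ^ (R * suc j) * suc X ^ (X * λ′) * X ^ c          ≡⟨ l₃ (Y ^ m) (suc X ^ (R * suc j)) (suc X ^ (X * λ′)) (X ^ c) ⟩
      Y ^ m * (suc X ^ (R * suc j) * suc X ^ (X * λ′) * X ^ c)        ≡⟨ cong (λ p → Y ^ m * (p * X ^ c)) (sym (^-distribˡ-+-* (suc X) (R * suc j) (X * λ′))) ⟩
      Y ^ m * (suc X ^ E * X ^ c)                                     ∎
      where
      l₁ : ∀ a b c e → a * b * (c * e) ≡ b * (c * a) * e
      l₁ = solve-∀
      l₂ : ∀ a b c e f → a * b * c * (e * f) ≡ a * e * (b * f) * c
      l₂ = solve-∀
      l₃ : ∀ a b c e → a * b * c * e ≡ a * (b * c * e)
      l₃ = solve-∀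

  -- For large `m` the rounding in `R` and the additive term `X λ′` are absorbed, leaving
  -- `c ≤ (1 + 2/j) m / C`. The family uses `j = 2 z`.
  chernoff-scaled : ∀ c m λ′ → j * (C * suc (j + X * λ′)) ≤ m →
                    C ^ m * (suc X ^ c * X ^ m) ≤ suc Y ^ m * 2 ^ λ′ * X ^ c → j * (C * c) ≤ (2 + j) * m
  chernoff-scaled c m λ′ big h = begin
    j * (C * c)                                     ≤⟨ *-monoʳ-≤ j (*-monoʳ-≤ C (chernoff c m λ′ (suc r) (<⇒≤ (m<[1+m/n]*n m (C * j))) h)) ⟩
    j * (C * (suc r * suc j + X * λ′))              ≡⟨ l₁ j C r (X * λ′) ⟩
    r * (C * j) * suc j + j * (C * suc (j + X * λ′)) ≤⟨ +-mono-≤ (*-monoˡ-≤ (suc j) (m/n*n≤m m (C * j))) big ⟩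
    m * suc j + m                                   ≡⟨ l₂ m j ⟩
    (2 + j) * m                                     ∎
    where
    open ≤-Reasoning
    instance
      Cj≢0 : NonZero (C * j)
      Cj≢0 = >-nonZero (*-mono-≤ 0<C 0<j)
    r = m / (C * j)
    l₁ : ∀ j C r y → j * (C * (suc r * suc j + y)) ≡ r * (C * j) * suc j + j * (C * suc (j + y))
    l₁ = solve-∀
    l₂ : ∀ m j → m * suc j + m ≡ (2 + j) * m
    l₂ = solve-∀

-- A vertex agrees with itself under every function; excluding `u = v` makes the test rare for all
-- pairs.
collides : ∀ {n} → Fin n → Fin n → Vec ℕ n → Bool
collides u v g = not ⌊ u ≟ v ⌋ ∧ (lookup g u ≡ᵇ lookup g v)

hits : ∀ {n} → Fin n → ℕ → Vec ℕ n → Bool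
hits u c g = lookup g u ≡ᵇ c

-- The first kind covers conflicts between two active vertices, the second conflicts of an active
-- vertex with a neighbour whose colour is already fixed.
familyTests : ∀ n → ℕ → List (Vec ℕ n → Bool)
familyTests n C = cartesianProductWith collides (allFin n) (allFin n) ++ cartesianProductWith hits (allFin n) (upTo C)

length-product : ∀ {A B D : Set} (f : A → B → D) xs ys → length (cartesianProductWith f xs ys) ≡ length xs * length ys
length-product f xs ys = trans (length-∑ (cartesianProductWith f xs ys)) (trans (∑-product f xs ys _) (trans (∑-cong xs (λ _ → sym (length-∑ ys))) (∑-const xs _)))

length-allFin : ∀ n → length (allFin n) ≡ n
length-allFin n = length-tabulate {n = n} (λ i → i)

length-familyTests : ∀ n C → length (familyTests n C) ≡ n * n + n * C
length-familyTests n C = trans (length-++ (cartesianProductWith collides (allFin n) (allFin n)))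
  (cong₂ _+_ (trans (length-product collides (allFin n) (allFin n)) (cong₂ _*_ (length-allFin n) (length-allFin n)))
             (trans (length-product hits (allFin n) (upTo C)) (cong₂ _*_ (length-allFin n) (length-upTo C))))

familyTests-rare : ∀ n C T → T ∈ familyTests n C → C * cnt T (functions n C) ≤ length (functions n C)
familyTests-rare n C T T∈ with ∈-++⁻ (cartesianProductWith collides (allFin n) (allFin n)) T∈
... | inj₂ T∈₂ with ∈-cartesianProductWith⁻ hits (allFin n) (upTo C) T∈₂
...   | u , c , _ , _ , refl = uniform n C u c
familyTests-rare n C T T∈ | inj₁ T∈₁ with ∈-cartesianProductWith⁻ collides (allFin n) (allFin n) T∈₁
...   | u , v , _ , _ , refl with u ≟ v
...     | no u≢v = pairwise n C u v u≢v
...     | yes _  = ≤-trans (≤-reflexive (trans (cong (C *_) (trans (∑-const (functions n C) 0) (*-zeroʳ (length (functions n C))))) (*-zeroʳ C))) z≤n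

-- In the junk case C = 0 the family is constant.
family : (n C z m : ℕ) → Vec (Vec ℕ n) m
family n zero      z m = Vec.replicate m (Vec.replicate n 0)
family n C@(suc _) z m = proj₁ (Sampling.sample (functions n C) (functions-pos n C (s≤s z≤n)) (familyTests n C) C (2 * (2 * z)) (familyTests-rare n C) m)

family-bound : ∀ n C z m → 0 < C → ∀ i v → lookup (lookup (family n C z m) i) v < C
family-bound n C@(suc _) z m _ i v =
  functions-bound n C (VAllP.lookup⁺ (proj₁ (proj₂ (Sampling.sample (functions n C) (functions-pos n C (s≤s z≤n)) (familyTests n C) C (2 * (2 * z)) (familyTests-rare n C) m))) i) v

family-rare : ∀ n C z m λ′ → 0 < C → 0 < z → n * n + n * C ≤ 2 ^ λ′ → 2 * z * (C * suc (2 * z + 2 * (2 * z) * λ′)) ≤ m →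
              ∀ T → T ∈ familyTests n C → z * (C * vcnt T (family n C z m)) ≤ suc z * m
family-rare n C@(suc _) z@(suc z′) m λ′ 0<C 0<z lenTs big T T∈ =
  *-cancelˡ-≤ {z * (C * c)} {suc z * m} 2 (≤-trans (≤-reflexive (sym (*-assoc 2 z (C * c)))) (≤-trans
    (Chernoff.chernoff-scaled j C X (suc (2 * z′ + (2 * z))) (s≤s z≤n) 0<C refl (l₂ z′) c m λ′ big main) (≤-reflexive (l₃ z m))))
  where
  j = 2 * z
  X = 2 * j
  open Sampling (functions n C) (functions-pos n C (s≤s z≤n)) (familyTests n C) C X (familyTests-rare n C)
  fs = family n C z m
  c = vcnt T fs
  pot = proj₂ (proj₂ (sample m))
  l₂ : ∀ z → 2 * (2 * suc z) ≡ suc (suc (2 * z + 2 * suc z))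
  l₂ = solve-∀
  l₃ : ∀ z m → (2 + 2 * z) * m ≡ 2 * (suc z * m)
  l₃ = solve-∀
  open ≤-Reasoning
  main : C ^ m * (suc X ^ c * X ^ m) ≤ suc (X * C) ^ m * 2 ^ λ′ * X ^ c
  main = begin
    C ^ m * (suc X ^ c * X ^ m)                        ≡⟨ cong (C ^ m *_) (sym (weight-vcnt T fs)) ⟩
    C ^ m * (weight T fs * X ^ c)                      ≡⟨ sym (*-assoc (C ^ m) (weight T fs) (X ^ c)) ⟩
    C ^ m * weight T fs * X ^ c                        ≤⟨ *-monoˡ-≤ (X ^ c) (*-monoʳ-≤ (C ^ m) (∑-∈ (familyTests n C) (λ T → weight T fs) T∈)) ⟩
    C ^ m * ∑ (familyTests n C) (λ T → weight T fs) * X ^ c  ≤⟨ *-monoˡ-≤ (X ^ c) pot ⟩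
    suc (X * C) ^ m * length (familyTests n C) * X ^ c ≤⟨ *-monoˡ-≤ (X ^ c) (*-monoʳ-≤ (suc (X * C) ^ m) (≤-trans (≤-reflexive (length-familyTests n C)) lenTs)) ⟩
    suc (X * C) ^ m * 2 ^ λ′ * X ^ c                   ∎

-- Loads and the Lovász local minimum

_==_ : ∀ {n} → Fin n → Fin n → Bool
u == v = ⌊ u ≟ v ⌋

inc : ∀ {n} → Fin n → Edge n → ℕ
inc u e = ⟦ u == proj₁ e ⟧ + ⟦ u == proj₂ e ⟧

mono : ∀ {n} → Vec ℕ n → Edge n → Bool
mono g e = lookup g (proj₁ e) ≡ᵇ lookup g (proj₂ e)

==-refl : ∀ {n} (u : Fin n) → (u == u) ≡ true
==-refl u with u ≟ u
... | yes _ = refl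
... | no ¬p = ⊥-elim (¬p refl)

==-suc : ∀ {n} (u v : Fin n) → (suc u == suc v) ≡ (u == v)
==-suc u v with u ≟ v
... | yes refl = refl
... | no _     = refl

∑-allFin-suc : ∀ n (f : Fin (suc n) → ℕ) → ∑ (allFin (suc n)) f ≡ f zero + ∑ (allFin n) (λ i → f (suc i))
∑-allFin-suc n f = cong (f zero +_) (trans (cong (λ xs → ∑ xs f) (sym (map-tabulate (λ i → i) suc))) (∑-map suc (allFin n) f))

∑-pick : ∀ {n} (f : Fin n → ℕ) v → ∑ (allFin n) (λ u → f u * ⟦ u == v ⟧) ≡ f v
∑-pick {suc n} f zero = trans (∑-allFin-suc n _) (trans (cong₂ _+_ (*-identityʳ (f zero))
  (trans (∑-cong (allFin n) (λ u → *-zeroʳ (f (suc u)))) (trans (∑-const (allFin n) 0) (*-zeroʳ (length (allFin n)))))) (+-identityʳ _))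
∑-pick {suc n} f (suc v) = trans (∑-allFin-suc n _) (cong₂ _+_ (*-zeroʳ (f zero))
  (trans (∑-cong (allFin n) (λ u → cong (λ b → f (suc u) * ⟦ b ⟧) (==-suc u v))) (∑-pick (λ u → f (suc u)) v)))

handshake : ∀ {n} (y : Fin n → ℕ) s (f : Edge n → ℕ) →
            ∑ (allFin n) (λ u → y u * ∑ s (λ e → inc u e * f e)) ≡ ∑ s (λ e → (y (proj₁ e) + y (proj₂ e)) * f e)
handshake {n} y s f = trans (∑-cong (allFin n) (λ u → sym (∑-*ˡ s (y u) _))) (trans (∑-swap (allFin n) s _) (∑-cong s (λ e →
  trans (∑-cong (allFin n) (λ u → l₁ (y u) ⟦ u == proj₁ e ⟧ ⟦ u == proj₂ e ⟧ (f e)))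
  (trans (∑-*ˡ (allFin n) (f e) _) (trans (cong (f e *_) (trans (∑-+ (allFin n) _ _) (cong₂ _+_ (∑-pick y (proj₁ e)) (∑-pick y (proj₂ e))))) (*-comm (f e) _))))))
  where l₁ : ∀ y a b f → y * ((a + b) * f) ≡ f * (y * a + y * b)
        l₁ = solve-∀

≢⇒== : ∀ {n} {u v : Fin n} → u ≢ v → (u == v) ≡ false
≢⇒== {u = u} {v} u≢v with u ≟ v
... | yes p = ⊥-elim (u≢v p)
... | no _  = refl

module LocalMin {n} (opts : Vec (List ℕ) n) (G : List (Edge n)) (loopless : ∀ e → e ∈ G → proj₁ e ≢ proj₂ e)
                (g : Vec ℕ n) (g∈ : g ∈ allVecs opts)
                (minimal : ∀ h → h ∈ allVecs opts → cnt (mono g) G ≤ cnt (mono h) G) where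

  module _ (u : Fin n) (x β : ℕ) (free : ∀ c → c < β → x + c ∈ lookup opts u) where

    moved : ℕ → Vec ℕ n
    moved c = g [ u ]≔ (x + c)

    moved∈ : ∀ c → c < β → moved c ∈ allVecs opts
    moved∈ c c<β = ∈-allVecs⁺ opts (moved c) at
      where
      at : ∀ i → lookup (moved c) i ∈ lookup opts i
      at i with i ≟ u
      ... | yes refl = subst (_∈ lookup opts u) (sym (lookup∘update u g (x + c))) (free c c<β)
      ... | no i≢u   = subst (_∈ lookup opts i) (sym (lookup∘update′ i≢u g (x + c))) (∈-allVecs⁻ opts g∈ i)

    -- Only edges at `u` change, and for a loopless edge `inc u e` is 0 or 1; the difference is
    -- stated without subtraction.
    local : ∀ c e → proj₁ e ≢ proj₂ e → ⟦ mono g e ⟧ + inc u e * ⟦ mono (moved c) e ⟧ ≡ ⟦ mono (moved c) e ⟧ + inc u e * ⟦ mono g e ⟧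
    local c (v , w) v≢w with u ≟ v | u ≟ w
    ... | yes refl | yes refl = ⊥-elim (v≢w refl)
    ... | yes refl | no _     = l ⟦ mono g (v , w) ⟧ ⟦ mono (moved c) (v , w) ⟧
      where l : ∀ a b → a + (1 + 0) * b ≡ b + (1 + 0) * a
            l = solve-∀
    ... | no _     | yes refl = l ⟦ mono g (v , w) ⟧ ⟦ mono (moved c) (v , w) ⟧
      where l : ∀ a b → a + (0 + 1) * b ≡ b + (0 + 1) * a
            l = solve-∀
    ... | no u≢v   | no u≢w   = cong (λ b → ⟦ b ⟧ + 0)
      (sym (cong₂ _≡ᵇ_ (lookup∘update′ (λ e → u≢v (sym e)) g (x + c)) (lookup∘update′ (λ e → u≢w (sym e)) g (x + c))))

    no-gain : ∀ c → c < β → ∑ G (λ e → inc u e * ⟦ mono g e ⟧) ≤ ∑ G (λ e → inc u e * ⟦ mono (moved c) e ⟧)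
    no-gain c c<β = +-cancelˡ-≤ (cnt (mono (moved c)) G) _ _ (begin
      cnt (mono (moved c)) G + ∑ G (λ e → inc u e * ⟦ mono g e ⟧)         ≡⟨ sym (∑-+ G _ _) ⟩
      ∑ G (λ e → ⟦ mono (moved c) e ⟧ + inc u e * ⟦ mono g e ⟧)           ≡⟨ ∑-cong-∈ G (λ e e∈ → sym (local c e (loopless e e∈))) ⟩
      ∑ G (λ e → ⟦ mono g e ⟧ + inc u e * ⟦ mono (moved c) e ⟧)           ≡⟨ ∑-+ G _ _ ⟩
      cnt (mono g) G + ∑ G (λ e → inc u e * ⟦ mono (moved c) e ⟧)         ≤⟨ +-monoˡ-≤ _ (minimal (moved c) (moved∈ c c<β)) ⟩
      cnt (mono (moved c)) G + ∑ G (λ e → inc u e * ⟦ mono (moved c) e ⟧) ∎)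
      where open ≤-Reasoning

    -- An edge at `u` is monochromatic for at most one of the `β` values, the one held by its other
    -- end.
    once : ∀ e → proj₁ e ≢ proj₂ e → ∑ (upTo β) (λ c → inc u e * ⟦ mono (moved c) e ⟧) ≤ inc u e
    once (v , w) v≢w with u ≟ v | u ≟ w
    ... | yes refl | yes refl = ⊥-elim (v≢w refl)
    ... | yes refl | no u≢w   = ≤-trans (≤-reflexive (∑-cong (upTo β) (λ c → trans (+-identityʳ _) (cong ⟦_⟧
            (cong₂ _≡ᵇ_ (lookup∘update u g (x + c)) (lookup∘update′ (λ e → u≢w (sym e)) g (x + c))))))) (∑-upTo-≡ᵇ β x (lookup g w))
    ... | no u≢v   | yes refl = ≤-trans (≤-reflexive (∑-cong (upTo β) (λ c → trans (+-identityʳ _) (cong ⟦_⟧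
            (trans (cong₂ _≡ᵇ_ (lookup∘update′ (λ e → u≢v (sym e)) g (x + c)) (lookup∘update u g (x + c))) (≡ᵇ-sym (lookup g v) (x + c))))))) (∑-upTo-≡ᵇ β x (lookup g v))
    ... | no _     | no _     = ≤-reflexive (trans (∑-const (upTo β) 0) (*-zeroʳ (length (upTo β))))

    -- No single move of `u` is an improvement, so the present number of conflicts at `u` is at most
    -- the average over the `β` moves.
    local-min : β * ∑ G (λ e → inc u e * ⟦ mono g e ⟧) ≤ ∑ G (inc u)
    local-min = begin
      β * ∑ G (λ e → inc u e * ⟦ mono g e ⟧)                              ≡⟨ sym (∑-upTo-const β _) ⟩
      ∑ (upTo β) (λ c → ∑ G (λ e → inc u e * ⟦ mono g e ⟧))               ≤⟨ ∑-mono-∈ (upTo β) (λ c c∈ → no-gain c (∈-upTo⁻ c∈)) ⟩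
      ∑ (upTo β) (λ c → ∑ G (λ e → inc u e * ⟦ mono (moved c) e ⟧))       ≡⟨ ∑-swap (upTo β) G _ ⟩
      ∑ G (λ e → ∑ (upTo β) (λ c → inc u e * ⟦ mono (moved c) e ⟧))       ≤⟨ ∑-mono-∈ G (λ e e∈ → once e (loopless e e∈)) ⟩
      ∑ G (inc u)                                                        ∎
      where open ≤-Reasoning

-- The ends are tested separately: an edge with both ends in `Y` has to count twice, while a test
-- counts an edge at most once.
sideTest : ∀ {n} → Vec Bool n → Bool → Edge n → Bool
sideTest Y side e = lookup Y (if side then proj₁ e else proj₂ e)

monoTest : ∀ {n} → Vec Bool n → Bool → Vec ℕ n → Edge n → Bool
monoTest Y side g e = sideTest Y side e ∧ mono g e

when : ∀ {n} → (Edge n → Bool) → (Edge n → Bool) → List (Edge n) → ℕ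
when rel T s = ∑ s (λ e → if rel e then ⟦ T e ⟧ else 0)

-- How a local minimum of the sketch G of the relevant edges of s performs on s itself.
module Transfer {n} (s G : List (Edge n)) (rel : Edge n → Bool) (d ε β : ℕ) (g : Vec ℕ n) (Y : Vec Bool n)
  (upper : ∀ side → d * when rel (monoTest Y side g) s ≤ d * cnt (monoTest Y side g) G + ε)
  (lower : ∀ side → d * cnt (sideTest Y side) G ≤ d * when rel (sideTest Y side) s + ε)
  (minimum : ∀ u → lookup Y u ≡ true → β * ∑ G (λ e → inc u e * ⟦ mono g e ⟧) ≤ ∑ G (inc u)) where

  y : Fin n → ℕ
  y u = ⟦ lookup Y u ⟧

  relInc : Fin n → ℕ
  relInc u = ∑ s (λ e → inc u e * ⟦ rel e ⟧)

  relMono : Fin n → ℕ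
  relMono u = ∑ s (λ e → inc u e * ⟦ rel e ∧ mono g e ⟧)

  private
    ⟦∧⟧ : ∀ a b → ⟦ a ∧ b ⟧ ≡ ⟦ a ⟧ * ⟦ b ⟧
    ⟦∧⟧ true  b = sym (+-identityʳ _)
    ⟦∧⟧ false b = refl

    ⟦if⟧ : ∀ (a : Bool) x → (if a then x else 0) ≡ x * ⟦ a ⟧
    ⟦if⟧ true  x = sym (*-identityʳ x)
    ⟦if⟧ false x = sym (*-zeroʳ x)

    two-sides : ∀ (xs : List (Edge n)) (φ : Edge n → ℕ) →
      ∑ (allFin n) (λ u → y u * ∑ xs (λ e → inc u e * φ e)) ≡
      ∑ xs (λ e → ⟦ sideTest Y true e ⟧ * φ e) + ∑ xs (λ e → ⟦ sideTest Y false e ⟧ * φ e)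
    two-sides xs φ = trans (handshake y xs φ) (trans (∑-cong xs (λ e → *-distribʳ-+ (φ e) (y (proj₁ e)) _)) (∑-+ xs _ _))

  relMono-sum : ∑ (allFin n) (λ u → y u * relMono u) ≡ when rel (monoTest Y true g) s + when rel (monoTest Y false g) s
  relMono-sum = trans (two-sides s _) (cong₂ _+_ (∑-cong s (pt true)) (∑-cong s (pt false)))
    where
    pt : ∀ side e → ⟦ sideTest Y side e ⟧ * ⟦ rel e ∧ mono g e ⟧ ≡ (if rel e then ⟦ monoTest Y side g e ⟧ else 0)
    pt side e with rel e
    ... | true  = sym (⟦∧⟧ (sideTest Y side e) (mono g e))
    ... | false = *-zeroʳ ⟦ sideTest Y side e ⟧

  relInc-sum : ∑ (allFin n) (λ u → y u * relInc u) ≡ when rel (sideTest Y true) s + when rel (sideTest Y false) s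
  relInc-sum = trans (two-sides s _) (cong₂ _+_ (∑-cong s (λ e → sym (⟦if⟧ (rel e) _))) (∑-cong s (λ e → sym (⟦if⟧ (rel e) _))))

  sketch-sum : β * (cnt (monoTest Y true g) G + cnt (monoTest Y false g) G) ≤ cnt (sideTest Y true) G + cnt (sideTest Y false) G
  sketch-sum = begin
    β * (cnt (monoTest Y true g) G + cnt (monoTest Y false g) G)       ≡⟨ cong (β *_) (cong₂ _+_ (∑-cong G (λ e → ⟦∧⟧ (sideTest Y true e) _)) (∑-cong G (λ e → ⟦∧⟧ (sideTest Y false e) _))) ⟩
    β * (∑ G (λ e → ⟦ sideTest Y true e ⟧ * ⟦ mono g e ⟧) + ∑ G (λ e → ⟦ sideTest Y false e ⟧ * ⟦ mono g e ⟧)) ≡⟨ cong (β *_) (sym (two-sides G _)) ⟩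
    β * ∑ (allFin n) (λ u → y u * ∑ G (λ e → inc u e * ⟦ mono g e ⟧))  ≡⟨ sym (∑-*ˡ (allFin n) β _) ⟩
    ∑ (allFin n) (λ u → β * (y u * ∑ G (λ e → inc u e * ⟦ mono g e ⟧))) ≤⟨ ∑-mono (allFin n) pt ⟩
    ∑ (allFin n) (λ u → y u * ∑ G (λ e → inc u e * 1))                 ≡⟨ two-sides G _ ⟩
    ∑ G (λ e → ⟦ sideTest Y true e ⟧ * 1) + ∑ G (λ e → ⟦ sideTest Y false e ⟧ * 1) ≡⟨ cong₂ _+_ (∑-cong G (λ e → *-identityʳ _)) (∑-cong G (λ e → *-identityʳ _)) ⟩
    cnt (sideTest Y true) G + cnt (sideTest Y false) G                 ∎
    where
    open ≤-Reasoning
    pt : ∀ u → β * (y u * ∑ G (λ e → inc u e * ⟦ mono g e ⟧)) ≤ y u * ∑ G (λ e → inc u e * 1)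
    pt u with lookup Y u in eq
    ... | false = ≤-reflexive (*-zeroʳ β)
    ... | true  = ≤-trans (≤-reflexive (cong (β *_) (+-identityʳ _))) (≤-trans (minimum u eq)
                    (≤-reflexive (trans (∑-cong G (λ e → sym (*-identityʳ (inc u e)))) (sym (+-identityʳ _)))))

  -- From true to sketched conflicts, then by local minimality to sketched incidences, and back to
  -- true incidences. The sketch error `ε` enters once per side in each comparison, multiplied by
  -- `β` in the first, hence `2 (β + 1) ε`.
  transfer : d * (β * ∑ (allFin n) (λ u → y u * relMono u)) ≤ d * ∑ (allFin n) (λ u → y u * relInc u) + 2 * suc β * ε
  transfer = begin
    d * (β * ∑ (allFin n) (λ u → y u * relMono u))     ≡⟨ cong (λ z → d * (β * z)) relMono-sum ⟩
    d * (β * (A₁ + A₂))                                ≡⟨ l₁ d β A₁ A₂ ⟩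
    β * (d * A₁ + d * A₂)                              ≤⟨ *-monoʳ-≤ β (+-mono-≤ (upper true) (upper false)) ⟩
    β * (d * P₁ + ε + (d * P₂ + ε))                    ≡⟨ l₂ d β P₁ P₂ ε ⟩
    d * (β * (P₁ + P₂)) + 2 * β * ε                    ≤⟨ +-monoˡ-≤ _ (*-monoʳ-≤ d sketch-sum) ⟩
    d * (P₃ + P₄) + 2 * β * ε                          ≡⟨ cong (_+ 2 * β * ε) (*-distribˡ-+ d P₃ P₄) ⟩
    d * P₃ + d * P₄ + 2 * β * ε                        ≤⟨ +-monoˡ-≤ _ (+-mono-≤ (lower true) (lower false)) ⟩
    d * A₃ + ε + (d * A₄ + ε) + 2 * β * ε              ≡⟨ l₃ d A₃ A₄ ε β ⟩
    d * (A₃ + A₄) + 2 * suc β * ε                      ≡⟨ cong (λ z → d * z + 2 * suc β * ε) (sym relInc-sum) ⟩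
    d * ∑ (allFin n) (λ u → y u * relInc u) + 2 * suc β * ε ∎
    where
    open ≤-Reasoning
    A₁ = when rel (monoTest Y true g) s
    A₂ = when rel (monoTest Y false g) s
    A₃ = when rel (sideTest Y true) s
    A₄ = when rel (sideTest Y false) s
    P₁ = cnt (monoTest Y true g) G
    P₂ = cnt (monoTest Y false g) G
    P₃ = cnt (sideTest Y true) G
    P₄ = cnt (sideTest Y false) G
    l₁ : ∀ d b x y → d * (b * (x + y)) ≡ b * (d * x + d * y)
    l₁ = solve-∀
    l₂ : ∀ d b x y e → b * (d * x + e + (d * y + e)) ≡ d * (b * (x + y)) + 2 * b * e
    l₂ = solve-∀
    l₃ : ∀ d x y e b → d * x + e + (d * y + e) + 2 * b * e ≡ d * (x + y) + 2 * suc b * e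
    l₃ = solve-∀

  -- A vertex of Y misses the next threshold, hence exceeds its average share by a definite gap.
  few-failures : ∀ Γ gap → (∀ u → lookup Y u ≡ true → Γ * relInc u + gap ≤ Γ * (β * relMono u)) →
                 d * (∑ (allFin n) y * gap) ≤ Γ * (2 * suc β * ε)
  few-failures Γ gap h = +-cancelˡ-≤ (Γ * (d * ∑ (allFin n) (λ u → y u * relInc u))) _ _ (begin
    Γ * (d * I) + d * (∑ (allFin n) y * gap)                       ≡⟨ l₁ Γ d I _ gap ⟩
    d * (Γ * I + gap * ∑ (allFin n) y)                             ≡⟨ cong (d *_) (sym (trans (∑-+ (allFin n) _ _) (cong₂ _+_ (∑-*ˡ (allFin n) Γ _) (∑-*ˡ (allFin n) gap y)))) ⟩
    d * ∑ (allFin n) (λ u → Γ * (y u * relInc u) + gap * y u)      ≤⟨ *-monoʳ-≤ d (∑-mono (allFin n) pt) ⟩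
    d * ∑ (allFin n) (λ u → Γ * β * (y u * relMono u))             ≡⟨ cong (d *_) (∑-*ˡ (allFin n) (Γ * β) _) ⟩
    d * (Γ * β * ∑ (allFin n) (λ u → y u * relMono u))             ≡⟨ l₂ d Γ β _ ⟩
    Γ * (d * (β * ∑ (allFin n) (λ u → y u * relMono u)))           ≤⟨ *-monoʳ-≤ Γ transfer ⟩
    Γ * (d * I + 2 * suc β * ε)                                    ≡⟨ *-distribˡ-+ Γ _ _ ⟩
    Γ * (d * I) + Γ * (2 * suc β * ε)                              ∎)
    where
    open ≤-Reasoning
    I = ∑ (allFin n) (λ u → y u * relInc u)
    l₁ : ∀ Γ d I Z gap → Γ * (d * I) + d * (Z * gap) ≡ d * (Γ * I + gap * Z)
    l₁ = solve-∀
    l₂ : ∀ d Γ β z → d * (Γ * β * z) ≡ Γ * (d * (β * z))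
    l₂ = solve-∀
    l₃ : ∀ Γ r gap → Γ * (1 * r) + gap * 1 ≡ Γ * r + gap
    l₃ = solve-∀
    l₄ : ∀ Γ b r → Γ * (b * r) ≡ Γ * b * (1 * r)
    l₄ = solve-∀
    l₅ : ∀ Γ gap → Γ * 0 + gap * 0 ≡ 0
    l₅ = solve-∀
    pt : ∀ u → Γ * (y u * relInc u) + gap * y u ≤ Γ * β * (y u * relMono u)
    pt u with lookup Y u in eq
    ... | true  = ≤-trans (≤-reflexive (l₃ Γ (relInc u) gap)) (≤-trans (h u eq) (≤-reflexive (l₄ Γ β (relMono u))))
    ... | false = ≤-trans (≤-reflexive (l₅ Γ gap)) z≤n

-- Binary codes for bounded data

-- Decoding has to invert encoding only on data satisfying `P`; this gives codes of fixed length for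
-- the bounded part of an infinite type.
record Code (A : Set) (P : A → Set) (S : ℕ) : Set where
  field
    enc     : A → Vec Bool S
    dec     : Vec Bool S → Maybe A
    dec-enc : ∀ x → P x → dec (enc x) ≡ just x
open Code

retractC : ∀ {A B : Set} {P : A → Set} {Q : B → Set} {S} (f : A → B) (g : B → Maybe A) →
           (∀ x → P x → g (f x) ≡ just x) → (∀ x → P x → Q (f x)) → Code B Q S → Code A P S
retractC f g gf pq c = record
  { enc     = λ x → enc c (f x)
  ; dec     = λ v → dec c v >>= g
  ; dec-enc = λ x p → trans (cong (_>>= g) (dec-enc c (f x) (pq x p))) (gf x p)
  }

split : ∀ m {n} → Vec Bool (m + n) → Vec Bool m × Vec Bool n
split zero    v       = [] , v
split (suc m) (b ∷ v) = let (x , y) = split m v in b ∷ x , y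

split-++ : ∀ {m n} (x : Vec Bool m) (y : Vec Bool n) → split m (x Vec.++ y) ≡ (x , y)
split-++ []      y = refl
split-++ (b ∷ x) y = cong (λ { (x , y) → b ∷ x , y }) (split-++ x y)

_⊗_ : ∀ {A B : Set} → (A → Set) → (B → Set) → A × B → Set
(P ⊗ Q) x = P (proj₁ x) × Q (proj₂ x)

pairC : ∀ {A B : Set} {P : A → Set} {Q : B → Set} {S T} → Code A P S → Code B Q T → Code (A × B) (P ⊗ Q) (S + T)
pairC {A} {B} {S = S} c d = record
  { enc     = λ { (x , y) → enc c x Vec.++ enc d y }
  ; dec     = λ v → both (split S v)
  ; dec-enc = λ { (x , y) (p , q) → trans (cong both (split-++ (enc c x) (enc d y)))
      (trans (cong (_>>= _) (dec-enc c x p)) (cong (_>>= _) (dec-enc d y q))) }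
  }
  where
  both : Vec Bool S × Vec Bool _ → Maybe (A × B)
  both (v , w) = dec c v >>= λ x → dec d w >>= λ y → just (x , y)

odd : ℕ → Bool
odd zero          = false
odd (suc zero)    = true
odd (suc (suc n)) = odd n

odd+half : ∀ n → ⟦ odd n ⟧ + 2 * ⌊ n /2⌋ ≡ n
odd+half zero          = refl
odd+half (suc zero)    = refl
odd+half (suc (suc n)) = trans (cong (⟦ odd n ⟧ +_) (*-suc 2 ⌊ n /2⌋))
  (trans (trans (sym (+-assoc ⟦ odd n ⟧ 2 _)) (trans (cong (_+ 2 * ⌊ n /2⌋) (+-comm ⟦ odd n ⟧ 2)) (+-assoc 2 ⟦ odd n ⟧ _))) (cong (2 +_) (odd+half n)))

bits : ∀ k → ℕ → Vec Bool k
bits zero    x = []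
bits (suc k) x = odd x ∷ bits k ⌊ x /2⌋

number : ∀ {k} → Vec Bool k → ℕ
number []      = 0
number (b ∷ v) = ⟦ b ⟧ + 2 * number v

number-bits : ∀ k x → x < 2 ^ k → number (bits k x) ≡ x
number-bits zero    zero    _  = refl
number-bits zero    (suc x) (s≤s ())
number-bits (suc k) x       lt = trans (cong (λ z → ⟦ odd x ⟧ + 2 * z) (number-bits k ⌊ x /2⌋
  (*-cancelˡ-< 2 _ _ (≤-<-trans (≤-trans (m≤n+m (2 * ⌊ x /2⌋) ⟦ odd x ⟧) (≤-reflexive (odd+half x))) lt)))) (odd+half x)

natC : ∀ k → Code ℕ (_< 2 ^ k) k
natC k = record { enc = bits k ; dec = λ v → just (number v) ; dec-enc = λ x lt → cong just (number-bits k x lt) }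

finC : ∀ n k → n ≤ 2 ^ k → Code (Fin n) (λ _ → ⊤) k
finC n k n≤ = retractC toℕ back back-toℕ (λ i _ → ≤-trans (toℕ<n i) n≤) (natC k)
  where
  back : ℕ → Maybe (Fin n)
  back x with x <? n
  ... | yes x<n = just (fromℕ< x<n)
  ... | no _    = nothing
  back-toℕ : ∀ i → ⊤ → back (toℕ i) ≡ just i
  back-toℕ i _ with toℕ i <? n
  ... | yes lt = cong just (fromℕ<-toℕ i lt)
  ... | no ¬lt = ⊥-elim (¬lt (toℕ<n i))

vecC : ∀ {A : Set} {P : A → Set} {S} → Code A P S → ∀ n → Code (Vec A n) (VAll.All P) (n * S)
vecC c zero    = record { enc = λ _ → [] ; dec = λ _ → just [] ; dec-enc = λ { [] _ → refl } }
vecC c (suc n) = retractC (λ { (x ∷ xs) → x , xs }) (λ { (x , xs) → just (x ∷ xs) }) (λ { (x ∷ xs) _ → refl })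
                   (λ { (x ∷ xs) (p VAll.∷ ps) → p , ps }) (pairC c (vecC c n))

data MaybeAll {A : Set} (P : A → Set) : Maybe A → Set where
  none : MaybeAll P nothing
  some : ∀ {x} → P x → MaybeAll P (just x)

maybeC : ∀ {A : Set} {P : A → Set} {S} → Code A P S → Code (Maybe A) (MaybeAll P) (suc S)
maybeC {A} {S = S} c = record { enc = to ; dec = from ; dec-enc = λ { nothing _ → refl ; (just x) (some p) → cong (_>>= λ y → just (just y)) (dec-enc c x p) } }
  where
  to : Maybe A → Vec Bool (suc S)
  to nothing  = replicate _ false
  to (just x) = true ∷ enc c x
  from : Vec Bool (suc S) → Maybe (Maybe A)
  from (false ∷ v) = just nothing
  from (true ∷ v)  = dec c v >>= λ x → just (just x)

ShortList : ∀ {A : Set} → (A → Set) → ℕ → List A → Set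
ShortList P N xs = length xs ≤ N × LAll.All P xs

-- The list is padded to `N` optional entries and ends at the first `nothing`.
listC : ∀ {A : Set} {P : A → Set} {S} → Code A P S → ∀ N → Code (List A) (ShortList P N) (N * suc S)
listC c zero = record { enc = λ _ → [] ; dec = λ _ → just [] ; dec-enc = λ { [] _ → refl ; (x ∷ xs) (() , _) } }
listC {A} {P} c (suc N) = retractC split′ join (λ { [] _ → refl ; (x ∷ xs) _ → refl })
    (λ { [] _ → none , z≤n , LAll.[] ; (x ∷ xs) (s≤s le , p LAll.∷ ps) → some p , le , ps }) (pairC (maybeC c) (listC c N))
  where
  split′ : List A → Maybe A × List A
  split′ []       = nothing , []
  split′ (x ∷ xs) = just x , xs
  join : Maybe A × List A → Maybe (List A)
  join (nothing , _) = just []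
  join (just x , xs) = just (x ∷ xs)

-- Multi-pass machines with structured memory, and their simulation on bit strings

record Machine (n : ℕ) : Set₁ where
  field
    Mem Work : Set
    start    : Mem
    fresh    : Mem → Work
    read     : Mem → Work → Edge n → Work
    finish   : Mem → Work → Mem
    done     : Mem → Bool
    colour   : Mem → Fin n → ℕ

module Simulation {n} (𝓜 : Machine n) {S} {VM : Machine.Mem 𝓜 → Set} {VW : Machine.Work 𝓜 → Set}
                  (code : Code (Machine.Mem 𝓜 × Machine.Work 𝓜) (VM ⊗ VW) S) where

  open Machine 𝓜

  -- A bit string that does not decode is read as the initial state; runs through valid memories
  -- never produce one.
  state : Vec Bool S → Mem × Work
  state v = fromMaybe (start , fresh start) (dec code v)

  state-enc : ∀ m w → VM m → VW w → state (enc code (m , w)) ≡ (m , w)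
  state-enc m w vm vw = cong (fromMaybe _) (dec-enc code (m , w) (vm , vw))

  algorithm : StreamAlg n S
  algorithm = record
    { init    = enc code (start , fresh start)
    ; step    = λ v e → let (m , w) = state v in enc code (m , read m w e)
    ; endPass = λ v → let (m , w) = state v ; m′ = finish m w in enc code (m′ , fresh m′)
    ; halted  = λ v → done (proj₁ (state v))
    ; output  = λ v → colour (proj₁ (state v))
    }

  run : Mem → List (Edge n) → Work
  run m = foldl (read m) (fresh m)

  pass : List (Edge n) → Mem → Mem
  pass s m = finish m (run m s)

  memory : List (Edge n) → ℕ → Mem
  memory s zero    = start
  memory s (suc p) = pass s (memory s p)

  iterate : List (Edge n) → ℕ → Mem → Mem
  iterate s zero    m = m
  iterate s (suc p) m = iterate s p (pass s m)

  memory-iterate : ∀ s p → memory s p ≡ iterate s p start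
  memory-iterate s zero    = refl
  memory-iterate s (suc p) = trans (cong (pass s) (memory-iterate s p)) (sym (go p start))
    where
    go : ∀ p m → iterate s (suc p) m ≡ pass s (iterate s p m)
    go zero    m = refl
    go (suc p) m = go p (pass s m)

  module _ (s : List (Edge n)) (valid : ∀ m xs ys → VM m → xs ++ ys ≡ s → VW (run m xs)) where

    -- Validity is needed on every prefix of the stream, because the state is encoded anew after
    -- each edge.
    steps : ∀ m → VM m → ∀ xs ys → xs ++ ys ≡ s →
            foldl (step algorithm) (enc code (m , run m xs)) ys ≡ enc code (m , run m s)
    steps m vm xs [] eq = cong (λ z → enc code (m , run m z)) (trans (sym (++-identityʳ xs)) eq)
    steps m vm xs (y ∷ ys) eq = trans (cong (λ z → foldl (step algorithm) z ys) one) (steps m vm (xs ++ y ∷ []) ys (trans (++-assoc xs (y ∷ []) ys) eq))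
      where
      foldl-snoc : ∀ w zs → foldl (read m) w (zs ++ y ∷ []) ≡ read m (foldl (read m) w zs) y
      foldl-snoc w []       = refl
      foldl-snoc w (z ∷ zs) = foldl-snoc (read m w z) zs
      one : step algorithm (enc code (m , run m xs)) y ≡ enc code (m , run m (xs ++ y ∷ []))
      one rewrite state-enc m (run m xs) vm (valid m xs (y ∷ ys) vm eq) = cong (λ z → enc code (m , z)) (sym (foldl-snoc (fresh m) xs))

    simulates : ∀ p → (∀ q → q < p → VM (memory s q)) → afterPasses algorithm s p ≡ enc code (memory s p , fresh (memory s p))
    simulates zero    h = refl
    simulates (suc p) h = trans (cong (endPass algorithm) (trans (cong (λ v → foldl (step algorithm) v s) (simulates p (λ q q<p → h q (m<n⇒m<1+n q<p))))
        (steps m vm [] s refl))) end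
      where
      m = memory s p
      vm = h p ≤-refl
      end : endPass algorithm (enc code (m , run m s)) ≡ enc code (pass s m , fresh (pass s m))
      end rewrite state-enc m (run m s) vm (valid m s [] vm (++-identityʳ s)) = refl

    simulates-state : ∀ p → (∀ q → q ≤ p → VM (memory s q)) → proj₁ (state (afterPasses algorithm s p)) ≡ memory s p
    simulates-state p h = trans (cong (λ v → proj₁ (state v)) (simulates p (λ q q<p → h q (<⇒≤ q<p))))
      (cong proj₁ (state-enc (memory s p) (fresh (memory s p)) (h p ≤-refl) (valid (memory s p) [] s (h p ≤-refl) refl)))

-- The algorithm

-- Total division, as block sizes are known to be positive only for admissible parameters.
_÷_ : ℕ → ℕ → ℕ
x ÷ zero  = 0
x ÷ suc k = x / suc k

÷-÷ : ∀ x k l → 0 < k → 0 < l → (x ÷ k) ÷ l ≡ x ÷ (k * l)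
÷-÷ x (suc k) (suc l) _ _ = m/n/o≡m/[n*o] x (suc k) (suc l)

÷-digit : ∀ B β c → c < β → (B * β + c) ÷ β ≡ B
÷-digit B β@(suc _) c c<β = trans (+-distrib-/-∣ˡ c (n∣m*n B)) (trans (cong₂ _+_ (m*n/n≡m B β) (m<n⇒m/n≡0 c<β)) (+-identityʳ B))

-- The palette of a round has top · base^depth colours; slack is the z of its family of functions,
-- and precision + 1 the d of its halving step.
record Spec : Set where
  field
    sampled     : Bool
    base depth top : ℕ
    slack       : ℕ
    precision   : ℕ
open Spec

-- Blocks with j levels to go hold K j colours; level j + 1 splits a block into β j blocks.
K : Spec → ℕ → ℕ
K σ zero    = 1
K σ (suc j) = top σ * base σ ^ j

β : Spec → ℕ → ℕ
β σ zero    = top σ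
β σ (suc j) = base σ

K-suc : ∀ σ j → K σ (suc j) ≡ K σ j * β σ j
K-suc σ zero    = trans (*-identityʳ (top σ)) (sym (+-identityʳ (top σ)))
K-suc σ (suc j) = lem (top σ) (base σ) (base σ ^ j)
  where lem : ∀ t b p → t * (b * p) ≡ t * p * b
        lem = solve-∀

size : Spec → ℕ
size σ = K σ (suc (depth σ))

-- There are `depth + 2` thresholds, counting the initial one. Sharing the surplus equally among
-- them makes the topmost threshold equal to the maximum degree.
Γ : Spec → ℕ
Γ σ = size σ * suc (suc (depth σ))

isJust : Maybe ℕ → Bool
isJust (just _) = true
isJust nothing  = false

position : Maybe ℕ → Maybe ℕ → ℕ → Maybe ℕ
position (just B) _        k = just B
position nothing  (just y) k = just (y ÷ k)
position nothing  nothing  k = nothing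

-- `B * b + x` numbers the x-th sub-block of block `B`. The 0 of an idle vertex is a dummy, since
-- edges at idle vertices are never relevant.
place : Maybe ℕ → Maybe ℕ → ℕ → ℕ → ℕ → ℕ
place (just B) _        b k x = B * b + x
place nothing  (just y) b k x = y ÷ k
place nothing  nothing  b k x = 0

options : Maybe ℕ → Maybe ℕ → ℕ → ℕ → List ℕ
options (just B) _ b k = map (B * b +_) (upTo b)
options nothing  y b k = place nothing y b k 0 ∷ []

keep : Maybe ℕ → Bool → ℕ → Maybe ℕ
keep (just _) true  x = just x
keep (just _) false x = nothing
keep nothing  _     x = nothing

recolour : Maybe ℕ → Maybe ℕ → Maybe ℕ
recolour (just x) y = just x
recolour nothing  y = y

activate : Maybe ℕ → Maybe ℕ
activate nothing  = just 0
activate (just _) = nothing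

agree : Maybe ℕ → Maybe ℕ → Bool
agree (just x) (just y) = x ≡ᵇ y
agree _        _        = false

data Mode : Set where
  degrees choose filter : Mode

-- A vertex is coloured (col), or active inside a block of colours (blk), or idle until the next round;
-- between the two passes of a level, cand holds the proposed sub-blocks.
record Memory (n : ℕ) : Set where
  constructor mem
  field
    maxdeg : ℕ
    round  : ℕ
    level  : ℕ
    mode   : Mode
    col    : Vec (Maybe ℕ) n
    blk    : Vec (Maybe ℕ) n
    cand   : Vec ℕ n
open Memory

record Working (n L mb : ℕ) : Set where
  constructor working
  field
    load   : Vec ℕ n
    cost   : Vec ℕ (suc mb)
    sketch : Vec (List (Edge n)) L
open Working

module Algorithm (n L N mb : ℕ) (spec : ℕ → ℕ → Spec) where

  σ : Memory n → Spec
  σ m = spec (maxdeg m) (round m)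

  b k k⁺ : Memory n → ℕ
  b m  = β (σ m) (level m)
  k m  = K (σ m) (level m)
  k⁺ m = K (σ m) (suc (level m))

  pos : Memory n → Fin n → Maybe ℕ
  pos m v = position (lookup (blk m) v) (lookup (col m) v) (k⁺ m)

  active : Memory n → Fin n → Bool
  active m v = isJust (lookup (blk m) v)

  -- Only these edges can still cause a conflict in this round: ends in different blocks never meet
  -- again, two coloured ends already differ, and an idle end receives no colour.
  rel : Memory n → Edge n → Bool
  rel m e = agree (pos m (proj₁ e)) (pos m (proj₂ e)) ∧ (active m (proj₁ e) ∨ active m (proj₂ e))

  placeAt : Memory n → Vec ℕ n → Fin n → ℕ
  placeAt m f v = place (lookup (blk m) v) (lookup (col m) v) (b m) (k m) (lookup f v)

  placement : Memory n → Vec ℕ n → Vec ℕ n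
  placement m f = tabulate (placeAt m f)

  optionsAt : Memory n → Fin n → List ℕ
  optionsAt m v = options (lookup (blk m) v) (lookup (col m) v) (b m) (k m)

  opts : Memory n → Vec (List ℕ) n
  opts m = tabulate (optionsAt m)

  subsetsAt : Memory n → Fin n → List Bool
  subsetsAt m v = if active m v then true ∷ false ∷ [] else false ∷ []

  subsets : Memory n → Vec (List Bool) n
  subsets m = tabulate (subsetsAt m)

  -- The choice `g` and the set `Y` of failing vertices are determined only after the sketch is
  -- complete, so all possible pairs are tested in advance.
  monoTests sideTests : Memory n → Bool → List (Edge n → Bool)
  monoTests m side = cartesianProductWith (λ Y g → monoTest Y side g) (allVecs (subsets m)) (allVecs (opts m))
  sideTests m side = map (λ Y → sideTest Y side) (allVecs (subsets m))

  tests : Memory n → List (Edge n → Bool)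
  tests m = (monoTests m true ++ monoTests m false) ++ (sideTests m true ++ sideTests m false)

  halve : Memory n → List (Edge n) → List (Edge n)
  halve m = Halving.halve (tests m) (precision (σ m))

  sample : Memory n → Fin (suc mb) → Vec ℕ n
  sample m i = lookup (family n (size (σ m)) (slack (σ m)) (suc mb)) i

  countedAs : Mode → Memory n → Edge n → Bool
  countedAs degrees m e = true
  countedAs choose  m e = rel m e ∧ mono (cand m) e
  countedAs filter  m e = rel m e ∧ mono (cand m) e

  counted : Memory n → Edge n → Bool
  counted m = countedAs (mode m) m

  endpoints : Memory n → Edge n → ℕ
  endpoints m e = ⟦ active m (proj₁ e) ⟧ + ⟦ active m (proj₂ e) ⟧

  -- One unit for each active end, so that the total is the sum of the loads of the active vertices
  -- and bounds the number of failures.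
  charge : Memory n → Fin (suc mb) → Edge n → ℕ
  charge m i e = endpoints m e * ⟦ rel m e ∧ mono (placement m (sample m i)) e ⟧

  fresh : Memory n → Working n L mb
  fresh m = working (replicate n 0) (replicate (suc mb) 0) (replicate L [])

  read : Memory n → Working n L mb → Edge n → Working n L mb
  read m w e = working
    (tabulate (λ v → lookup (load w) v + inc v e * ⟦ counted m e ⟧))
    (tabulate (λ i → lookup (cost w) i + charge m i e))
    (if rel m e then Sketch.push (halve m) N (e ∷ []) (sketch w) else sketch w)

  flat : Memory n → Working n L mb → List (Edge n)
  flat m w = Sketch.flat (halve m) N (sketch w)

  startRound : ℕ → ℕ → Vec (Maybe ℕ) n → Memory n
  startRound Δ r c = mem Δ r (depth (spec Δ r)) choose c (Vec.map activate c) (replicate n 0)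

  cheapest : Memory n → Working n L mb → Fin (suc mb)
  cheapest m w = argmin (lookup (cost w)) zero (allFin (suc mb))

  -- Exhaustive search, as the model does not bound computation. The default of `argmin` is itself
  -- one of the option vectors, so the minimiser lies in the list.
  flattest : Memory n → Working n L mb → Vec ℕ n
  flattest m w = argmin (λ g → cnt (mono g) (flat m w)) (placement m (replicate n 0)) (allVecs (opts m))

  abstract
    best : Memory n → Working n L mb → Vec ℕ n
    best m w = if sampled (σ m) then placement m (sample m (cheapest m w)) else flattest m w

    best-sampled : ∀ m w → sampled (σ m) ≡ true → best m w ≡ placement m (sample m (cheapest m w))
    best-sampled m w e = cong (λ z → if z then placement m (sample m (cheapest m w)) else flattest m w) e

    best-sketched : ∀ m w → sampled (σ m) ≡ false → best m w ≡ flattest m w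
    best-sketched m w e = cong (λ z → if z then placement m (sample m (cheapest m w)) else flattest m w) e

  -- With j levels to go a block of K j colours tolerates a load of (1 - (j + 1) δ) K j, where δ = excess / Γ.
  -- At the top this is what the maximum degree guarantees, and for j = 0 it forces load 0.
  light : Memory n → ℕ → Bool
  light m l = l * Γ (σ m) + k m * suc (level m) * (size (σ m) ∸ maxdeg m) ≤ᵇ k m * Γ (σ m)

  survivors : Memory n → Working n L mb → Vec (Maybe ℕ) n
  survivors m w = tabulate (λ v → keep (lookup (blk m) v) (light m (lookup (load w) v)) (lookup (cand m) v))

  -- At level 0 a surviving sub-block is a single colour. All vertices that dropped out become
  -- active again in the next round.
  descend : Memory n → ℕ → Vec (Maybe ℕ) n → Memory n
  descend m zero    bl = startRound (maxdeg m) (suc (round m)) (Vec.zipWith recolour bl (col m))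
  descend m (suc j) bl = mem (maxdeg m) (round m) j choose (col m) bl (replicate n 0)

  maximum : ∀ {j} → Vec ℕ j → ℕ
  maximum = Vec.foldr _ _⊔_ 0

  finishAs : Mode → Memory n → Working n L mb → Memory n
  finishAs degrees m w = startRound (maximum (load w)) 0 (col m)
  finishAs choose  m w = mem (maxdeg m) (round m) (level m) filter (col m) (blk m) (best m w)
  finishAs filter  m w = descend m (level m) (survivors m w)

  finish : Memory n → Working n L mb → Memory n
  finish m = finishAs (mode m) m

  start : Memory n
  start = mem 0 0 0 degrees (replicate n nothing) (replicate n nothing) (replicate n 0)

  done : Memory n → Bool
  done m = Vec.foldr _ (λ c r → isJust c ∧ r) true (col m)

  machine : Machine n
  machine = record
    { Mem = Memory n ; Work = Working n L mb ; start = start ; fresh = fresh ; read = read ; finish = finish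
    ; done = done ; colour = λ m v → fromMaybe 0 (lookup (col m) v) }

  run : Memory n → List (Edge n) → Working n L mb
  run m = foldl (read m) (fresh m)

  pass : List (Edge n) → Memory n → Memory n
  pass s m = finish m (run m s)

  run-load : ∀ m s v → lookup (load (run m s)) v ≡ ∑ s (λ e → inc v e * ⟦ counted m e ⟧)
  run-load m s v = trans (go s (fresh m)) (cong (_+ ∑ s (λ e → inc v e * ⟦ counted m e ⟧)) (lookup-replicate v 0))
    where
    go : ∀ s w → lookup (load (foldl (read m) w s)) v ≡ lookup (load w) v + ∑ s (λ e → inc v e * ⟦ counted m e ⟧)
    go []      w = sym (+-identityʳ _)
    go (e ∷ s) w = trans (go s (read m w e)) (trans (cong (_+ ∑ s (λ e → inc v e * ⟦ counted m e ⟧)) (lookup∘tabulate (λ v → lookup (load w) v + inc v e * ⟦ counted m e ⟧) v)) (+-assoc (lookup (load w) v) _ _))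

  run-cost : ∀ m s i → lookup (cost (run m s)) i ≡ ∑ s (charge m i)
  run-cost m s i = trans (go s (fresh m)) (cong (_+ ∑ s (charge m i)) (lookup-replicate i 0))
    where
    go : ∀ s w → lookup (cost (foldl (read m) w s)) i ≡ lookup (cost w) i + ∑ s (charge m i)
    go []      w = sym (+-identityʳ _)
    go (e ∷ s) w = trans (go s (read m w e)) (trans (cong (_+ ∑ s (charge m i)) (lookup∘tabulate (λ i → lookup (cost w) i + charge m i e) i)) (+-assoc (lookup (cost w) i) _ _))

  run-sketch : ∀ m s → sketch (run m s) ≡ Sketch.sketchFrom (halve m) N (rel m) (replicate L []) s
  run-sketch m s = go s (fresh m)
    where
    go : ∀ s w → sketch (foldl (read m) w s) ≡ Sketch.sketchFrom (halve m) N (rel m) (sketch w) s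
    go []      w = refl
    go (e ∷ s) w = go s (read m w e)

true⇒T : ∀ {b} → b ≡ true → T b
true⇒T refl = tt

≤ᵇ-true : ∀ {a b} → (a ≤ᵇ b) ≡ true → a ≤ b
≤ᵇ-true {a} {b} e = ≤ᵇ⇒≤ a b (true⇒T e)

≤ᵇ-false : ∀ {a b} → (a ≤ᵇ b) ≡ false → b < a
≤ᵇ-false {a} {b} e = ≰⇒> (λ le → subst T e (≤⇒≤ᵇ le))

≡ᵇ-true : ∀ {a b} → (a ≡ᵇ b) ≡ true → a ≡ b
≡ᵇ-true {a} {b} e = ≡ᵇ⇒≡ a b (true⇒T e)

≡ᵇ-refl : ∀ a → (a ≡ᵇ a) ≡ true
≡ᵇ-refl zero    = refl
≡ᵇ-refl (suc a) = ≡ᵇ-refl a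

∧-true : ∀ {a b} → (a ∧ b) ≡ true → a ≡ true × b ≡ true
∧-true {true} e = refl , e

agree-true : ∀ {p q} → agree p q ≡ true → Σ ℕ λ x → p ≡ just x × q ≡ just x
agree-true {just x} {just y} e = x , refl , cong just (sym (≡ᵇ-true e))

agree-refl : ∀ {p q x} → p ≡ just x → q ≡ just x → agree p q ≡ true
agree-refl {x = x} refl refl = ≡ᵇ-refl x

isJust-true : ∀ {p} → isJust p ≡ true → Σ ℕ λ x → p ≡ just x
isJust-true {just x} _ = x , refl

-- Admissible parameters and invariants of a run

record Admissible (Δ C : ℕ) (σ : Spec) : Set where
  field
    0<base : 0 < base σ
    0<top  : 0 < top σ
    Δ<size : Δ < size σ
    size≤C : size σ ≤ C
open Admissible

0<K : ∀ {Δ C σ} → Admissible Δ C σ → ∀ j → 0 < K σ j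
0<K ok zero    = s≤s z≤n
0<K ok (suc j) = *-mono-≤ (0<top ok) (^-pos _ j (0<base ok))

0<β : ∀ {Δ C σ} → Admissible Δ C σ → ∀ j → 0 < β σ j
0<β ok zero    = 0<top ok
0<β ok (suc j) = 0<base ok

module Analysis (n L N mb : ℕ) (spec : ℕ → ℕ → Spec) (s : List (Edge n)) (loopless : ∀ e → e ∈ s → proj₁ e ≢ proj₂ e)
                (Δ C : ℕ) (inc≤Δ : ∀ v → ∑ s (inc v) ≤ Δ) (admissible : ∀ r → Admissible Δ C (spec Δ r)) where

  open Algorithm n L N mb spec public

  relLoad : Memory n → Fin n → ℕ
  relLoad m v = ∑ s (λ e → inc v e * ⟦ rel m e ⟧)

  monoLoad : Memory n → Fin n → ℕ
  monoLoad m v = ∑ s (λ e → inc v e * ⟦ rel m e ∧ mono (cand m) e ⟧)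

  excess : Memory n → ℕ
  excess m = size (σ m) ∸ maxdeg m

  -- `balanced` is the test `light` of the level above, restated for the edges that are relevant at
  -- the present level.
  record Invariant (m : Memory n) : Set where
    field
      maxdeg≡  : maxdeg m ≡ Δ
      proper   : ∀ e → e ∈ s → ∀ {x} → lookup (col m) (proj₁ e) ≡ just x → lookup (col m) (proj₂ e) ≡ just x → ⊥
      bounded  : ∀ v {y} → lookup (col m) v ≡ just y → y < C
      disjoint : ∀ v {B} → lookup (blk m) v ≡ just B → lookup (col m) v ≡ nothing
      inside   : ∀ v {B} → lookup (blk m) v ≡ just B → suc B * k⁺ m ≤ size (σ m)
      balanced : ∀ v {B} → lookup (blk m) v ≡ just B → relLoad m v * Γ (σ m) + k⁺ m * suc (suc (level m)) * excess m ≤ k⁺ m * Γ (σ m)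
  open Invariant public

  record Candidate (m : Memory n) : Set where
    field
      digit : ∀ v {B} → lookup (blk m) v ≡ just B → Σ ℕ λ c → c < b m × lookup (cand m) v ≡ B * b m + c
      fixed : ∀ v {y} → lookup (blk m) v ≡ nothing → lookup (col m) v ≡ just y → lookup (cand m) v ≡ y ÷ k m
      idle  : ∀ v → lookup (blk m) v ≡ nothing → lookup (col m) v ≡ nothing → lookup (cand m) v ≡ 0
  open Candidate public

  ok : ∀ {m} → Invariant m → Admissible Δ C (σ m)
  ok {m} inv = subst (λ D → Admissible Δ C (spec D (round m))) (sym (maxdeg≡ inv)) (admissible (round m))

  0<excess : ∀ {m} → Invariant m → 0 < excess m
  0<excess {m} inv = m<n⇒0<n∸m (subst (_< size (σ m)) (sym (maxdeg≡ inv)) (Δ<size (ok inv)))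

  0<Γ : ∀ {m} → Invariant m → 0 < Γ (σ m)
  0<Γ {m} inv = *-mono-≤ (0<K (ok inv) (suc (depth (σ m)))) (s≤s (z≤n {suc (depth (σ m))}))

  relLoad≤Δ : ∀ m v → relLoad m v ≤ Δ
  relLoad≤Δ m v = ≤-trans (∑-mono s (λ e → ≤-trans (*-monoʳ-≤ (inc v e) (⟦⟧≤1 (rel m e))) (≤-reflexive (*-identityʳ _)))) (inc≤Δ v)

  module Step (m : Memory n) (inv : Invariant m) (cok : Candidate m) where

    kept : (Fin n → Bool) → Fin n → Maybe ℕ
    kept l v = keep (lookup (blk m) v) (l v) (lookup (cand m) v)

    kept-just : ∀ l v {x} → kept l v ≡ just x → Σ ℕ λ B → lookup (blk m) v ≡ just B × l v ≡ true × lookup (cand m) v ≡ x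
    kept-just l v e with lookup (blk m) v | l v
    kept-just l v e | just B | true  = B , refl , refl , just-injective e

    childPos : (Fin n → Bool) → Fin n → Maybe ℕ
    childPos l v = position (kept l v) (lookup (col m) v) (k m)

    -- Blocks are nested: dividing the number of a child block by `b m` gives its parent. For a
    -- coloured vertex both numbers are quotients of its colour.
    parent : ∀ l v {x} → childPos l v ≡ just x → lookup (cand m) v ≡ x × pos m v ≡ just (x ÷ b m)
    parent l v e with lookup (blk m) v in eqB | l v
    parent l v e | just B | true with digit cok v eqB
    ... | c , c<b , eqc = just-injective e , cong just (trans (sym (÷-digit B (b m) c c<b)) (cong (_÷ b m) (trans (sym eqc) (just-injective e))))
    -- A failing active vertex is uncoloured, so it has no position below its old block.
    parent l v e | just B | false with trans (sym (cong (λ z → position nothing z (k m)) (disjoint inv v eqB))) e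
    ... | ()
    parent l v e | nothing | _ with lookup (col m) v in eqC
    ... | just y = trans (fixed cok v eqB eqC) (just-injective e) ,
                   cong just (trans (trans (cong (y ÷_) (K-suc (σ m) (level m))) (sym (÷-÷ y (k m) (b m) (0<K (ok inv) (level m)) (0<β (ok inv) (level m))))) (cong (_÷ b m) (just-injective e)))

    active-kept : ∀ l v {x} → kept l v ≡ just x → active m v ≡ true
    active-kept l v e with kept-just l v e
    ... | B , eqB , _ = cong isJust eqB

    -- Two vertices in the same child block were in the same block before, and the filter pass counted their edge.
    edge-counted : ∀ l e {x} → childPos l (proj₁ e) ≡ just x → childPos l (proj₂ e) ≡ just x →
                   (isJust (kept l (proj₁ e)) ∨ isJust (kept l (proj₂ e))) ≡ true → (rel m e ∧ mono (cand m) e) ≡ true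
    edge-counted l (u , v) {x} pu pv act with parent l u pu | parent l v pv
    ... | cu , qu | cv , qv = cong₂ _∧_ (cong₂ _∧_ (agree-refl qu qv) act′) (trans (cong₂ _≡ᵇ_ cu cv) (≡ᵇ-refl x))
      where
      act′ : (active m u ∨ active m v) ≡ true
      act′ with isJust (kept l u) in eu
      ... | true  = cong (_∨ active m v) (active-kept l u (proj₂ (isJust-true eu)))
      ... | false = trans (cong (active m u ∨_) (active-kept l v (proj₂ (isJust-true act)))) (∨-true (active m u))
        where ∨-true : ∀ a → (a ∨ true) ≡ true
              ∨-true true  = refl
              ∨-true false = refl

    child-inside : ∀ l v {x} → kept l v ≡ just x → suc x * k m ≤ size (σ m)
    child-inside l v {x} e with kept-just l v e
    ... | B , eqB , _ , eqx with digit cok v eqB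
    ... | c , c<b , eqc = begin
      suc x * k m                ≡⟨ cong (λ z → suc z * k m) (trans (sym eqx) eqc) ⟩
      suc (B * b m + c) * k m    ≡⟨ cong (_* k m) (sym (+-suc (B * b m) c)) ⟩
      (B * b m + suc c) * k m    ≤⟨ *-monoˡ-≤ (k m) (+-monoʳ-≤ (B * b m) c<b) ⟩
      (B * b m + b m) * k m      ≡⟨ lem B (b m) (k m) ⟩
      suc B * (k m * b m)        ≡⟨ cong (suc B *_) (sym (K-suc (σ m) (level m))) ⟩
      suc B * k⁺ m               ≤⟨ inside inv v eqB ⟩
      size (σ m)                 ∎
      where
      open ≤-Reasoning
      lem : ∀ B b k → (B * b + b) * k ≡ suc B * (k * b)
      lem = solve-∀

  uncoloured : Vec (Maybe ℕ) n → ℕ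
  uncoloured c = ∑ (allFin n) (λ v → ⟦ not (isJust (lookup c v)) ⟧)

  blocks : Vec (Maybe ℕ) n → ℕ
  blocks c = ∑ (allFin n) (λ v → ⟦ isJust (lookup c v) ⟧)

  startRound-invariant : ∀ r c → (∀ e → e ∈ s → ∀ {x} → lookup c (proj₁ e) ≡ just x → lookup c (proj₂ e) ≡ just x → ⊥) →
                         (∀ v {y} → lookup c v ≡ just y → y < C) → Invariant (startRound Δ r c)
  startRound-invariant r c pr bd = record
    { maxdeg≡ = refl ; proper = pr ; bounded = bd
    ; disjoint = dj
    ; inside = λ v e → ≤-reflexive (trans (cong (λ z → suc z * size τ) (just0 v e)) (*-identityˡ _))
    ; balanced = λ v e → ≤-trans (+-monoˡ-≤ _ (*-monoˡ-≤ (Γ τ) (relLoad≤Δ m v)))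
        (≤-reflexive (trans (lem Δ (size τ) (suc (suc (depth τ))) (size τ ∸ Δ)) (cong (_* Γ τ) (m+[n∸m]≡n (<⇒≤ (Δ<size (admissible r)))))))
    }
    where
    m = startRound Δ r c
    τ = spec Δ r
    lem : ∀ D S T x → D * (S * T) + S * T * x ≡ (D + x) * (S * T)
    lem = solve-∀
    just0 : ∀ v {B} → lookup (blk m) v ≡ just B → B ≡ 0
    just0 v e with lookup c v | trans (sym (lookup-map v activate c)) e
    ... | nothing | refl = refl
    dj : ∀ v {B} → lookup (blk m) v ≡ just B → lookup c v ≡ nothing
    dj v e with lookup c v | trans (sym (lookup-map v activate c)) e
    ... | nothing | _ = refl

  startRound-blocks : ∀ r c → blocks (blk (startRound Δ r c)) ≡ uncoloured c
  startRound-blocks r c = ∑-cong (allFin n) (λ v → trans (cong (λ z → ⟦ isJust z ⟧) (lookup-map v activate c)) (pt (lookup c v)))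
    where pt : ∀ y → ⟦ isJust (activate y) ⟧ ≡ ⟦ not (isJust y) ⟧
          pt (just _) = refl
          pt nothing  = refl

  module Filter (r j : ℕ) (c bl : Vec (Maybe ℕ) n) (ca : Vec ℕ n)
                (inv : Invariant (mem Δ r j filter c bl ca)) (cok : Candidate (mem Δ r j filter c bl ca)) where

    m : Memory n
    m = mem Δ r j filter c bl ca

    open Step m inv cok

    w = run m s

    l : Fin n → Bool
    l v = light m (monoLoad m v)

    survivor : ∀ v → lookup (survivors m w) v ≡ kept l v
    survivor v = trans (lookup∘tabulate (λ v → keep (lookup bl v) (light m (lookup (load w) v)) (lookup ca v)) v)
                       (cong (λ z → keep (lookup bl v) (light m z) (lookup ca v)) (run-load m s v))

    fails : Fin n → Bool
    fails v = active m v ∧ not (l v)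

    failed : Vec Bool n
    failed = tabulate fails

    failed-count : blocks (survivors m w) + ∑ (allFin n) (λ v → ⟦ lookup failed v ⟧) ≡ blocks bl
    failed-count = trans (sym (∑-+ (allFin n) _ _)) (∑-cong (allFin n) (λ v →
      trans (cong₂ (λ x y → ⟦ isJust x ⟧ + ⟦ y ⟧) (survivor v) (lookup∘tabulate fails v)) (pt (lookup bl v) (l v) (lookup ca v))))
      where
      pt : ∀ B x y → ⟦ isJust (keep B x y) ⟧ + ⟦ isJust B ∧ not x ⟧ ≡ ⟦ isJust B ⟧
      pt (just _) true  y = refl
      pt (just _) false y = refl
      pt nothing  x     y = refl

    -- A failed vertex misses the new threshold although it met the old one.
    failed-gap : ∀ v → lookup failed v ≡ true → Γ (σ m) * relLoad m v + k⁺ m * excess m ≤ Γ (σ m) * (b m * monoLoad m v)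
    failed-gap v f with ∧-true {active m v} (trans (sym (lookup∘tabulate fails v)) f)
    ... | act , nl with isJust-true act
    ... | B , eqB = +-cancelʳ-≤ (k⁺ m * suc j * excess m) _ _ (begin
      G * relLoad m v + k⁺ m * excess m + k⁺ m * suc j * excess m  ≡⟨ l₁ G (relLoad m v) (k⁺ m) (excess m) j ⟩
      relLoad m v * G + k⁺ m * suc (suc j) * excess m              ≤⟨ balanced inv v eqB ⟩
      k⁺ m * G                                                     ≡⟨ cong (_* G) (K-suc (σ m) j) ⟩
      k m * b m * G                                                ≡⟨ l₂ (k m) (b m) G ⟩
      b m * (k m * G)                                              ≤⟨ *-monoʳ-≤ (b m) (<⇒≤ (≤ᵇ-false (not-true nl))) ⟩
      b m * (monoLoad m v * G + k m * suc j * excess m)            ≡⟨ l₃ (b m) (monoLoad m v) G (k m) j (excess m) ⟩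
      G * (b m * monoLoad m v) + k m * b m * suc j * excess m      ≡⟨ cong (λ z → G * (b m * monoLoad m v) + z * suc j * excess m) (sym (K-suc (σ m) j)) ⟩
      G * (b m * monoLoad m v) + k⁺ m * suc j * excess m           ∎)
      where
      open ≤-Reasoning
      G = Γ (σ m)
      not-true : ∀ {x} → not x ≡ true → x ≡ false
      not-true {false} _ = refl
      l₁ : ∀ G r k e j → G * r + k * e + k * suc j * e ≡ r * G + k * suc (suc j) * e
      l₁ = solve-∀
      l₂ : ∀ a b c → a * b * c ≡ b * (a * c)
      l₂ = solve-∀
      l₃ : ∀ b x G k j e → b * (x * G + k * suc j * e) ≡ G * (b * x) + k * b * suc j * e
      l₃ = solve-∀

  -- Every edge relevant at the next level was counted by the filter pass, so the new loads are at
  -- most the tested ones; vertices dropping out can only lower them.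
  filter-deeper : ∀ r j c bl ca → Invariant (mem Δ r (suc j) filter c bl ca) → Candidate (mem Δ r (suc j) filter c bl ca) →
                  let m = mem Δ r (suc j) filter c bl ca in Invariant (mem Δ r j choose c (survivors m (run m s)) (replicate n 0))
  filter-deeper r j c bl ca inv cok = record
    { maxdeg≡ = refl ; proper = proper inv ; bounded = bounded inv
    ; disjoint = λ v e → let (B , eqB , _) = kept-just l v (trans (sym (survivor v)) e) in disjoint inv v eqB
    ; inside = λ v e → child-inside l v (trans (sym (survivor v)) e)
    ; balanced = λ v e → let (B , eqB , lt , _) = kept-just l v (trans (sym (survivor v)) e) in
        ≤-trans (+-monoˡ-≤ _ (*-monoˡ-≤ (Γ (σ m)) (load≤ v))) (≤ᵇ-true lt)
    }
    where
    open Filter r (suc j) c bl ca inv cok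
    open Step m inv cok
    m′ = mem Δ r j choose c (survivors m w) (replicate n 0)
    pos′ : ∀ v → pos m′ v ≡ childPos l v
    pos′ v = cong (λ z → position z (lookup c v) (k m)) (survivor v)
    le : ∀ e → ⟦ rel m′ e ⟧ ≤ ⟦ rel m e ∧ mono ca e ⟧
    le e with rel m′ e in eq
    ... | false = z≤n
    ... | true with ∧-true {agree (pos m′ (proj₁ e)) (pos m′ (proj₂ e))} eq
    ... | ag , ac with agree-true {pos m′ (proj₁ e)} ag
    ... | x , p₁ , p₂ = ≤-reflexive (sym (cong ⟦_⟧ (edge-counted l e (trans (sym (pos′ (proj₁ e))) p₁) (trans (sym (pos′ (proj₂ e))) p₂)
                          (trans (sym (cong₂ (λ y z → isJust y ∨ isJust z) (survivor (proj₁ e)) (survivor (proj₂ e)))) ac))))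
    load≤ : ∀ v → relLoad m′ v ≤ monoLoad m v
    load≤ v = ∑-mono s (λ e → *-monoʳ-≤ (inc v e) (le e))

  pass-deeper : ∀ r j c bl ca → let m = mem Δ r (suc j) filter c bl ca in pass s m ≡ mem Δ r j choose c (survivors m (run m s)) (replicate n 0)
  pass-deeper r j c bl ca = refl

  module FilterLast (r : ℕ) (c bl : Vec (Maybe ℕ) n) (ca : Vec ℕ n)
                (inv : Invariant (mem Δ r 0 filter c bl ca)) (cok : Candidate (mem Δ r 0 filter c bl ca)) where

    open Filter r 0 c bl ca inv cok
    open Step m inv cok

    c′ : Vec (Maybe ℕ) n
    c′ = Vec.zipWith recolour (survivors m w) c

    c′-lookup : ∀ v → lookup c′ v ≡ recolour (kept l v) (lookup c v)
    c′-lookup v = trans (lookup-zipWith recolour v (survivors m w) c) (cong (λ z → recolour z (lookup c v)) (survivor v))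

    -- For single colours the test reads `load * Γ + excess ≤ Γ`, and a positive excess leaves only
    -- load 0.
    light-zero : ∀ v → l v ≡ true → monoLoad m v ≡ 0
    light-zero v e = n<1⇒n≡0 (*-cancelʳ-< (Γ (σ m)) (monoLoad m v) 1 (<-≤-trans (m<m+n _ (≤-trans (0<excess inv) (≤-reflexive (sym (+-identityʳ _))))) (≤ᵇ-true e)))

    pos-c′ : ∀ v {x} → lookup c′ v ≡ just x → childPos l v ≡ just x
    pos-c′ v {x} e with kept l v | trans (sym (c′-lookup v)) e
    ... | just y  | e′ = e′
    ... | nothing | e′ = trans (cong (λ z → position nothing z 1) e′) (cong just (n/1≡n x))

    inc-pos : ∀ (e : Edge n) v → (v ≡ proj₁ e ⊎ v ≡ proj₂ e) → 0 < inc v e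
    inc-pos e v (inj₁ refl) = subst (λ z → 0 < ⟦ z ⟧ + ⟦ v == proj₂ e ⟧) (sym (==-refl v)) (s≤s z≤n)
    inc-pos e v (inj₂ refl) = subst (λ z → 0 < ⟦ v == proj₁ e ⟧ + ⟦ z ⟧) (sym (==-refl v)) (m≤n+m 1 _)

    -- The clashing edge would be counted in the load of its kept end `v`, which is 0.
    no-clash : ∀ e → e ∈ s → ∀ {x} → lookup c′ (proj₁ e) ≡ just x → lookup c′ (proj₂ e) ≡ just x →
               (isJust (kept l (proj₁ e)) ∨ isJust (kept l (proj₂ e))) ≡ true →
               ∀ v {y} → (v ≡ proj₁ e ⊎ v ≡ proj₂ e) → kept l v ≡ just y → ⊥
    no-clash e e∈ e₁ e₂ act v end kv with kept-just l v kv
    ... | B , _ , lt , _ = <⇒≢ (≤-trans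
      (*-mono-≤ (inc-pos e v end) (≤-reflexive (sym (cong ⟦_⟧ (edge-counted l e (pos-c′ (proj₁ e) e₁) (pos-c′ (proj₂ e) e₂) act)))))
      (∑-∈ s (λ e → inc v e * ⟦ rel m e ∧ mono ca e ⟧) e∈)) (sym (light-zero v lt))

    proper′ : ∀ e → e ∈ s → ∀ {x} → lookup c′ (proj₁ e) ≡ just x → lookup c′ (proj₂ e) ≡ just x → ⊥
    proper′ e e∈ {x} e₁ e₂ = cases (kept l (proj₁ e)) (kept l (proj₂ e)) refl refl
      where
      back : ∀ v → kept l v ≡ nothing → lookup c′ v ≡ just x → lookup c v ≡ just x
      back v kn e = trans (sym (cong (λ z → recolour z (lookup c v)) kn)) (trans (sym (c′-lookup v)) e)
      cases : ∀ p q → kept l (proj₁ e) ≡ p → kept l (proj₂ e) ≡ q → ⊥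
      cases nothing  nothing  k₁ k₂ = proper inv e e∈ (back (proj₁ e) k₁ e₁) (back (proj₂ e) k₂ e₂)
      cases (just y) _        k₁ k₂ = no-clash e e∈ e₁ e₂ (cong (λ z → isJust z ∨ isJust (kept l (proj₂ e))) k₁) (proj₁ e) (inj₁ refl) k₁
      cases nothing  (just y) k₁ k₂ = no-clash e e∈ e₁ e₂ (cong₂ (λ y z → isJust y ∨ isJust z) k₁ k₂) (proj₂ e) (inj₂ refl) k₂

    bounded′ : ∀ v {y} → lookup c′ v ≡ just y → y < C
    bounded′ v {y} e with kept l v in kv
    ... | nothing = bounded inv v (trans (sym (cong (λ z → recolour z (lookup c v)) kv)) (trans (sym (c′-lookup v)) e))
    ... | just x  = ≤-trans (subst (_≤ size (σ m)) (*-identityʳ (suc y))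
                      (child-inside l v (trans kv (trans (sym (cong (λ z → recolour z (lookup c v)) kv)) (trans (sym (c′-lookup v)) e))))) (size≤C (ok inv))

    invariant′ : Invariant (startRound Δ (suc r) c′)
    invariant′ = startRound-invariant (suc r) c′ proper′ bounded′

    pass-last : pass s m ≡ startRound Δ (suc r) c′
    pass-last = refl

    uncoloured′ : uncoloured c′ + blocks (survivors m w) ≡ uncoloured c
    uncoloured′ = trans (sym (∑-+ (allFin n) _ _)) (∑-cong (allFin n) pt)
      where
      pt : ∀ v → ⟦ not (isJust (lookup c′ v)) ⟧ + ⟦ isJust (lookup (survivors m w) v) ⟧ ≡ ⟦ not (isJust (lookup c v)) ⟧
      pt v rewrite c′-lookup v | survivor v with kept l v in kv
      ... | nothing = +-identityʳ _
      ... | just x  = sym (cong (λ z → ⟦ not (isJust z) ⟧) (disjoint inv v (proj₁ (proj₂ (kept-just l v kv)))))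

length-allVecs-tabulate : ∀ {A : Set} {n} (f : Fin n → List A) (act : Fin n → Bool) x → (∀ v → length (f v) ≤ (if act v then x else 1)) →
                          length (allVecs (tabulate f)) ≤ x ^ ∑ (allFin n) (λ v → ⟦ act v ⟧)
length-allVecs-tabulate {n = zero}  f act x h = ≤-refl
length-allVecs-tabulate {n = suc n} f act x h = begin
  length (allVecs (tabulate f))                                    ≡⟨ length-allVecs-∷ (f zero) (tabulate (λ v → f (suc v))) ⟩
  length (f zero) * length (allVecs (tabulate (λ v → f (suc v))))  ≤⟨ *-mono-≤ (≤-trans (h zero) (≤-reflexive (pow (act zero)))) (length-allVecs-tabulate (λ v → f (suc v)) (λ v → act (suc v)) x (λ v → h (suc v))) ⟩
  x ^ ⟦ act zero ⟧ * x ^ ∑ (allFin n) (λ v → ⟦ act (suc v) ⟧)      ≡⟨ sym (^-distribˡ-+-* x ⟦ act zero ⟧ _) ⟩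
  x ^ (⟦ act zero ⟧ + ∑ (allFin n) (λ v → ⟦ act (suc v) ⟧))        ≡⟨ cong (x ^_) (sym (∑-allFin-suc n (λ v → ⟦ act v ⟧))) ⟩
  x ^ ∑ (allFin (suc n)) (λ v → ⟦ act v ⟧)                         ∎
  where
  open ≤-Reasoning
  pow : ∀ a → (if a then x else 1) ≡ x ^ ⟦ a ⟧
  pow true  = sym (*-identityʳ x)
  pow false = refl

vcnt-∑ : ∀ {A : Set} {m} (T : A → Bool) (xs : Vec A m) → vcnt T xs ≡ ∑ (allFin m) (λ i → ⟦ T (lookup xs i) ⟧)
vcnt-∑ T []                   = refl
vcnt-∑ {m = suc m} T (x ∷ xs) = trans (cong (⟦ T x ⟧ +_) (vcnt-∑ T xs)) (sym (∑-allFin-suc m (λ i → ⟦ T (lookup (x ∷ xs) i) ⟧)))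

option-digit : ∀ {B y d k x} → x ∈ options (just B) y d k → Σ ℕ λ c → c < d × x ≡ B * d + c
option-digit {B} {d = d} x∈ with ∈-map⁻ (B * d +_) x∈
... | c , c∈ , eq = c , ∈-upTo⁻ c∈ , eq

option-fixed : ∀ {y d k x} → x ∈ options nothing (just y) d k → x ≡ y ÷ k
option-fixed (here eq) = eq

option-idle : ∀ {d k x} → x ∈ options nothing nothing d k → x ≡ 0
option-idle (here eq) = eq

-- Failures caused by one choice of sub-blocks

module Choosing (n L N mb : ℕ) (spec : ℕ → ℕ → Spec) (s : List (Edge n)) (loopless : ∀ e → e ∈ s → proj₁ e ≢ proj₂ e)
                (Δ C : ℕ) (inc≤Δ : ∀ v → ∑ s (inc v) ≤ Δ) (admissible : ∀ r → Admissible Δ C (spec Δ r)) where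

  open Analysis n L N mb spec s loopless Δ C inc≤Δ admissible public

  module Choose (r j : ℕ) (c bl : Vec (Maybe ℕ) n) (ca : Vec ℕ n) (inv : Invariant (mem Δ r j choose c bl ca)) where

    m : Memory n
    m = mem Δ r j choose c bl ca

    w = run m s
    g = best m w

    m₁ : Memory n
    m₁ = mem Δ r j filter c bl g

    pass-choose : pass s m ≡ m₁
    pass-choose = refl

    inv₁ : Invariant m₁
    inv₁ = record { maxdeg≡ = refl ; proper = proper inv ; bounded = bounded inv ; disjoint = disjoint inv ; inside = inside inv ; balanced = balanced inv }

    relLoad≤k⁺ : ∀ v {B} → lookup bl v ≡ just B → relLoad m v ≤ k⁺ m
    relLoad≤k⁺ v e = *-cancelʳ-≤ _ _ (Γ (σ m)) {{>-nonZero (0<Γ inv)}} (≤-trans (m≤m+n _ _) (balanced inv v e))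

    active-sum : ∀ (f : Fin n → ℕ) X → (∀ v {B} → lookup bl v ≡ just B → f v ≤ X) → ∑ (allFin n) (λ v → ⟦ active m v ⟧ * f v) ≤ blocks bl * X
    active-sum f X h = ≤-trans (∑-mono (allFin n) pt) (≤-reflexive (trans (∑-*ˡ (allFin n) X _) (*-comm X _)))
      where
      pt : ∀ v → ⟦ active m v ⟧ * f v ≤ X * ⟦ isJust (lookup bl v) ⟧
      pt v with lookup bl v in e
      ... | just B  = ≤-trans (≤-reflexive (+-identityʳ (f v))) (≤-trans (h v e) (≤-reflexive (sym (*-identityʳ X))))
      ... | nothing = z≤n

    -- Every relevant edge is charged to an active end.
    relevant≤ : ∀ X → (∀ v {B} → lookup bl v ≡ just B → relLoad m v ≤ X) → cnt (rel m) s ≤ blocks bl * X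
    relevant≤ X h = begin
      cnt (rel m) s                                            ≤⟨ ∑-mono s pt ⟩
      ∑ s (λ e → endpoints m e * ⟦ rel m e ⟧)                  ≡⟨ sym (handshake (λ v → ⟦ active m v ⟧) s (λ e → ⟦ rel m e ⟧)) ⟩
      ∑ (allFin n) (λ v → ⟦ active m v ⟧ * relLoad m v)        ≤⟨ active-sum (relLoad m) X h ⟩
      blocks bl * X                                            ∎
      where
      open ≤-Reasoning
      pt : ∀ e → ⟦ rel m e ⟧ ≤ endpoints m e * ⟦ rel m e ⟧
      pt e with agree (pos m (proj₁ e)) (pos m (proj₂ e)) | active m (proj₁ e) | active m (proj₂ e)
      ... | true  | true  | true  = s≤s z≤n
      ... | true  | true  | false = s≤s z≤n
      ... | true  | false | true  = s≤s z≤n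
      ... | true  | false | false = z≤n
      ... | false | _     | _     = z≤n

    module Sketched (unsampled : sampled (σ m) ≡ false) where

      best≡ : g ≡ flattest m w
      best≡ = best-sketched m w unsampled

      default∈ : placement m (replicate n 0) ∈ allVecs (opts m)
      default∈ = ∈-allVecs⁺ (opts m) _ (λ v → subst₂ _∈_ (sym (lookup∘tabulate (placeAt m (replicate n 0)) v))
                   (sym (lookup∘tabulate (optionsAt m) v)) (pt (lookup bl v) (lookup c v) _ (lookup-replicate v 0)))
        where
        pt : ∀ B y x → x ≡ 0 → place B y (b m) (k m) x ∈ options B y (b m) (k m)
        pt (just B) y        .0 refl = ∈-map⁺ (B * b m +_) (∈-upTo⁺ (0<β (ok inv) j))
        pt nothing  (just y) _ _     = here refl
        pt nothing  nothing  _ _     = here refl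

      energy : Vec ℕ n → ℕ
      energy h = cnt (mono h) (flat m w)

      g∈ : g ∈ allVecs (opts m)
      g∈ = subst (_∈ allVecs (opts m)) (sym best≡) (argmin-all energy default∈ (LAll.tabulate (λ p → p)))

      minimal : ∀ h → h ∈ allVecs (opts m) → cnt (mono g) (flat m w) ≤ cnt (mono h) (flat m w)
      minimal h h∈ = ≤-trans (≤-reflexive (cong energy best≡)) (LAll.lookup (f[argmin]≤f[xs] {f = energy} (placement m (replicate n 0)) (allVecs (opts m))) h∈)

      g-option : ∀ v → lookup g v ∈ options (lookup bl v) (lookup c v) (b m) (k m)
      g-option v = subst (lookup g v ∈_) (lookup∘tabulate (optionsAt m) v) (∈-allVecs⁻ (opts m) g∈ v)

      candidate : Candidate m₁
      candidate = record { digit = dg ; fixed = fx ; idle = id }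
        where
        dg : ∀ v {B} → lookup bl v ≡ just B → Σ ℕ λ x → x < b m × lookup g v ≡ B * b m + x
        dg v {B} e = option-digit {B} {lookup c v} {b m} {k m} (subst (λ z → lookup g v ∈ options z (lookup c v) (b m) (k m)) e (g-option v))
        fx : ∀ v {y} → lookup bl v ≡ nothing → lookup c v ≡ just y → lookup g v ≡ y ÷ k m
        fx v e₁ e₂ = option-fixed {_} {b m} {k m} (subst₂ (λ z y → lookup g v ∈ options z y (b m) (k m)) e₁ e₂ (g-option v))
        id : ∀ v → lookup bl v ≡ nothing → lookup c v ≡ nothing → lookup g v ≡ 0
        id v e₁ e₂ = option-idle {b m} {k m} (subst₂ (λ z y → lookup g v ∈ options z y (b m) (k m)) e₁ e₂ (g-option v))

      module F = Filter r j c bl g inv₁ candidate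

      failures : ℕ
      failures = ∑ (allFin n) (λ v → ⟦ lookup F.failed v ⟧)

      failed∈ : F.failed ∈ allVecs (subsets m)
      failed∈ = ∈-allVecs⁺ (subsets m) F.failed (λ v → subst₂ _∈_ (sym (lookup∘tabulate F.fails v))
        (sym (lookup∘tabulate (subsetsAt m) v)) (pt (active m v) (F.l v)))
        where
        pt : ∀ a x → (a ∧ not x) ∈ (if a then true ∷ false ∷ [] else false ∷ [])
        pt true  true  = there (here refl)
        pt true  false = here refl
        pt false x     = here refl

      monoTest∈ : ∀ side → monoTest F.failed side g ∈ tests m
      monoTest∈ true  = ∈-++⁺ˡ (∈-++⁺ˡ (∈-cartesianProductWith⁺ (λ Y g → monoTest Y true g) failed∈ g∈))
      monoTest∈ false = ∈-++⁺ˡ (∈-++⁺ʳ (monoTests m true) (∈-cartesianProductWith⁺ (λ Y g → monoTest Y false g) failed∈ g∈))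

      sideTest∈ : ∀ side → sideTest F.failed side ∈ tests m
      sideTest∈ true  = ∈-++⁺ʳ (monoTests m true ++ monoTests m false) (∈-++⁺ˡ (∈-map⁺ (λ Y → sideTest Y true) failed∈))
      sideTest∈ false = ∈-++⁺ʳ (monoTests m true ++ monoTests m false) (∈-++⁺ʳ (sideTests m true) (∈-map⁺ (λ Y → sideTest Y false) failed∈))

      open Sketch (halve m) N using (sketchFrom; sketchFrom-all; sketchFrom-error; sketchFrom-exact; flat-empty; credit-empty; credit)

      G≡ : flat m w ≡ Sketch.flat (halve m) N (sketchFrom (rel m) (replicate L []) s)
      G≡ = cong (Sketch.flat (halve m) N) (run-sketch m s)

      flat-loopless : ∀ e → e ∈ flat m w → proj₁ e ≢ proj₂ e
      flat-loopless e e∈ = sketchFrom-all (Halving.halve⊆ (tests m) (precision (σ m))) (λ e → proj₁ e ≢ proj₂ e) (rel m) s (replicate L [])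
        (loopless _) (λ {x} x∈ → ⊥-elim (empty (subst (x ∈_) (flat-empty L) x∈))) (subst (e ∈_) G≡ e∈)
        where empty : ∀ {x : Edge n} → x ∈ [] → ⊥
              empty ()

      failures-bound : ∀ d ε → (∀ T → T ∈ tests m → d * when (rel m) T s ≤ d * cnt T (flat m w) + ε × d * cnt T (flat m w) ≤ d * when (rel m) T s + ε) →
                       d * (failures * (k⁺ m * excess m)) ≤ Γ (σ m) * (2 * suc (b m) * ε)
      failures-bound d ε err = Transfer.few-failures s (flat m w) (rel m) d ε (b m) g F.failed
        (λ side → proj₁ (err _ (monoTest∈ side))) (λ side → proj₂ (err _ (sideTest∈ side))) minimum (Γ (σ m)) (k⁺ m * excess m) F.failed-gap
        where
        minimum : ∀ u → lookup F.failed u ≡ true → b m * ∑ (flat m w) (λ e → inc u e * ⟦ mono g e ⟧) ≤ ∑ (flat m w) (inc u)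
        minimum u f = LocalMin.local-min (opts m) (flat m w) flat-loopless g g∈ minimal u (B * b m) (b m)
          (λ x x<b → subst (B * b m + x ∈_) (sym (trans (lookup∘tabulate (optionsAt m) u) (cong (λ z → options z (lookup c u) (b m) (k m)) eqB)))
                       (∈-map⁺ (B * b m +_) (∈-upTo⁺ x<b)))
          where
          act = isJust-true (proj₁ (∧-true {active m u} (trans (sym (lookup∘tabulate F.fails u)) f)))
          B = proj₁ act
          eqB = proj₂ act

      length-opts : length (allVecs (opts m)) ≤ b m ^ blocks bl
      length-opts = length-allVecs-tabulate _ (active m) (b m) (λ v → pt (lookup bl v) (lookup c v))
        where
        pt : ∀ B y → length (options B y (b m) (k m)) ≤ (if isJust B then b m else 1)
        pt (just B) y = ≤-reflexive (trans (length-map (B * b m +_) (upTo (b m))) (length-upTo (b m)))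
        pt nothing  y = ≤-refl

      length-subsets : length (allVecs (subsets m)) ≤ 2 ^ blocks bl
      length-subsets = length-allVecs-tabulate _ (active m) 2 (λ v → pt (active m v))
        where
        pt : ∀ a → length (if a then true ∷ false ∷ [] else false ∷ []) ≤ (if a then 2 else 1)
        pt true  = ≤-refl
        pt false = ≤-refl

      -- Four families of at most `2^|U| b^|U|` tests each, doubled for the two signs of the
      -- potential, give `8 (2 b)^|U|`, where `U` is the set of active vertices.
      length-tests : ∀ κ → 2 * b m ≤ 2 ^ κ → 2 * length (tests m) ≤ 2 ^ (3 + κ * blocks bl)
      length-tests κ 2b≤ = begin
        2 * length (tests m)                                   ≡⟨ cong (2 *_) len ⟩
        2 * (y * o + y * o + (y + y))                          ≤⟨ *-monoʳ-≤ 2 (+-monoʳ-≤ (y * o + y * o) (+-mono-≤ y≤ y≤)) ⟩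
        2 * (y * o + y * o + (y * o + y * o))                  ≡⟨ l₁ (y * o) ⟩
        8 * (y * o)                                            ≤⟨ *-monoʳ-≤ 8 (*-mono-≤ length-subsets length-opts) ⟩
        8 * (2 ^ blocks bl * b m ^ blocks bl)                  ≡⟨ cong (8 *_) (sym (*-^ 2 (b m) (blocks bl))) ⟩
        8 * (2 * b m) ^ blocks bl                              ≤⟨ *-monoʳ-≤ 8 (^-monoˡ-≤ (blocks bl) 2b≤) ⟩
        8 * (2 ^ κ) ^ blocks bl                                ≡⟨ cong (8 *_) (^-*-assoc 2 κ (blocks bl)) ⟩
        2 ^ 3 * 2 ^ (κ * blocks bl)                            ≡⟨ sym (^-distribˡ-+-* 2 3 (κ * blocks bl)) ⟩
        2 ^ (3 + κ * blocks bl)                                ∎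
        where
        open ≤-Reasoning
        y = length (allVecs (subsets m))
        o = length (allVecs (opts m))
        l₁ : ∀ x → 2 * (x + x + (x + x)) ≡ 8 * x
        l₁ = solve-∀
        0<o : 0 < o
        0<o = nonempty default∈
          where nonempty : ∀ {A : Set} {x : A} {xs} → x ∈ xs → 0 < length xs
                nonempty (here _)  = s≤s z≤n
                nonempty (there _) = s≤s z≤n
        y≤ : y ≤ y * o
        y≤ = ≤-trans (≤-reflexive (sym (*-identityʳ y))) (*-monoʳ-≤ y 0<o)
        len : length (tests m) ≡ y * o + y * o + (y + y)
        len = trans (length-++ (monoTests m true ++ monoTests m false)) (cong₂ _+_
          (trans (length-++ (monoTests m true)) (cong₂ _+_ (length-product _ (allVecs (subsets m)) (allVecs (opts m))) (length-product _ (allVecs (subsets m)) (allVecs (opts m)))))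
          (trans (length-++ (sideTests m true)) (cong₂ _+_ (length-map _ (allVecs (subsets m))) (length-map _ (allVecs (subsets m))))))

      -- d = precision + 1 and λ = 3 + κ·(number of blocks) are the parameters of the halving step.
      sketch-error : ∀ h κ → let d = suc (precision (σ m)) in d * d ≡ 2 * h → 0 < precision (σ m) → 2 * b m ≤ 2 ^ κ →
        d * d * (3 + κ * blocks bl) ≤ N → cnt (rel m) s < 2 ^ L →
        ∀ T → T ∈ tests m → d * when (rel m) T s ≤ d * cnt T (flat m w) + 5 * (L * cnt (rel m) s) ×
                            d * cnt T (flat m w) ≤ d * when (rel m) T s + 5 * (L * cnt (rel m) s)
      sketch-error h κ dd 0<p 2b≤ N≥ lt T T∈ =
        subst (λ z → d * W ≤ d * cnt T z + E × d * cnt T z ≤ d * W + E) (sym G≡)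
          ( ≤-trans (m≤m+n _ _) (subst₂ (λ y z → d * y + 5 * credit bs ≤ d * V + 5 * z) W₀ E₀ (proj₂ raw))
          , ≤-trans (m≤m+n _ _) (subst₂ (λ y z → d * V + 5 * credit bs ≤ d * y + 5 * z) W₀ E₀ (proj₁ raw)))
        where
        d = suc (precision (σ m))
        W = when (rel m) T s
        M = cnt (rel m) s
        E = 5 * (L * M)
        bs = sketchFrom (rel m) (replicate L []) s
        V = cnt T (Sketch.flat (halve m) N bs)
        W₀ : W + cnt T (Sketch.flat (halve m) N (replicate L [])) ≡ W
        W₀ = trans (cong (λ xs → W + cnt T xs) (flat-empty L)) (+-identityʳ W)
        E₀ : L * M + credit (replicate L []) ≡ L * M
        E₀ = trans (cong (L * M +_) (credit-empty L)) (+-identityʳ (L * M))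
        he : ∀ xs → N ≤ length xs → d * (2 * cnt T (halve m xs)) ≤ d * cnt T xs + 5 * length xs × d * cnt T xs ≤ d * (2 * cnt T (halve m xs)) + 5 * length xs
        he xs N≤ = Halving.halve-error (tests m) (precision (σ m)) h (3 + κ * blocks bl) dd 0<p (s≤s z≤n) (length-tests κ 2b≤) T T∈ xs (≤-trans N≥ N≤)
        raw = sketchFrom-error (Halving.2*length-halve (tests m) (precision (σ m))) d (rel m) T he s (replicate L [])
                (subst (_< 2 ^ L) (sym (trans (cong (λ z → M + length z) (flat-empty L)) (+-identityʳ M))) lt)

      sketch-exact : ∀ L′ → L ≡ suc L′ → cnt (rel m) s < N → ∀ T → cnt T (flat m w) ≡ when (rel m) T s
      sketch-exact L′ refl lt T = trans (cong (cnt T) G≡) (trans (sketchFrom-exact (rel m) T s [] (replicate L′ []) (subst (_< N) (sym (+-identityʳ _)) lt))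
        (trans (cong (λ z → when (rel m) T s + cnt T z) (flat-empty (suc L′))) (+-identityʳ _)))

      -- Both the gap of a failing vertex and the bound on the relevant edges are proportional to
      -- the block size `k⁺ m`, which therefore cancels.
      few-failures : ∀ h κ → let d = suc (precision (σ m)) in d * d ≡ 2 * h → 0 < precision (σ m) → 2 * b m ≤ 2 ^ κ →
        d * d * (3 + κ * blocks bl) ≤ N → cnt (rel m) s < 2 ^ L →
        d * (failures * excess m) ≤ Γ (σ m) * (10 * suc (b m) * (L * blocks bl))
      few-failures h κ dd 0<p 2b≤ N≥ lt = *-cancelʳ-≤ _ _ (k⁺ m) {{>-nonZero (0<K (ok inv) (suc j))}} (begin
        d * (failures * excess m) * k⁺ m              ≡⟨ l₁ d failures (excess m) (k⁺ m) ⟩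
        d * (failures * (k⁺ m * excess m))            ≤⟨ failures-bound d _ (sketch-error h κ dd 0<p 2b≤ N≥ lt) ⟩
        Γ (σ m) * (2 * suc (b m) * (5 * (L * cnt (rel m) s)))   ≤⟨ *-monoʳ-≤ (Γ (σ m)) (*-monoʳ-≤ (2 * suc (b m)) (*-monoʳ-≤ 5 (*-monoʳ-≤ L (relevant≤ (k⁺ m) relLoad≤k⁺)))) ⟩
        Γ (σ m) * (2 * suc (b m) * (5 * (L * (blocks bl * k⁺ m)))) ≡⟨ l₂ (Γ (σ m)) (suc (b m)) L (blocks bl) (k⁺ m) ⟩
        Γ (σ m) * (10 * suc (b m) * (L * blocks bl)) * k⁺ m     ∎)
        where
        open ≤-Reasoning
        d = suc (precision (σ m))
        l₁ : ∀ d f e k → d * (f * e) * k ≡ d * (f * (k * e))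
        l₁ = solve-∀
        l₂ : ∀ G x L B k → G * (2 * x * (5 * (L * (B * k)))) ≡ G * (10 * x * (L * B)) * k
        l₂ = solve-∀

      -- All relevant edges fit into the first buffer, so the sketch error is 0, while every failure
      -- would contribute a positive gap.
      no-failures : ∀ L′ → L ≡ suc L′ → blocks bl * Δ < N → failures ≡ 0
      no-failures L′ eL lt = n≤0⇒n≡0 (*-cancelʳ-≤ failures 0 (k⁺ m * excess m) {{>-nonZero (*-mono-≤ (0<K (ok inv) (suc j)) (0<excess inv))}} (begin
        failures * (k⁺ m * excess m)              ≡⟨ sym (*-identityˡ _) ⟩
        1 * (failures * (k⁺ m * excess m))        ≤⟨ failures-bound 1 0 (λ T _ → ≤-reflexive (trans (cong (1 *_) (sym (ex T))) (sym (+-identityʳ _))) , ≤-reflexive (trans (cong (1 *_) (ex T)) (sym (+-identityʳ _)))) ⟩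
        Γ (σ m) * (2 * suc (b m) * 0)             ≡⟨ trans (cong (Γ (σ m) *_) (*-zeroʳ (2 * suc (b m)))) (*-zeroʳ (Γ (σ m))) ⟩
        0                                         ∎))
        where
        open ≤-Reasoning
        ex = sketch-exact L′ eL (≤-<-trans (relevant≤ Δ (λ v _ → relLoad≤Δ m v)) lt)

  module Sampled (r : ℕ) (c bl : Vec (Maybe ℕ) n) (ca : Vec ℕ n) (inv : Invariant (mem Δ r 0 choose c bl ca))
                 (isSampled : sampled (spec Δ r) ≡ true) (shallow : depth (spec Δ r) ≡ 0) (full : size (spec Δ r) ≡ C)
                 (λ′ : ℕ) (0<z : 0 < slack (spec Δ r)) (few : n * n + n * C ≤ 2 ^ λ′)
                 (many : 2 * slack (spec Δ r) * (C * suc (2 * slack (spec Δ r) + 2 * (2 * slack (spec Δ r)) * λ′)) ≤ suc mb) where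

    open Choose r 0 c bl ca inv

    private
      z = slack (spec Δ r)

    size≡top : size (σ m) ≡ top (σ m)
    size≡top = trans (cong (λ d → top (σ m) * base (σ m) ^ d) shallow) (*-identityʳ (top (σ m)))

    0<C : 0 < C
    0<C = subst (0 <_) full (≤-<-trans z≤n (Δ<size (ok inv)))

    f : Fin (suc mb) → Vec ℕ n
    f i = sample m i

    f-bound : ∀ i v → lookup (f i) v < b m
    f-bound i v = subst (lookup (f i) v <_) size≡top (family-bound n (size (σ m)) z (suc mb) (subst (0 <_) (sym full) 0<C) i v)

    best≡ : g ≡ placement m (f (cheapest m w))
    best≡ = best-sampled m w isSampled

    g-lookup : ∀ v → lookup g v ≡ place (lookup bl v) (lookup c v) (b m) (k m) (lookup (f (cheapest m w)) v)
    g-lookup v = trans (cong (λ h → lookup h v) best≡) (lookup∘tabulate (placeAt m (f (cheapest m w))) v)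

    candidate : Candidate m₁
    candidate = record
      { digit = λ v e → lookup (f (cheapest m w)) v , f-bound (cheapest m w) v , trans (g-lookup v) (cong (λ B → place B (lookup c v) (b m) (k m) (lookup (f (cheapest m w)) v)) e)
      ; fixed = λ v e₁ e₂ → trans (g-lookup v) (cong₂ (λ B y → place B y (b m) (k m) (lookup (f (cheapest m w)) v)) e₁ e₂)
      ; idle  = λ v e₁ e₂ → trans (g-lookup v) (cong₂ (λ B y → place B y (b m) (k m) (lookup (f (cheapest m w)) v)) e₁ e₂)
      }

    module F = Filter r 0 c bl g inv₁ candidate

    failures : ℕ
    failures = ∑ (allFin n) (λ v → ⟦ lookup F.failed v ⟧)

    total : Fin (suc mb) → ℕ
    total i = ∑ s (charge m i)

    excess≤Γ : excess m ≤ Γ (σ m)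
    excess≤Γ = ≤-trans (m∸n≤m (size (σ m)) Δ) (≤-trans (≤-reflexive (sym (*-identityʳ (size (σ m))))) (*-monoʳ-≤ (size (σ m)) (s≤s (z≤n {suc (depth (σ m))}))))

    light-0 : ∀ x → x ≡ 0 → light m₁ x ≡ true
    light-0 .0 refl = T⇒true (≤⇒≤ᵇ (≤-trans (≤-reflexive (+-identityʳ (excess m))) (≤-trans excess≤Γ (≤-reflexive (sym (+-identityʳ (Γ (σ m))))))))
      where T⇒true : ∀ {x} → T x → x ≡ true
            T⇒true {true} _ = refl

    failed≤ : ∀ v → ⟦ lookup F.failed v ⟧ ≤ ⟦ active m v ⟧ * monoLoad m₁ v
    failed≤ v = subst (λ x → ⟦ x ⟧ ≤ ⟦ active m v ⟧ * monoLoad m₁ v) (sym (lookup∘tabulate F.fails v)) (pt (active m v) (monoLoad m₁ v) refl)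
      where
      pt : ∀ a x → x ≡ monoLoad m₁ v → ⟦ a ∧ not (light m₁ x) ⟧ ≤ ⟦ a ⟧ * x
      pt false x       _ = z≤n
      pt true  zero    _ = ≤-reflexive (cong (λ y → ⟦ not y ⟧) (light-0 0 refl))
      pt true  (suc x) _ = ≤-trans (⟦⟧≤1 (not (light m₁ (suc x)))) (s≤s z≤n)

    -- Load 0 always passes the test, so a failing vertex has load at least 1.
    failures≤ : failures ≤ total (cheapest m w)
    failures≤ = begin
      failures                                                              ≤⟨ ∑-mono (allFin n) failed≤ ⟩
      ∑ (allFin n) (λ v → ⟦ active m v ⟧ * monoLoad m₁ v)                   ≡⟨ handshake (λ v → ⟦ active m v ⟧) s (λ e → ⟦ rel m e ∧ mono g e ⟧) ⟩
      ∑ s (λ e → endpoints m e * ⟦ rel m e ∧ mono g e ⟧)                    ≡⟨ cong (λ h → ∑ s (λ e → endpoints m e * ⟦ rel m e ∧ mono h e ⟧)) best≡ ⟩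
      total (cheapest m w)                                                  ∎
      where open ≤-Reasoning

    cheapest≤ : ∀ i → total (cheapest m w) ≤ total i
    cheapest≤ i = subst₂ _≤_ (run-cost m s (cheapest m w)) (run-cost m s i)
      (LAll.lookup (f[argmin]≤f[xs] {f = lookup (cost w)} zero (allFin (suc mb))) (∈-allFin i))

    rare : ∀ T → T ∈ familyTests n C → z * (C * ∑ (allFin (suc mb)) (λ i → ⟦ T (f i) ⟧)) ≤ suc z * suc mb
    rare T T∈ = subst (λ S → z * (C * ∑ (allFin (suc mb)) (λ i → ⟦ T (lookup (family n S z (suc mb)) i) ⟧)) ≤ suc z * suc mb) (sym full)
      (subst (λ x → z * (C * x) ≤ suc z * suc mb) (vcnt-∑ T (family n C z (suc mb))) (family-rare n C z (suc mb) λ′ 0<C 0<z few many T T∈))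

    -- At depth 0 the only block is the whole palette.
    block-zero : ∀ v {B} → lookup bl v ≡ just B → B ≡ 0
    block-zero v {zero}  e = refl
    block-zero v {suc B} e = ⊥-elim (1+n≰n (*-cancelʳ-≤ 2 1 (size (σ m)) {{>-nonZero (0<K (ok inv) (suc (depth (σ m))))}}
      (≤-trans (*-monoˡ-≤ (size (σ m)) (s≤s (s≤s (z≤n {B})))) (≤-trans (≤-reflexive (cong (suc (suc B) *_) (trans size≡top (sym (*-identityʳ (top (σ m))))))) (≤-trans (inside inv v e) (≤-reflexive (sym (*-identityˡ _))))))))

    collision : Fin (suc mb) → Edge n → Bool
    collision i e = mono (placement m (f i)) e

    placed : ∀ i v → lookup (placement m (f i)) v ≡ place (lookup bl v) (lookup c v) (b m) (k m) (lookup (f i) v)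
    placed i v = lookup∘tabulate (placeAt m (f i)) v

    placed-active : ∀ i v {B} → lookup bl v ≡ just B → lookup (placement m (f i)) v ≡ lookup (f i) v
    placed-active i v e = trans (placed i v) (trans (cong (λ B → place B (lookup c v) (b m) (k m) (lookup (f i) v)) e) (cong (λ B → B * b m + lookup (f i) v) (block-zero v e)))

    placed-fixed : ∀ i v {y} → lookup bl v ≡ nothing → lookup c v ≡ just y → lookup (placement m (f i)) v ≡ y
    placed-fixed i v {y} e₁ e₂ = trans (placed i v) (trans (cong₂ (λ B y → place B y (b m) (k m) (lookup (f i) v)) e₁ e₂) (n/1≡n y))

    collides-≢ : ∀ {u v : Fin n} → u ≢ v → ∀ h → collides u v h ≡ (lookup h u ≡ᵇ lookup h v)
    collides-≢ {u} {v} u≢v h = cong (λ x → not x ∧ (lookup h u ≡ᵇ lookup h v)) (≢⇒== u≢v)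

    -- A relevant edge has an active end. Its other end is also active, which gives a `collides`
    -- test, or it is coloured, which gives a `hits` test for that colour.
    collision-rare : ∀ e → e ∈ s → rel m e ≡ true → z * (C * ∑ (allFin (suc mb)) (λ i → ⟦ collision i e ⟧)) ≤ suc z * suc mb
    collision-rare e@(u , v) e∈ re = cases (lookup bl u) (lookup bl v) (lookup c u) (lookup c v) refl refl refl refl
      where
      ag = agree-true {pos m u} {pos m v} (proj₁ (∧-true {agree (pos m u) (pos m v)} re))
      via : ∀ T → T ∈ familyTests n C → (∀ i → collision i e ≡ T (f i)) → z * (C * ∑ (allFin (suc mb)) (λ i → ⟦ collision i e ⟧)) ≤ suc z * suc mb
      via T T∈ h = ≤-trans (≤-reflexive (cong (λ x → z * (C * x)) (∑-cong (allFin (suc mb)) (λ i → cong ⟦_⟧ (h i))))) (rare T T∈)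
      hits∈ : ∀ v y → y < C → hits v y ∈ familyTests n C
      hits∈ v y y<C = ∈-++⁺ʳ (cartesianProductWith collides (allFin n) (allFin n)) (∈-cartesianProductWith⁺ hits (∈-allFin v) (∈-upTo⁺ y<C))
      impossible : ∀ {x : ℕ} {A : Set} → nothing ≡ just x → A
      impossible ()
      cases : ∀ B B′ y y′ → lookup bl u ≡ B → lookup bl v ≡ B′ → lookup c u ≡ y → lookup c v ≡ y′ → z * (C * ∑ (allFin (suc mb)) (λ i → ⟦ collision i e ⟧)) ≤ suc z * suc mb
      cases (just B) (just B′) _ _ eu ev _ _ = via (collides u v) (∈-++⁺ˡ (∈-cartesianProductWith⁺ collides (∈-allFin u) (∈-allFin v)))
        (λ i → trans (cong₂ _≡ᵇ_ (placed-active i u eu) (placed-active i v ev)) (sym (collides-≢ (loopless e e∈) (f i))))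
      cases (just B) nothing _ (just y) eu ev _ yv = via (hits u y) (hits∈ u y (bounded inv v yv))
        (λ i → cong₂ _≡ᵇ_ (placed-active i u eu) (placed-fixed i v ev yv))
      cases nothing (just B) (just y) _ eu ev yu _ = via (hits v y) (hits∈ v y (bounded inv u yu))
        (λ i → trans (cong₂ _≡ᵇ_ (placed-fixed i u eu yu) (placed-active i v ev)) (≡ᵇ-sym y (lookup (f i) v)))
      cases (just B) nothing _ nothing eu ev _ yv = impossible (trans (sym (cong₂ (λ B y → position B y (k⁺ m)) ev yv)) (proj₂ (proj₂ ag)))
      cases nothing (just B) nothing _ eu ev yu _ = impossible (trans (sym (cong₂ (λ B y → position B y (k⁺ m)) eu yu)) (proj₁ (proj₂ ag)))
      cases nothing nothing _ _ eu ev _ _ = no-active (trans (sym (cong₂ (λ B B′ → isJust B ∨ isJust B′) eu ev)) (proj₂ (∧-true {agree (pos m u) (pos m v)} re)))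
        where no-active : ∀ {A : Set} → false ≡ true → A
              no-active ()

    charge-rare : ∀ e → e ∈ s → z * (C * ∑ (allFin (suc mb)) (λ i → charge m i e)) ≤ suc z * suc mb * (endpoints m e * ⟦ rel m e ⟧)
    charge-rare e e∈ = ≤-trans (≤-reflexive (cong (λ x → z * (C * x)) (∑-*ˡ (allFin (suc mb)) (endpoints m e) _))) (pt (rel m e) refl)
      where
      open ≤-Reasoning
      E = endpoints m e
      l₁ : ∀ z C E x → z * (C * (E * x)) ≡ z * (C * x) * E
      l₁ = solve-∀
      pt : ∀ x → rel m e ≡ x → z * (C * (E * ∑ (allFin (suc mb)) (λ i → ⟦ x ∧ collision i e ⟧))) ≤ suc z * suc mb * (E * ⟦ x ⟧)
      pt true re = begin
        z * (C * (E * ∑ (allFin (suc mb)) (λ i → ⟦ collision i e ⟧)))   ≡⟨ l₁ z C E _ ⟩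
        z * (C * ∑ (allFin (suc mb)) (λ i → ⟦ collision i e ⟧)) * E     ≤⟨ *-monoˡ-≤ E (collision-rare e e∈ re) ⟩
        suc z * suc mb * E                                              ≡⟨ cong (suc z * suc mb *_) (sym (*-identityʳ E)) ⟩
        suc z * suc mb * (E * 1)                                        ∎
      pt false _ = ≤-trans (≤-reflexive (trans (cong (λ x → z * (C * (E * x))) (trans (∑-const (allFin (suc mb)) 0) (*-zeroʳ (length (allFin (suc mb)))))) (l₂ z C E))) z≤n
        where l₂ : ∀ z C E → z * (C * (E * 0)) ≡ 0
              l₂ = solve-∀

    -- The cheapest member costs at most the average over the family, and each relevant edge is in
    -- conflict under at most a `(1 + 1/z)/C` fraction of the members.
    few-failures : z * (C * failures) ≤ suc z * (blocks bl * Δ)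
    few-failures = *-cancelˡ-≤ (suc mb) (begin
      suc mb * (z * (C * failures))                                          ≤⟨ *-monoʳ-≤ (suc mb) (*-monoʳ-≤ z (*-monoʳ-≤ C failures≤)) ⟩
      suc mb * (z * (C * total (cheapest m w)))                              ≡⟨ l₁ (suc mb) z C _ ⟩
      z * (C * (suc mb * total (cheapest m w)))                              ≡⟨ cong (λ x → z * (C * x)) (sym (trans (∑-const (allFin (suc mb)) _) (cong (_* total (cheapest m w)) (length-allFin (suc mb))))) ⟩
      z * (C * ∑ (allFin (suc mb)) (λ _ → total (cheapest m w)))             ≤⟨ *-monoʳ-≤ z (*-monoʳ-≤ C (∑-mono (allFin (suc mb)) cheapest≤)) ⟩
      z * (C * ∑ (allFin (suc mb)) total)                                    ≡⟨ cong (λ x → z * (C * x)) (∑-swap (allFin (suc mb)) s (charge m)) ⟩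
      z * (C * ∑ s (λ e → ∑ (allFin (suc mb)) (λ i → charge m i e)))         ≡⟨ trans (sym (*-assoc z C _)) (trans (sym (∑-*ˡ s (z * C) _)) (∑-cong s (λ e → *-assoc z C _))) ⟩
      ∑ s (λ e → z * (C * ∑ (allFin (suc mb)) (λ i → charge m i e)))         ≤⟨ ∑-mono-∈ s charge-rare ⟩
      ∑ s (λ e → suc z * suc mb * (endpoints m e * ⟦ rel m e ⟧))             ≡⟨ ∑-*ˡ s (suc z * suc mb) _ ⟩
      suc z * suc mb * ∑ s (λ e → endpoints m e * ⟦ rel m e ⟧)               ≡⟨ cong (suc z * suc mb *_) (sym (handshake (λ v → ⟦ active m v ⟧) s (λ e → ⟦ rel m e ⟧))) ⟩
      suc z * suc mb * ∑ (allFin n) (λ v → ⟦ active m v ⟧ * relLoad m v)     ≤⟨ *-monoʳ-≤ (suc z * suc mb) (active-sum (relLoad m) Δ (λ v _ → relLoad≤Δ m v)) ⟩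
      suc z * suc mb * (blocks bl * Δ)                                       ≡⟨ l₂ (suc z) (suc mb) (blocks bl * Δ) ⟩
      suc mb * (suc z * (blocks bl * Δ))                                     ∎)
      where
      open ≤-Reasoning
      l₁ : ∀ m z C x → m * (z * (C * x)) ≡ z * (C * (m * x))
      l₁ = solve-∀
      l₂ : ∀ a b x → a * b * x ≡ b * (a * x)
      l₂ = solve-∀

-- Whole rounds

module Rounds (n L N mb : ℕ) (spec : ℕ → ℕ → Spec) (s : List (Edge n)) (loopless : ∀ e → e ∈ s → proj₁ e ≢ proj₂ e)
              (Δ C : ℕ) (inc≤Δ : ∀ v → ∑ s (inc v) ≤ Δ) (admissible : ∀ r → Admissible Δ C (spec Δ r)) where

  open Choosing n L N mb spec s loopless Δ C inc≤Δ admissible public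

  iter : ℕ → Memory n → Memory n
  iter zero    m = m
  iter (suc p) m = iter p (pass s m)

  iter-+ : ∀ p q m → iter (p + q) m ≡ iter q (iter p m)
  iter-+ zero    q m = refl
  iter-+ (suc p) q m = iter-+ p q (pass s m)

  iter-2 : ∀ m {m₁ m₂} → pass s m ≡ m₁ → pass s m₁ ≡ m₂ → iter 2 m ≡ m₂
  iter-2 m refl refl = refl

  iter-2+ : ∀ p m {m₁ m₂} → pass s m ≡ m₁ → pass s m₁ ≡ m₂ → iter (2 + p) m ≡ iter p m₂
  iter-2+ p m refl refl = refl

  module SketchedRound (r : ℕ) (c : Vec (Maybe ℕ) n) (unsampled : sampled (spec Δ r) ≡ false) (U d Y : ℕ)
    (few : ∀ j bl ca (inv : Invariant (mem Δ r j choose c bl ca)) → blocks bl ≤ U → d * Choose.Sketched.failures r j c bl ca inv unsampled ≤ Y) where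

    -- The bookkeeping is additive: `uncoloured c - blocks bl` vertices have already dropped out,
    -- and each of the `j + 1` remaining levels adds at most `Y / d` more.
    Outcome : ℕ → Vec (Maybe ℕ) n → Vec ℕ n → Set
    Outcome j bl ca = Σ (Vec (Maybe ℕ) n) λ c′ → iter (2 * suc j) (mem Δ r j choose c bl ca) ≡ startRound Δ (suc r) c′ ×
                      Invariant (startRound Δ (suc r) c′) × d * (uncoloured c′ + blocks bl) ≤ d * uncoloured c + suc j * Y

    module Last (bl : Vec (Maybe ℕ) n) (ca : Vec ℕ n) (inv : Invariant (mem Δ r 0 choose c bl ca)) (bl≤U : blocks bl ≤ U) where
      open Choose r 0 c bl ca inv
      open Sketched unsampled
      open FilterLast r c bl g inv₁ candidate using (c′; invariant′; uncoloured′; pass-last)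

      count : uncoloured c′ + blocks bl ≡ uncoloured c + failures
      count = trans (cong (uncoloured c′ +_) (sym F.failed-count)) (trans (sym (+-assoc (uncoloured c′) _ _)) (cong (_+ failures) uncoloured′))

      outcome : Outcome 0 bl ca
      outcome = c′ , iter-2 m pass-choose pass-last , invariant′ , ≤-trans (≤-reflexive (trans (cong (d *_) count) (*-distribˡ-+ d (uncoloured c) failures)))
                  (+-monoʳ-≤ (d * uncoloured c) (≤-trans (few 0 bl ca inv bl≤U) (≤-reflexive (sym (+-identityʳ Y)))))

    module Deeper (j : ℕ) (bl : Vec (Maybe ℕ) n) (ca : Vec ℕ n) (inv : Invariant (mem Δ r (suc j) choose c bl ca)) (bl≤U : blocks bl ≤ U)
                  (next : ∀ bl′ → Invariant (mem Δ r j choose c bl′ (replicate n 0)) → blocks bl′ ≤ U → Outcome j bl′ (replicate n 0)) where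
      open Choose r (suc j) c bl ca inv
      open Sketched unsampled

      bl′ : Vec (Maybe ℕ) n
      bl′ = survivors m₁ (run m₁ s)

      rest : Outcome j bl′ (replicate n 0)
      rest = next bl′ (filter-deeper r j c bl g inv₁ candidate) (≤-trans (≤-trans (m≤m+n _ failures) (≤-reflexive F.failed-count)) bl≤U)

      outcome : Outcome (suc j) bl ca
      outcome = proj₁ rest , trans (cong (λ p → iter p (mem Δ r (suc j) choose c bl ca)) (*-suc 2 (suc j))) (trans (iter-2+ (2 * suc j) m pass-choose (pass-deeper r j c bl g)) (proj₁ (proj₂ rest))) , proj₁ (proj₂ (proj₂ rest)) , (begin
        d * (x + blocks bl)                       ≡⟨ cong (λ y → d * (x + y)) (sym F.failed-count) ⟩
        d * (x + (blocks bl′ + failures))         ≡⟨ l₁ d x (blocks bl′) failures ⟩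
        d * (x + blocks bl′) + d * failures       ≤⟨ +-mono-≤ (proj₂ (proj₂ (proj₂ rest))) (few (suc j) bl ca inv bl≤U) ⟩
        d * uncoloured c + suc j * Y + Y          ≡⟨ l₂ (d * uncoloured c) (suc j * Y) Y ⟩
        d * uncoloured c + (Y + suc j * Y)        ∎)
        where
        open ≤-Reasoning
        x = uncoloured (proj₁ rest)
        l₁ : ∀ d x y z → d * (x + (y + z)) ≡ d * (x + y) + d * z
        l₁ = solve-∀
        l₂ : ∀ x y z → x + y + z ≡ x + (z + y)
        l₂ = solve-∀

    levels : ∀ j bl ca → Invariant (mem Δ r j choose c bl ca) → blocks bl ≤ U → Outcome j bl ca
    levels zero    bl ca inv le = Last.outcome bl ca inv le
    levels (suc j) bl ca inv le = Deeper.outcome j bl ca inv le (λ bl′ inv′ le′ → levels j bl′ (replicate n 0) inv′ le′)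

    wholeRound : Invariant (startRound Δ r c) → uncoloured c ≤ U → Σ (Vec (Maybe ℕ) n) λ c′ →
            iter (2 * suc (depth (spec Δ r))) (startRound Δ r c) ≡ startRound Δ (suc r) c′ ×
            Invariant (startRound Δ (suc r) c′) × d * uncoloured c′ ≤ suc (depth (spec Δ r)) * Y
    wholeRound inv le with levels (depth (spec Δ r)) (Vec.map activate c) (replicate n 0) inv (≤-trans (≤-reflexive (startRound-blocks r c)) le)
    ... | c′ , eq , inv′ , h = c′ , eq , inv′ , +-cancelʳ-≤ (d * uncoloured c) _ _ (≤-trans
          (≤-reflexive (trans (sym (*-distribˡ-+ d (uncoloured c′) (uncoloured c))) (cong (λ y → d * (uncoloured c′ + y)) (sym (startRound-blocks r c)))))
          (≤-trans h (≤-reflexive (+-comm (d * uncoloured c) _))))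

  module SampledRound (r : ℕ) (isSampled : sampled (spec Δ r) ≡ true) (shallow : depth (spec Δ r) ≡ 0) (full : size (spec Δ r) ≡ C)
                 (λ′ : ℕ) (0<z : 0 < slack (spec Δ r)) (few : n * n + n * C ≤ 2 ^ λ′)
                 (many : 2 * slack (spec Δ r) * (C * suc (2 * slack (spec Δ r) + 2 * (2 * slack (spec Δ r)) * λ′)) ≤ suc mb)
                 (c : Vec (Maybe ℕ) n) (inv₀ : Invariant (startRound Δ r c)) where

    private
      z = slack (spec Δ r)
      bl₀ = Vec.map activate c

    start≡ : startRound Δ r c ≡ mem Δ r 0 choose c bl₀ (replicate n 0)
    start≡ = cong (λ j → mem Δ r j choose c bl₀ (replicate n 0)) shallow

    inv : Invariant (mem Δ r 0 choose c bl₀ (replicate n 0))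
    inv = subst Invariant start≡ inv₀

    open Choose r 0 c bl₀ (replicate n 0) inv
    open Sampled r c bl₀ (replicate n 0) inv isSampled shallow full λ′ 0<z few many
    open FilterLast r c bl₀ g inv₁ candidate using (c′; invariant′; uncoloured′; pass-last)

    count : uncoloured c′ ≡ failures
    count = +-cancelʳ-≡ (uncoloured c) _ _ (trans (cong (uncoloured c′ +_) (trans (sym (startRound-blocks r c)) (sym F.failed-count)))
      (trans (sym (+-assoc (uncoloured c′) _ _)) (trans (cong (_+ failures) uncoloured′) (+-comm (uncoloured c) failures))))

    wholeRound : Σ (Vec (Maybe ℕ) n) λ c″ → iter 2 (startRound Δ r c) ≡ startRound Δ (suc r) c″ × Invariant (startRound Δ (suc r) c″) ×
            z * (C * uncoloured c″) ≤ suc z * (uncoloured c * Δ)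
    wholeRound = c′ , trans (cong (iter 2) start≡) (iter-2 m pass-choose pass-last) , invariant′ ,
      subst₂ (λ x y → z * (C * x) ≤ suc z * (y * Δ)) (sym count) (startRound-blocks r c) few-failures

-- Degrees in simple streams

module Simple {n} (s : List (Edge n)) (simple : SimpleStream s) where

  loopless : ∀ e → e ∈ s → proj₁ e ≢ proj₂ e
  loopless e = LAll.lookup (proj₁ simple)

  deg≡ : ∀ v → deg s v ≡ ∑ s (inc v)
  deg≡ v = go s loopless
    where
    go : ∀ xs → (∀ e → e ∈ xs → proj₁ e ≢ proj₂ e) → deg xs v ≡ ∑ xs (inc v)
    go []             h = refl
    go ((x , y) ∷ xs) h with v ≟ x | v ≟ y
    ... | yes refl | yes refl = ⊥-elim (h (x , y) (here refl) refl)
    ... | yes _    | no _     = cong suc (go xs (λ e e∈ → h e (there e∈)))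
    ... | no _     | yes _    = cong suc (go xs (λ e e∈ → h e (there e∈)))
    ... | no _     | no _     = go xs (λ e e∈ → h e (there e∈))

  joins : Fin n → Fin n → Edge n → ℕ
  joins u v e = ⟦ v == proj₁ e ⟧ * ⟦ u == proj₂ e ⟧ + ⟦ v == proj₂ e ⟧ * ⟦ u == proj₁ e ⟧

  inc-joins : ∀ v e → inc v e ≡ ∑ (allFin n) (λ u → joins u v e)
  inc-joins v e = sym (trans (∑-+ (allFin n) _ _) (cong₂ _+_ (∑-pick (λ _ → ⟦ v == proj₁ e ⟧) (proj₂ e)) (∑-pick (λ _ → ⟦ v == proj₂ e ⟧) (proj₁ e))))

  -- Two edges of the stream joining `u` and `v` would be the same edge. Summing over `u` later
  -- bounds every degree by `n`.
  joins≤1 : ∀ u v → ∑ s (joins u v) ≤ 1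
  joins≤1 u v = go s (proj₁ simple) (proj₂ simple)
    where
    joined : ∀ e → joins u v e ≡ 0 ⊎ (SameEdge (v , u) e × (proj₁ e ≢ proj₂ e → joins u v e ≡ 1))
    joined (x , y) with v ≟ x | u ≟ y | v ≟ y | u ≟ x
    ... | yes refl | yes refl | yes refl | _        = inj₂ (inj₁ (refl , refl) , λ h → ⊥-elim (h refl))
    ... | yes refl | yes refl | no _     | yes _    = inj₂ (inj₁ (refl , refl) , λ h → refl)
    ... | yes refl | yes refl | no _     | no _     = inj₂ (inj₁ (refl , refl) , λ h → refl)
    ... | yes refl | no _     | yes refl | yes refl = inj₂ (inj₂ (refl , refl) , λ h → ⊥-elim (h refl))
    ... | no _     | yes _    | yes refl | yes refl = inj₂ (inj₂ (refl , refl) , λ h → refl)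
    ... | no _     | no _     | yes refl | yes refl = inj₂ (inj₂ (refl , refl) , λ h → refl)
    ... | yes _    | no _     | yes _    | no _     = inj₁ refl
    ... | yes _    | no _     | no _     | yes _    = inj₁ refl
    ... | yes _    | no _     | no _     | no _     = inj₁ refl
    ... | no _     | yes _    | yes _    | no _     = inj₁ refl
    ... | no _     | yes _    | no _     | yes _    = inj₁ refl
    ... | no _     | yes _    | no _     | no _     = inj₁ refl
    ... | no _     | no _     | yes _    | no _     = inj₁ refl
    ... | no _     | no _     | no _     | yes _    = inj₁ refl
    ... | no _     | no _     | no _     | no _     = inj₁ refl
    same : ∀ {e e′ : Edge n} → SameEdge (v , u) e → SameEdge (v , u) e′ → SameEdge e e′
    same (inj₁ (refl , refl)) p                    = p
    same (inj₂ (refl , refl)) (inj₁ (refl , refl)) = inj₂ (refl , refl)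
    same (inj₂ (refl , refl)) (inj₂ (refl , refl)) = inj₁ (refl , refl)
    rest : ∀ xs e → SameEdge (v , u) e → LAll.All (λ f → ¬ SameEdge e f) xs → ∑ xs (joins u v) ≡ 0
    rest []       e p LAll.[]         = refl
    rest (x ∷ xs) e p (q LAll.∷ qs) with joined x
    ... | inj₁ z       = cong₂ _+_ z (rest xs e p qs)
    ... | inj₂ (p′ , _) = ⊥-elim (q (same p p′))
    go : ∀ xs → LAll.All (λ e → proj₁ e ≢ proj₂ e) xs → AllPairs (λ e f → ¬ SameEdge e f) xs → ∑ xs (joins u v) ≤ 1
    go []       _              _         = z≤n
    go (x ∷ xs) (l LAll.∷ ls) (q ∷ qs) with joined x
    ... | inj₁ z       = subst (λ y → y + ∑ xs (joins u v) ≤ 1) (sym z) (go xs ls qs)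
    ... | inj₂ (p , o) = ≤-reflexive (cong₂ _+_ (o l) (rest xs x p q))

  inc≤n : ∀ v → ∑ s (inc v) ≤ n
  inc≤n v = begin
    ∑ s (inc v)                                       ≡⟨ ∑-cong s (inc-joins v) ⟩
    ∑ s (λ e → ∑ (allFin n) (λ u → joins u v e))      ≡⟨ ∑-swap s (allFin n) _ ⟩
    ∑ (allFin n) (λ u → ∑ s (joins u v))              ≤⟨ ∑-mono (allFin n) (λ u → joins≤1 u v) ⟩
    ∑ (allFin n) (λ _ → 1)                            ≡⟨ trans (∑-const (allFin n) 1) (trans (*-identityʳ _) (length-allFin n)) ⟩
    n                                                 ∎
    where open ≤-Reasoning

  2*length≤n² : 2 * length s ≤ n * n
  2*length≤n² = begin
    2 * length s                                                ≡⟨ trans (*-comm 2 (length s)) (sym (∑-const s 2)) ⟩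
    ∑ s (λ e → (1 + 1) * 1)                                     ≡⟨ sym (handshake (λ _ → 1) s (λ _ → 1)) ⟩
    ∑ (allFin n) (λ v → 1 * ∑ s (λ e → inc v e * 1))            ≤⟨ ∑-mono (allFin n) (λ v → ≤-trans (≤-reflexive (trans (*-identityˡ _) (∑-cong s (λ e → *-identityʳ (inc v e))))) (inc≤n v)) ⟩
    ∑ (allFin n) (λ _ → n)                                      ≡⟨ trans (∑-const (allFin n) n) (cong (_* n) (length-allFin n)) ⟩
    n * n                                                       ∎
    where open ≤-Reasoning

  length≤n² : length s ≤ n * n
  length≤n² = ≤-trans (m≤n*m (length s) 2) 2*length≤n²

  foldr-⊔-≤ : ∀ (xs : List ℕ) X → (∀ {x} → x ∈ xs → x ≤ X) → foldr _⊔_ 0 xs ≤ X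
  foldr-⊔-≤ []       X h = z≤n
  foldr-⊔-≤ (x ∷ xs) X h = ⊔-lub (h (here refl)) (foldr-⊔-≤ xs X (λ p → h (there p)))

  ≤-foldr-⊔ : ∀ (xs : List ℕ) {x} → x ∈ xs → x ≤ foldr _⊔_ 0 xs
  ≤-foldr-⊔ (x ∷ xs) (here refl) = m≤m⊔n x _
  ≤-foldr-⊔ (y ∷ xs) (there p)   = ≤-trans (≤-foldr-⊔ xs p) (m≤n⊔m y _)

  inc≤maxDeg : ∀ v → ∑ s (inc v) ≤ maxDeg s
  inc≤maxDeg v = subst (_≤ maxDeg s) (deg≡ v) (≤-foldr-⊔ (map (deg s) (allFin n)) (∈-map⁺ (deg s) (∈-allFin v)))

  maxDeg≤n : maxDeg s ≤ n
  maxDeg≤n = foldr-⊔-≤ (map (deg s) (allFin n)) n h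
    where
    h : ∀ {x} → x ∈ map (deg s) (allFin n) → x ≤ n
    h x∈ with ∈-map⁻ (deg s) x∈
    ... | v , _ , refl = subst (_≤ n) (sym (deg≡ v)) (inc≤n v)

foldr-lookup : ∀ {n} (xs : Vec ℕ n) → Vec.foldr _ _⊔_ 0 xs ≡ foldr _⊔_ 0 (map (lookup xs) (allFin n))
foldr-lookup []       = refl
foldr-lookup (x ∷ xs) = cong (x ⊔_) (trans (foldr-lookup xs) (cong (foldr _⊔_ 0) (trans (map-tabulate (λ i → i) (lookup xs)) (sym (map-tabulate suc (lookup (x ∷ xs)))))))

-- Reachable memories and correctness at halting

module Reachable (n L N mb : ℕ) (spec : ℕ → ℕ → Spec) (s : List (Edge n)) (simple : SimpleStream s)
                 (C : ℕ) (admissible : ∀ r → Admissible (maxDeg s) C (spec (maxDeg s) r))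
                 (λ′ : ℕ) (few : n * n + n * C ≤ 2 ^ λ′)
                 (sampling : ∀ r → sampled (spec (maxDeg s) r) ≡ true →
                    depth (spec (maxDeg s) r) ≡ 0 × size (spec (maxDeg s) r) ≡ C × 0 < slack (spec (maxDeg s) r) ×
                    2 * slack (spec (maxDeg s) r) * (C * suc (2 * slack (spec (maxDeg s) r) + 2 * (2 * slack (spec (maxDeg s) r)) * λ′)) ≤ suc mb) where

  open Simple s simple public

  Δ : ℕ
  Δ = maxDeg s

  open Rounds n L N mb spec s loopless Δ C inc≤maxDeg admissible public

  first-load : ∀ v → lookup (load (run start s)) v ≡ deg s v
  first-load v = trans (run-load start s v) (trans (∑-cong s (λ e → *-identityʳ (inc v e))) (sym (deg≡ v)))

  first-maximum : maximum (load (run start s)) ≡ Δ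
  first-maximum = trans (foldr-lookup (load (run start s))) (cong (foldr _⊔_ 0) (map-cong first-load (allFin n)))

  blank : Vec (Maybe ℕ) n
  blank = replicate n nothing

  blank-lookup : ∀ v {x : ℕ} {A : Set} → lookup blank v ≡ just x → A
  blank-lookup v e with trans (sym (lookup-replicate v nothing)) e
  ... | ()

  first-pass : pass s start ≡ startRound Δ 0 blank
  first-pass = cong (λ D → startRound D 0 blank) first-maximum

  first-invariant : Invariant (startRound Δ 0 blank)
  first-invariant = startRound-invariant 0 blank (λ e _ e₁ _ → blank-lookup (proj₁ e) e₁) (λ v e → blank-lookup v e)

  -- Halting is tested after every pass and every memory is encoded, so properness and size bounds
  -- are needed in the middle of a round as well.
  data Good : Memory n → Set where
    initial   : Good start
    choosing  : ∀ r j c bl → Invariant (mem Δ r j choose c bl (replicate n 0)) → j ≤ depth (spec Δ r) → Good (mem Δ r j choose c bl (replicate n 0))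
    filtering : ∀ r j c bl ca → Invariant (mem Δ r j filter c bl ca) → Candidate (mem Δ r j filter c bl ca) → j ≤ depth (spec Δ r) → Good (mem Δ r j filter c bl ca)

  good-start : ∀ r c → Invariant (startRound Δ r c) → Good (startRound Δ r c)
  good-start r c inv = choosing r (depth (spec Δ r)) c (Vec.map activate c) inv ≤-refl

  good-choose : ∀ r j c bl → Invariant (mem Δ r j choose c bl (replicate n 0)) → j ≤ depth (spec Δ r) →
                ∀ x → sampled (spec Δ r) ≡ x → Good (pass s (mem Δ r j choose c bl (replicate n 0)))
  good-choose r j c bl inv j≤ false eq = filtering r j c bl _ (Choose.inv₁ r j c bl (replicate n 0) inv) (Choose.Sketched.candidate r j c bl (replicate n 0) inv eq) j≤
  good-choose r zero c bl inv j≤ true eq = let (sh , fu , 0<z , many) = sampling r eq in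
    filtering r 0 c bl _ (Choose.inv₁ r 0 c bl (replicate n 0) inv) (Sampled.candidate r c bl (replicate n 0) inv eq sh fu λ′ 0<z few many) j≤
  good-choose r (suc j) c bl inv j≤ true eq = ⊥-elim (n≮0 (subst (suc j ≤_) (proj₁ (sampling r eq)) j≤))

  good-pass : ∀ {m} → Good m → Good (pass s m)
  good-pass initial = subst Good (sym first-pass) (good-start 0 blank first-invariant)
  good-pass (choosing r j c bl inv j≤) = good-choose r j c bl inv j≤ (sampled (spec Δ r)) refl
  good-pass (filtering r zero c bl ca inv cok j≤) = good-start (suc r) _ (FilterLast.invariant′ r c bl ca inv cok)
  good-pass (filtering r (suc j) c bl ca inv cok j≤) = choosing r j c _ (filter-deeper r j c bl ca inv cok) (<⇒≤ j≤)

  good-iter : ∀ p → Good (iter p start)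
  good-iter p = go p initial
    where
    go : ∀ p {m} → Good m → Good (iter p m)
    go zero    g = g
    go (suc p) g = go p (good-pass g)

  -- The round counter has to fit into memory; this bounds it by the number of passes.
  round-pass : ∀ m → round (pass s m) ≤ suc (round m)
  round-pass (mem D r j degrees c bl ca)       = z≤n
  round-pass (mem D r j choose c bl ca)        = n≤1+n r
  round-pass (mem D r zero filter c bl ca)     = ≤-refl
  round-pass (mem D r (suc j) filter c bl ca)  = n≤1+n r

  round-iter : ∀ p → round (iter p start) ≤ p
  round-iter p = ≤-trans (go p start) (≤-reflexive (+-identityʳ p))
    where
    go : ∀ p m → round (iter p m) ≤ p + round m
    go zero    m = ≤-refl
    go (suc p) m = ≤-trans (go p (pass s m)) (≤-trans (+-monoʳ-≤ p (round-pass m)) (≤-reflexive (+-suc p (round m))))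

  done-lookup : ∀ {j} (c : Vec (Maybe ℕ) j) → Vec.foldr _ (λ c r → isJust c ∧ r) true c ≡ true → ∀ v → Σ ℕ λ x → lookup c v ≡ just x
  done-lookup (x ∷ c) e zero    = isJust-true (proj₁ (∧-true {isJust x} e))
  done-lookup (x ∷ c) e (suc v) = done-lookup c (proj₂ (∧-true {isJust x} e)) v

  uncoloured-done : ∀ {j} (c : Vec (Maybe ℕ) j) → ∑ (allFin j) (λ v → ⟦ not (isJust (lookup c v)) ⟧) ≡ 0 → Vec.foldr _ (λ c r → isJust c ∧ r) true c ≡ true
  uncoloured-done []            e = refl
  uncoloured-done {suc j} (x ∷ c) e with isJust x | trans (sym (∑-allFin-suc j (λ v → ⟦ not (isJust (lookup (x ∷ c) v)) ⟧))) e
  ... | true | e′ = uncoloured-done c e′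

  good-proper : ∀ {m} → Good m → ∀ e → e ∈ s → ∀ {x} → lookup (col m) (proj₁ e) ≡ just x → lookup (col m) (proj₂ e) ≡ just x → ⊥
  good-proper initial                            e _ e₁ _ = blank-lookup (proj₁ e) e₁
  good-proper (choosing r j c bl inv _)        = proper inv
  good-proper (filtering r j c bl ca inv _ _)  = proper inv

  good-bounded : ∀ {m} → Good m → ∀ v {y} → lookup (col m) v ≡ just y → y < C
  good-bounded initial                           v e = blank-lookup v e
  good-bounded (choosing r j c bl inv _)       = bounded inv
  good-bounded (filtering r j c bl ca inv _ _) = bounded inv

  good-coloring : ∀ a b → C * b ≤ (b + a) * Δ → ∀ {m} → Good m → done m ≡ true → ProperColoring s a b Δ (λ v → fromMaybe 0 (lookup (col m) v))
  good-coloring a b C≤ {m} good dn = distinct , small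
    where
    at : ∀ v → Σ ℕ λ x → lookup (col m) v ≡ just x
    at = done-lookup (col m) dn
    colour≡ : ∀ v → fromMaybe 0 (lookup (col m) v) ≡ proj₁ (at v)
    colour≡ v = cong (fromMaybe 0) (proj₂ (at v))
    distinct : ∀ {e} → e ∈ s → fromMaybe 0 (lookup (col m) (proj₁ e)) ≢ fromMaybe 0 (lookup (col m) (proj₂ e))
    distinct {e} e∈ eq = good-proper good e e∈ (proj₂ (at (proj₁ e)))
      (trans (proj₂ (at (proj₂ e))) (cong just (trans (sym (colour≡ (proj₂ e))) (trans (sym eq) (colour≡ (proj₁ e))))))
    small : ∀ v → suc (fromMaybe 0 (lookup (col m) v)) * b ≤ (b + a) * Δ
    small v = ≤-trans (*-monoˡ-≤ b (subst (λ x → suc x ≤ C) (sym (colour≡ v)) (good-bounded good v (proj₂ (at v))))) C≤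

-- Parameters

-- Serves for the integer square root and for the first pass after which the run halts.
least : ∀ (f : ℕ → Bool) k → f k ≡ true → Σ ℕ λ j → j ≤ k × f j ≡ true × (∀ i → i < j → f i ≡ false)
least f zero    e = 0 , z≤n , e , λ i ()
least f (suc k) e with f 0 in e₀
... | true  = 0 , z≤n , e₀ , λ i ()
... | false with least (λ i → f (suc i)) k e
...   | j , j≤k , fj , below = suc j , s≤s j≤k , fj , λ { zero _ → e₀ ; (suc i) (s≤s i<j) → below i i<j }

n≤n*n : ∀ x → x ≤ x * x
n≤n*n zero    = z≤n
n≤n*n (suc x) = m≤m*n (suc x) (suc x)

≤⇒≤ᵇ-true : ∀ {x y} → x ≤ y → (x ≤ᵇ y) ≡ true
≤⇒≤ᵇ-true {x} {y} le with x ≤ᵇ y in e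
... | true  = refl
... | false = ⊥-elim (<⇒≱ (≤ᵇ-false e) le)

>⇒≤ᵇ-false : ∀ {x y} → y < x → (x ≤ᵇ y) ≡ false
>⇒≤ᵇ-false {x} {y} lt with x ≤ᵇ y in e
... | true  = ⊥-elim (<⇒≱ lt (≤ᵇ-true e))
... | false = refl

sqrtWitness : ∀ x → Σ ℕ λ j → j ≤ x × (x ≤ᵇ j * j) ≡ true × (∀ i → i < j → (x ≤ᵇ i * i) ≡ false)
sqrtWitness x = least (λ r → x ≤ᵇ r * r) x (≤⇒≤ᵇ-true (n≤n*n x))

⌈√_⌉ : ℕ → ℕ
⌈√ x ⌉ = proj₁ (sqrtWitness x)

x≤⌈√x⌉² : ∀ x → x ≤ ⌈√ x ⌉ * ⌈√ x ⌉
x≤⌈√x⌉² x = ≤ᵇ-true (proj₁ (proj₂ (proj₂ (sqrtWitness x))))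

⌈√⌉≤self : ∀ x → ⌈√ x ⌉ ≤ x
⌈√⌉≤self x = proj₁ (proj₂ (sqrtWitness x))

⌈√⌉-least : ∀ x r → x ≤ r * r → ⌈√ x ⌉ ≤ r
⌈√⌉-least x r le = ≮⇒≥ λ lt → <⇒≱ (≤ᵇ-false (proj₂ (proj₂ (proj₂ (sqrtWitness x))) r lt)) le

deepest : ℕ → ℕ → ℕ → ℕ
deepest q x zero    = 0
deepest q x (suc f) = if 2 * q ^ suc f ≤ᵇ x then suc f else deepest q x f

deepest-fits : ∀ q x f → 2 ≤ x → 2 * q ^ deepest q x f ≤ x
deepest-fits q x zero    2≤x = 2≤x
deepest-fits q x (suc f) 2≤x with 2 * q ^ suc f ≤ᵇ x in e
... | true  = ≤ᵇ-true e
... | false = deepest-fits q x f 2≤x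

deepest-maximal : ∀ q x f j → deepest q x f < j → j ≤ f → x < 2 * q ^ j
deepest-maximal q x zero    j lt le = ⊥-elim (<⇒≱ lt le)
deepest-maximal q x (suc f) j lt le with 2 * q ^ suc f ≤ᵇ x in e
... | true  = ⊥-elim (<⇒≱ lt le)
... | false with m≤n⇒m<n∨m≡n le
...   | inj₁ (s≤s j≤f) = deepest-maximal q x f j lt j≤f
...   | inj₂ refl      = ≤ᵇ-false e

2^-cancel-< : ∀ m n → 2 ^ m < 2 ^ n → m < n
2^-cancel-< m n h = ≰⇒> (λ n≤m → <⇒≱ h (^-monoʳ-≤ 2 n≤m))

bitLength : ℕ → ℕ
bitLength n = suc ⌈log₂ (suc n) ⌉

n<2^bitLength : ∀ n → suc n < 2 ^ bitLength n
n<2^bitLength n = ≰⇒> λ le → 1+n≰n (subst (_≤ ⌈log₂ suc n ⌉) (⌈log₂2^n⌉≡n (bitLength n)) (⌈log₂⌉-mono-≤ le))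

n<2^[1+log] : ∀ n → n < 2 ^ suc ⌊log₂ n ⌋
n<2^[1+log] n = ≰⇒> λ le → 1+n≰n (subst (_≤ ⌊log₂ n ⌋) (⌊log₂[2^n]⌋≡n (suc ⌊log₂ n ⌋)) (⌊log₂⌋-mono-≤ le))

2^x≤n⇒x≤log : ∀ x n → 2 ^ x ≤ n → x ≤ ⌊log₂ n ⌋
2^x≤n⇒x≤log x n le = subst (_≤ ⌊log₂ n ⌋) (⌊log₂[2^n]⌋≡n x) (⌊log₂⌋-mono-≤ le)

module Parameters (a b n : ℕ) (0<a : 0 < a) (a<b : a < b) where

  instance
    a≢0 : NonZero a
    a≢0 = >-nonZero 0<a
    b≢0 : NonZero b
    b≢0 = >-nonZero (<-trans 0<a a<b)

  0<b : 0 < b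
  0<b = <-trans 0<a a<b

  ℓ : ℕ
  ℓ = bitLength n

  extra palette : ℕ → ℕ
  extra Δ   = a * Δ / b
  palette Δ = Δ + extra Δ

  -- `g` exceeds `2/η`; once `η Δ ≥ 1` this yields `Δ / palette Δ ≤ 1 - 1/(g + 1)`. With
  -- `z = 2 (g + 1)` the inaccuracy `1 + 1/z` of the family costs at most half of this gain.
  g z : ℕ
  g = suc (2 * b / a)
  z = 2 * suc g

  -- A run of `z` rounds, each with shrinking factor `1 - 1/z`, halves the uncoloured set; this is
  -- done `4 * root Δ` times.
  root sampledRounds : ℕ → ℕ
  root Δ = ⌈√ ⌊log₂ Δ ⌋ ⌉
  sampledRounds Δ = z * (4 * root Δ)

  -- quality s is (number of levels) · X · 2^s for the failure bound X of one level (sketched-shrink).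
  c₀ : ℕ
  c₀ = 150 * (b * b) * (ℓ * ℓ * ℓ)

  quality : ℕ → ℕ
  quality s = 2 * (c₀ * (2 ^ s * 2 ^ s))

  -- The deepest nesting with `2 q^depth ≤ extra + 1` for `q = 2^s`: rounding the palette down to a
  -- multiple of `q^depth` then sacrifices at most about half of the extra colours.
  levels : ℕ → ℕ → ℕ
  levels Δ s = deepest (2 ^ s) (suc (extra Δ)) (suc (extra Δ))

  sampledSpec : ℕ → Spec
  sampledSpec Δ = record { sampled = true ; base = 1 ; depth = 0 ; top = palette Δ ; slack = z ; precision = 1 }

  sketchedSpec : ℕ → ℕ → Spec
  sketchedSpec Δ s = record { sampled = false ; base = 2 ^ s ; depth = levels Δ s ; top = palette Δ ÷ ((2 ^ s) ^ levels Δ s) ; slack = 0 ; precision = quality s ∸ 1 }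

  -- After the sampled rounds come four rounds for each s = t, 2t, 4t, …
  exponent : ℕ → ℕ → ℕ
  exponent Δ r = 2 ^ ((r ∸ sampledRounds Δ) / 4) * root Δ

  spec : ℕ → ℕ → Spec
  spec Δ r = if sampledRounds Δ ≤ᵇ r then sketchedSpec Δ (exponent Δ r) else sampledSpec Δ

  -- `2^L` exceeds the number of edges. `N` covers the buffer size `d² λ` of halving: the factor
  -- `2^(4s)` in `d²` cancels against the size of the uncoloured set. `2^λ′` bounds the number of
  -- tests for the family, and `mb` is the family size demanded by `family-rare` for a palette of at
  -- most `2 n` colours.
  L N mb λ′ : ℕ
  L  = 2 * ℓ
  N  = 2 * c₀ * (2 * c₀) * ((7 + b) * ℓ) * suc n
  λ′ = 2 + 2 * ℓ
  mb = 2 * z * (2 * n * suc (2 * z + 2 * (2 * z) * λ′))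

  0<ℓ : 0 < ℓ
  0<ℓ = s≤s z≤n

  0<c₀ : 0 < c₀
  0<c₀ = *-mono-≤ {1} {150 * (b * b)} {1} (*-mono-≤ {1} {150} {1} (s≤s z≤n) (*-mono-≤ 0<b 0<b)) (*-mono-≤ (*-mono-≤ 0<ℓ 0<ℓ) 0<ℓ)

  n<2^ℓ : n < 2 ^ ℓ
  n<2^ℓ = <-trans (n<1+n n) (n<2^bitLength n)

  n²<2^L : n * n < 2 ^ L
  n²<2^L = <-≤-trans (*-mono-< n<2^ℓ n<2^ℓ) (≤-reflexive (trans (sym (^-distribˡ-+-* 2 ℓ ℓ)) (cong (λ x → 2 ^ (ℓ + x)) (sym (+-identityʳ ℓ)))))

  0<quality : ∀ s → 1 < quality s
  0<quality s = *-monoʳ-≤ 2 (*-mono-≤ 0<c₀ (*-mono-≤ (m^n>0 2 s) (m^n>0 2 s)))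

  suc-precision : ∀ s → suc (quality s ∸ 1) ≡ quality s
  suc-precision s = m+[n∸m]≡n (<⇒≤ (0<quality s))

  ga≤3b : g * a ≤ 3 * b
  ga≤3b = begin
    a + 2 * b / a * a   ≤⟨ +-mono-≤ (<⇒≤ a<b) (m/n*n≤m (2 * b) a) ⟩
    b + 2 * b           ≡⟨⟩
    3 * b               ∎
    where open ≤-Reasoning

  2b≤ga : 2 * b ≤ g * a
  2b≤ga = <⇒≤ (m<[1+m/n]*n (2 * b) a)

  za≤8b : z * a ≤ 8 * b
  za≤8b = begin
    2 * suc g * a         ≡⟨ l g a ⟩
    2 * (g * a) + 2 * a   ≤⟨ +-mono-≤ (*-monoʳ-≤ 2 ga≤3b) (*-monoʳ-≤ 2 (<⇒≤ a<b)) ⟩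
    2 * (3 * b) + 2 * b   ≡⟨ l₂ b ⟩
    8 * b                 ∎
    where
    open ≤-Reasoning
    l : ∀ g a → 2 * suc g * a ≡ 2 * (g * a) + 2 * a
    l = solve-∀
    l₂ : ∀ b → 2 * (3 * b) + 2 * b ≡ 8 * b
    l₂ = solve-∀

  -- Estimates for a fixed maximum degree

  module Degree (Δ : ℕ) (Δ≤n : Δ ≤ n) (b≤aΔ : b ≤ a * Δ) where

    w C t : ℕ
    w = extra Δ
    C = palette Δ
    t = root Δ

    0<Δ : 0 < Δ
    0<Δ = n≢0⇒n>0 λ { refl → <⇒≱ 0<b (≤-trans b≤aΔ (≤-reflexive (*-zeroʳ a))) }

    2≤Δ : 2 ≤ Δ
    2≤Δ = ≰⇒> λ Δ≤1 → <⇒≱ a<b (≤-trans b≤aΔ (≤-trans (*-monoʳ-≤ a Δ≤1) (≤-reflexive (*-identityʳ a))))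

    0<w : 0 < w
    0<w = m≥n⇒m/n>0 b≤aΔ

    w<Δ : w < Δ
    w<Δ = m<n*o⇒m/o<n (subst (a * Δ <_) (*-comm b Δ) (*-monoˡ-< Δ {{>-nonZero 0<Δ}} a<b))

    aΔ< : a * Δ < suc w * b
    aΔ< = m<[1+m/n]*n (a * Δ) b

    C*b≤ : C * b ≤ (b + a) * Δ
    C*b≤ = begin
      (Δ + w) * b         ≡⟨ *-distribʳ-+ b Δ w ⟩
      Δ * b + w * b       ≤⟨ +-mono-≤ (≤-reflexive (*-comm Δ b)) (m/n*n≤m (a * Δ) b) ⟩
      b * Δ + a * Δ       ≡⟨ sym (*-distribʳ-+ Δ b a) ⟩
      (b + a) * Δ         ∎
      where open ≤-Reasoning

    C≤2Δ : C ≤ 2 * Δ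
    C≤2Δ = +-monoʳ-≤ Δ (≤-trans (<⇒≤ w<Δ) (≤-reflexive (sym (+-identityʳ Δ))))

    0<C : 0 < C
    0<C = ≤-trans 0<Δ (m≤m+n Δ w)

    0<t : 0 < t
    0<t = n≢0⇒n>0 λ t≡0 → <⇒≱ (2^x≤n⇒x≤log 1 Δ 2≤Δ) (≤-trans (x≤⌈√x⌉² ⌊log₂ Δ ⌋) (≤-reflexive (cong (λ x → x * x) t≡0)))

    log≤t² : ⌊log₂ Δ ⌋ ≤ t * t
    log≤t² = x≤⌈√x⌉² ⌊log₂ Δ ⌋

    t≤ℓ : t ≤ ℓ
    t≤ℓ = ≤-trans (⌈√⌉≤self ⌊log₂ Δ ⌋) (≤-trans (⌊log₂⌋-mono-≤ (≤-trans Δ≤n (<⇒≤ n<2^ℓ))) (≤-reflexive (⌊log₂[2^n]⌋≡n ℓ)))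

    gC : suc g * Δ ≤ g * C
    gC = begin
      Δ + g * Δ        ≤⟨ +-monoˡ-≤ (g * Δ) Δ≤gw ⟩
      g * w + g * Δ    ≡⟨ trans (+-comm (g * w) (g * Δ)) (sym (*-distribˡ-+ g Δ w)) ⟩
      g * (Δ + w)      ∎
      where
      open ≤-Reasoning
      Δ≤gw : Δ ≤ g * w
      Δ≤gw = *-cancelˡ-≤ a (begin
        a * Δ          ≤⟨ <⇒≤ aΔ< ⟩
        suc w * b      ≤⟨ *-monoˡ-≤ b (+-monoˡ-≤ w 0<w) ⟩
        (w + w) * b    ≡⟨ l₁ w b ⟩
        2 * b * w      ≤⟨ *-monoˡ-≤ w 2b≤ga ⟩
        g * a * w      ≡⟨ l₂ g a w ⟩
        a * (g * w)    ∎)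
        where
        l₁ : ∀ w b → (w + w) * b ≡ 2 * b * w
        l₁ = solve-∀
        l₂ : ∀ g a w → g * a * w ≡ a * (g * w)
        l₂ = solve-∀

    -- Here z = 2g + 2, so the factor is 1 - 1/z.
    sampled-shrink : ∀ u u′ → z * (C * u′) ≤ suc z * (u * Δ) → z * u′ ≤ (suc g + g) * u
    sampled-shrink u u′ h = *-cancelˡ-≤ (suc g) (*-cancelˡ-≤ Δ {{>-nonZero 0<Δ}} (begin
      Δ * (suc g * (z * u′))            ≡⟨ l₁ Δ (suc g) z u′ ⟩
      z * u′ * (suc g * Δ)              ≤⟨ *-monoʳ-≤ (z * u′) gC ⟩
      z * u′ * (g * C)                  ≡⟨ l₂ z u′ g C ⟩
      g * (z * (C * u′))                ≤⟨ *-monoʳ-≤ g h ⟩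
      g * (suc z * (u * Δ))             ≡⟨ l₃ g u Δ ⟩
      Δ * (u * (g * (2 * g + 3)))       ≤⟨ *-monoʳ-≤ Δ (*-monoʳ-≤ u (≤-trans (n≤1+n _) (≤-reflexive (l₄ g)))) ⟩
      Δ * (u * (suc g * (suc g + g)))   ≡⟨ cong (Δ *_) (l₅ u (suc g) (suc g + g)) ⟩
      Δ * (suc g * ((suc g + g) * u))   ∎))
      where
      open ≤-Reasoning
      l₁ : ∀ D x y u → D * (x * (y * u)) ≡ y * u * (x * D)
      l₁ = solve-∀
      l₂ : ∀ z u g C → z * u * (g * C) ≡ g * (z * (C * u))
      l₂ = solve-∀
      l₃ : ∀ g u D → g * (suc (2 * suc g) * (u * D)) ≡ D * (u * (g * (2 * g + 3)))
      l₃ = solve-∀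
      l₄ : ∀ g → suc (g * (2 * g + 3)) ≡ suc g * (suc g + g)
      l₄ = solve-∀
      l₅ : ∀ u x y → u * (x * y) ≡ x * (y * u)
      l₅ = solve-∀

    module Sketching (s : ℕ) (0<s : 0 < s) where

      q Q D d : ℕ
      q = 2 ^ s
      D = levels Δ s
      Q = q ^ D
      d = quality s

      τ : Spec
      τ = sketchedSpec Δ s

      2≤q : 2 ≤ q
      2≤q = ^-monoʳ-≤ 2 0<s

      0<q : 0 < q
      0<q = ≤-trans (s≤s z≤n) 2≤q

      0<Q : 0 < Q
      0<Q = ^-pos q D 0<q

      instance
        Q≢0 : NonZero Q
        Q≢0 = >-nonZero 0<Q

      2Q≤ : 2 * Q ≤ suc w
      2Q≤ = deepest-fits q (suc w) (suc w) (s≤s 0<w)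

      2^D≤Q : 2 ^ D ≤ Q
      2^D≤Q = ^-monoˡ-≤ D 2≤q

      -- The search bound in `levels` does not interfere: `D + 1` still lies within it, so it was
      -- tried and rejected.
      D<w : suc D ≤ suc w
      D<w = ≤-trans (n<2^n D) (≤-trans 2^D≤Q (≤-trans (m≤m+n Q (Q + 0)) 2Q≤))

      w< : suc w < 2 * (q * Q)
      w< = deepest-maximal q (suc w) (suc w) (suc D) (n<1+n D) D<w

      top≡ : top τ ≡ C / Q
      top≡ = ÷-NonZero C Q
        where ÷-NonZero : ∀ x y .{{_ : NonZero y}} → x ÷ y ≡ x / y
              ÷-NonZero x (suc y) = refl

      size≤C′ : size τ ≤ C
      size≤C′ = ≤-trans (≤-reflexive (cong (_* Q) top≡)) (m/n*n≤m C Q)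

      -- Rounding loses fewer than `Q` of the `Δ + w` colours, and `2 Q ≤ w + 1`, so a surplus of at
      -- least `(w + 1)/2` remains.
      excess′ : suc w + 2 * Δ ≤ 2 * size τ
      excess′ = +-cancelʳ-≤ (2 * Q) _ _ (begin
        suc w + 2 * Δ + 2 * Q     ≤⟨ +-monoʳ-≤ (suc w + 2 * Δ) 2Q≤ ⟩
        suc w + 2 * Δ + suc w     ≡⟨ l₁ w Δ ⟩
        2 * suc C                 ≤⟨ *-monoʳ-≤ 2 (m<[1+m/n]*n C Q) ⟩
        2 * (suc (C / Q) * Q)     ≡⟨ cong (λ x → 2 * (suc x * Q)) (sym top≡) ⟩
        2 * (suc (top τ) * Q)     ≡⟨ l₂ (top τ) Q ⟩
        2 * (top τ * Q) + 2 * Q   ∎)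
        where
        open ≤-Reasoning
        l₁ : ∀ w D → suc w + 2 * D + suc w ≡ 2 * suc (D + w)
        l₁ = solve-∀
        l₂ : ∀ t Q → 2 * (suc t * Q) ≡ 2 * (t * Q) + 2 * Q
        l₂ = solve-∀

      Δ<size′ : Δ < size τ
      Δ<size′ = *-cancelˡ-< 2 _ _ (<-≤-trans (m<n+m (2 * Δ) (s≤s (z≤n {w}))) excess′)

      0<top′ : 0 < top τ
      0<top′ = n≢0⇒n>0 λ e → <⇒≱ Δ<size′ (≤-trans (≤-reflexive (cong (_* Q) e)) z≤n)

      admissible : Admissible Δ C τ
      admissible = record { 0<base = 0<q ; 0<top = 0<top′ ; Δ<size = Δ<size′ ; size≤C = size≤C′ }

      -- The surplus is a constant fraction of the palette for fixed η: `Δ ≤ a Δ < (w + 1) b`, and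
      -- `w + 1` is at most twice the surplus.
      size≤3b : size τ ≤ 3 * b * (size τ ∸ Δ)
      size≤3b = begin
        size τ                      ≡⟨ sym (m+[n∸m]≡n (<⇒≤ Δ<size′)) ⟩
        Δ + x                       ≤⟨ +-mono-≤ Δ≤ (≤-trans (≤-reflexive (sym (*-identityˡ x))) (*-monoˡ-≤ x 0<b)) ⟩
        2 * b * x + b * x           ≡⟨ l₁ b x ⟩
        3 * b * x                   ∎
        where
        open ≤-Reasoning
        x = size τ ∸ Δ
        l₁ : ∀ b x → 2 * b * x + b * x ≡ 3 * b * x
        l₁ = solve-∀
        w≤2x : suc w ≤ 2 * x
        w≤2x = +-cancelʳ-≤ (2 * Δ) _ _ (≤-trans excess′ (≤-reflexive (trans (cong (2 *_) (sym (m+[n∸m]≡n (<⇒≤ Δ<size′)))) (l₂ Δ x))))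
          where l₂ : ∀ D x → 2 * (D + x) ≡ 2 * x + 2 * D
                l₂ = solve-∀
        Δ≤ : Δ ≤ 2 * b * x
        Δ≤ = begin
          Δ                ≤⟨ m≤n*m Δ a ⟩
          a * Δ            ≤⟨ <⇒≤ aΔ< ⟩
          suc w * b        ≤⟨ *-monoˡ-≤ b w≤2x ⟩
          2 * x * b        ≡⟨ l₃ x b ⟩
          2 * b * x        ∎
          where l₃ : ∀ x b → 2 * x * b ≡ 2 * b * x
                l₃ = solve-∀

      -- By maximality of `D`, `w + 1 < 2 q Q`, while the palette has at most `2 (w + 1) b` colours.
      -- So the branching left over for the last level is also `O(q)` for fixed `b`.
      top≤ : top τ ≤ 4 * b * q
      top≤ = begin
        top τ                  ≡⟨ top≡ ⟩
        C / Q                  ≤⟨ /-monoˡ-≤ Q C≤ ⟩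
        4 * b * q * Q / Q      ≡⟨ m*n/n≡m (4 * b * q) Q ⟩
        4 * b * q              ∎
        where
        open ≤-Reasoning
        l₁ : ∀ b q Q → 2 * (2 * (q * Q) * b) ≡ 4 * b * q * Q
        l₁ = solve-∀
        C≤ : C ≤ 4 * b * q * Q
        C≤ = begin
          C                           ≤⟨ C≤2Δ ⟩
          2 * Δ                       ≤⟨ *-monoʳ-≤ 2 (≤-trans (m≤n*m Δ a) (<⇒≤ aΔ<)) ⟩
          2 * (suc w * b)             ≤⟨ *-monoʳ-≤ 2 (*-monoˡ-≤ b (<⇒≤ w<)) ⟩
          2 * (2 * (q * Q) * b)       ≡⟨ l₁ b q Q ⟩
          4 * b * q * Q               ∎

      β≤ : ∀ j → β τ j ≤ 4 * b * q
      β≤ zero    = top≤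
      β≤ (suc j) = m≤n*m q (4 * b) {{>-nonZero (*-mono-≤ (s≤s (z≤n {3})) 0<b)}}

      sβ≤ : ∀ j → suc (β τ j) ≤ 5 * b * q
      sβ≤ j = ≤-trans (+-mono-≤ (*-mono-≤ 0<b 0<q) (β≤ j)) (≤-reflexive (l b q))
        where l : ∀ b q → b * q + 4 * b * q ≡ 5 * b * q
              l = solve-∀

      κ : ℕ
      κ = 3 + b + s

      2β≤ : ∀ j → 2 * β τ j ≤ 2 ^ κ
      2β≤ j = begin
        2 * β τ j             ≤⟨ *-monoʳ-≤ 2 (β≤ j) ⟩
        2 * (4 * b * q)       ≡⟨ l b q ⟩
        8 * b * q             ≤⟨ *-monoˡ-≤ q (*-monoʳ-≤ 8 (<⇒≤ (n<2^n b))) ⟩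
        2 ^ 3 * 2 ^ b * 2 ^ s ≡⟨ trans (cong (_* 2 ^ s) (sym (^-distribˡ-+-* 2 3 b))) (sym (^-distribˡ-+-* 2 (3 + b) s)) ⟩
        2 ^ (3 + b + s)       ∎
        where
        open ≤-Reasoning
        l : ∀ b q → 2 * (4 * b * q) ≡ 8 * b * q
        l = solve-∀

      D+2≤ℓ : suc (suc D) ≤ ℓ
      D+2≤ℓ = 2^-cancel-< (suc D) ℓ (≤-<-trans (≤-trans (*-monoʳ-≤ 2 2^D≤Q) (≤-trans 2Q≤ (≤-trans w<Δ Δ≤n))) n<2^ℓ)

      sD≤log : s * D ≤ ⌊log₂ Δ ⌋
      sD≤log = 2^x≤n⇒x≤log (s * D) Δ (≤-trans (≤-reflexive (sym (^-*-assoc 2 s D))) (≤-trans (m≤m+n Q (Q + 0)) (≤-trans 2Q≤ w<Δ)))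

      -- The factor 2 in `quality` is there to make `d²` even, as the halving estimate requires.
      dd : d * d ≡ 2 * (c₀ * (q * q) * d)
      dd = *-assoc 2 (c₀ * (q * q)) d

      X : ℕ
      X = 3 * b * suc (suc D) * (10 * (5 * b * q) * L)

      gap-bound : ∀ j F u → d * (F * (size τ ∸ Δ)) ≤ Γ τ * (10 * suc (β τ j) * (L * u)) → d * F ≤ X * u
      gap-bound j F u h = *-cancelʳ-≤ _ _ x {{>-nonZero (m<n⇒0<n∸m Δ<size′)}} (begin
        d * F * x                                                 ≡⟨ *-assoc d F x ⟩
        d * (F * x)                                               ≤⟨ h ⟩
        size τ * suc (suc D) * (10 * suc (β τ j) * (L * u))       ≤⟨ *-mono-≤ (*-monoˡ-≤ (suc (suc D)) size≤3b) (*-monoˡ-≤ (L * u) (*-monoʳ-≤ 10 (sβ≤ j))) ⟩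
        3 * b * x * suc (suc D) * (10 * (5 * b * q) * (L * u))    ≡⟨ l (3 * b) x (suc (suc D)) (10 * (5 * b * q)) L u ⟩
        X * u * x                                                 ∎)
        where
        open ≤-Reasoning
        x = size τ ∸ Δ
        l : ∀ b x D y L u → b * x * D * (y * (L * u)) ≡ b * D * (y * L) * u * x
        l = solve-∀

      -- The constants of `c₀` arise here: `D + 2 ≤ ℓ` is used for the number of levels and inside
      -- `X`, `L = 2 ℓ` gives the third `ℓ`, and `3 · 50 · 2 = 300` is the `2 · 150` of `2 c₀`.
      sketched-shrink : ∀ u u′ → d * u′ ≤ suc D * (X * u) → q * u′ ≤ u
      sketched-shrink u u′ h = *-cancelˡ-≤ (2 * c₀ * q) {{>-nonZero (*-mono-≤ {1} {2 * c₀} {1} (≤-trans 0<c₀ (m≤m+n c₀ (c₀ + 0))) 0<q)}} (begin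
        2 * c₀ * q * (q * u′)           ≡⟨ l₁ c₀ q u′ ⟩
        d * u′                          ≤⟨ h ⟩
        suc D * (X * u)                 ≤⟨ *-mono-≤ (≤-trans (n≤1+n (suc D)) D+2≤ℓ) (*-monoˡ-≤ u (*-monoˡ-≤ (10 * (5 * b * q) * L) (*-monoʳ-≤ (3 * b) D+2≤ℓ))) ⟩
        ℓ * (3 * b * ℓ * (10 * (5 * b * q) * (2 * ℓ)) * u) ≡⟨ l₂ ℓ b q u ⟩
        2 * c₀ * q * u                  ∎)
        where
        open ≤-Reasoning
        l₁ : ∀ c q u → 2 * c * q * (q * u) ≡ 2 * (c * (q * q)) * u
        l₁ = solve-∀
        l₂ : ∀ l b q u → l * (3 * b * l * (10 * (5 * b * q) * (2 * l)) * u) ≡ 2 * (150 * (b * b) * (l * l * l)) * q * u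
        l₂ = solve-∀

      -- `d²` contains `q^4 = 2^(4s)`, which the hypothesis turns into `n`; this dictates the
      -- exponent 4 throughout the schedule. A positive `u` is needed to absorb the constant 3 and
      -- to bound `s` by `ℓ`.
      buffer : ∀ u → 0 < u → u * 2 ^ (4 * s) ≤ n → ∀ B → B ≤ u → d * d * (3 + κ * B) ≤ N
      buffer u 0<u fit B B≤u = begin
        d * d * (3 + κ * B)                                     ≤⟨ *-monoʳ-≤ (d * d) (+-mono-≤ (*-monoʳ-≤ 3 0<u) (*-monoʳ-≤ κ B≤u)) ⟩
        d * d * (3 * u + κ * u)                                 ≡⟨ l₁ d c₀ q u b s ⟩
        2 * c₀ * (2 * c₀) * (6 + b + s) * (u * (q * q * (q * q))) ≤⟨ *-mono-≤ (*-monoʳ-≤ (2 * c₀ * (2 * c₀)) e₁) e₂ ⟩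
        2 * c₀ * (2 * c₀) * ((7 + b) * ℓ) * suc n               ∎
        where
        open ≤-Reasoning
        l₁ : ∀ d c q u b s → 2 * (c * (q * q)) * (2 * (c * (q * q))) * (3 * u + (3 + b + s) * u) ≡ 2 * c * (2 * c) * (6 + b + s) * (u * (q * q * (q * q)))
        l₁ d = solve-∀
        q⁴ : q * q * (q * q) ≡ 2 ^ (4 * s)
        q⁴ = trans (cong₂ _*_ (sym (^-distribˡ-+-* 2 s s)) (sym (^-distribˡ-+-* 2 s s))) (trans (sym (^-distribˡ-+-* 2 (s + s) (s + s))) (cong (2 ^_) (l s)))
          where l : ∀ s → s + s + (s + s) ≡ 4 * s
                l = solve-∀
        e₂ : u * (q * q * (q * q)) ≤ suc n
        e₂ = ≤-trans (≤-reflexive (cong (u *_) q⁴)) (≤-trans fit (n≤1+n n))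
        s≤ℓ : s ≤ ℓ
        s≤ℓ = <⇒≤ (2^-cancel-< s ℓ (≤-<-trans (≤-trans (^-monoʳ-≤ 2 (m≤n*m s 4)) (≤-trans (m≤n*m (2 ^ (4 * s)) u {{>-nonZero 0<u}}) fit)) n<2^ℓ))
        e₁ : 6 + b + s ≤ (7 + b) * ℓ
        e₁ = ≤-trans (+-mono-≤ (≤-trans (≤-reflexive (sym (*-identityʳ (6 + b)))) (*-monoʳ-≤ (6 + b) 0<ℓ)) s≤ℓ) (≤-reflexive (l (6 + b) ℓ))
          where l : ∀ x y → x * y + y ≡ suc x * y
                l = solve-∀

-- Schedule of rounds and number of passes

module Schedule (a b n : ℕ) (0<a : 0 < a) (a<b : a < b) (s : List (Edge n)) (simple : SimpleStream s) (b≤aΔ : b ≤ a * maxDeg s) where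

  open Parameters a b n 0<a a<b public
  open Degree (maxDeg s) (Simple.maxDeg≤n s simple) b≤aΔ public

  private
    R = sampledRounds (maxDeg s)

  spec-sampled : ∀ r → r < R → spec (maxDeg s) r ≡ sampledSpec (maxDeg s)
  spec-sampled r r<R = cong (λ x → if x then sketchedSpec (maxDeg s) (exponent (maxDeg s) r) else sampledSpec (maxDeg s)) (>⇒≤ᵇ-false r<R)

  spec-sketched : ∀ r → R ≤ r → spec (maxDeg s) r ≡ sketchedSpec (maxDeg s) (exponent (maxDeg s) r)
  spec-sketched r R≤r = cong (λ x → if x then sketchedSpec (maxDeg s) (exponent (maxDeg s) r) else sampledSpec (maxDeg s)) (≤⇒≤ᵇ-true R≤r)

  0<exponent : ∀ r → 0 < exponent (maxDeg s) r
  0<exponent r = *-mono-≤ (m^n>0 2 ((r ∸ R) / 4)) 0<t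

  admissible-sampled : Admissible (maxDeg s) C (sampledSpec (maxDeg s))
  admissible-sampled = record { 0<base = s≤s z≤n ; 0<top = 0<C
    ; Δ<size = subst (maxDeg s <_) (sym (*-identityʳ C)) (m<m+n (maxDeg s) 0<w) ; size≤C = ≤-reflexive (*-identityʳ C) }

  spec-admissible : ∀ r → Admissible (maxDeg s) C (spec (maxDeg s) r)
  spec-admissible r = cases (R ≤? r)
    where
    cases : Dec (R ≤ r) → Admissible (maxDeg s) C (spec (maxDeg s) r)
    cases (yes R≤r) = subst (Admissible (maxDeg s) C) (sym (spec-sketched r R≤r)) (Sketching.admissible (exponent (maxDeg s) r) (0<exponent r))
    cases (no R≰r)  = subst (Admissible (maxDeg s) C) (sym (spec-sampled r (≰⇒> R≰r))) admissible-sampled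

  C≤2n : C ≤ 2 * n
  C≤2n = ≤-trans C≤2Δ (*-monoʳ-≤ 2 (Simple.maxDeg≤n s simple))

  few-tests : n * n + n * C ≤ 2 ^ λ′
  few-tests = begin
    n * n + n * C               ≤⟨ +-monoʳ-≤ (n * n) (*-monoʳ-≤ n C≤2n) ⟩
    n * n + n * (2 * n)         ≤⟨ m≤m+n _ (n * n) ⟩
    n * n + n * (2 * n) + n * n ≡⟨ l n ⟩
    2 ^ 2 * (n * n)             ≤⟨ *-monoʳ-≤ (2 ^ 2) (<⇒≤ n²<2^L) ⟩
    2 ^ 2 * 2 ^ (2 * ℓ)         ≡⟨ sym (^-distribˡ-+-* 2 2 (2 * ℓ)) ⟩
    2 ^ (2 + 2 * ℓ)             ∎
    where
    open ≤-Reasoning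
    l : ∀ n → n * n + n * (2 * n) + n * n ≡ 4 * (n * n)
    l = solve-∀

  SamplingOK : Spec → Set
  SamplingOK σ = depth σ ≡ 0 × size σ ≡ C × 0 < slack σ × 2 * slack σ * (C * suc (2 * slack σ + 2 * (2 * slack σ) * λ′)) ≤ suc mb

  sampling-ok : SamplingOK (sampledSpec (maxDeg s))
  sampling-ok = refl , *-identityʳ C , s≤s z≤n , ≤-trans (*-monoʳ-≤ (2 * z) (*-monoˡ-≤ (suc (2 * z + 2 * (2 * z) * λ′)) C≤2n)) (n≤1+n mb)

  spec-sampling : ∀ r → sampled (spec (maxDeg s) r) ≡ true → SamplingOK (spec (maxDeg s) r)
  spec-sampling r e = cases (R ≤? r)
    where
    absurd : false ≡ true → SamplingOK (spec (maxDeg s) r)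
    absurd ()
    cases : Dec (R ≤ r) → SamplingOK (spec (maxDeg s) r)
    cases (no R≰r)  = subst SamplingOK (sym (spec-sampled r (≰⇒> R≰r))) sampling-ok
    cases (yes R≤r) = absurd (trans (sym (cong sampled (spec-sketched r R≤r))) e)

  open Reachable n L N mb spec s simple C spec-admissible λ′ few-tests spec-sampling hiding (b) public

  Done : ℕ → Set
  Done p = Σ ℕ λ p′ → p′ ≤ p × done (iter p′ start) ≡ true

  At : ℕ → ℕ → Vec (Maybe ℕ) n → Set
  At p r c = iter p start ≡ startRound Δ r c × Invariant (startRound Δ r c)

  Reached : ℕ → ℕ → ℕ → Set
  Reached p r x = Σ (Vec (Maybe ℕ) n) λ c → At p r c × uncoloured c * 2 ^ x ≤ n

  done-mono : ∀ {p p′} → p ≤ p′ → Done p → Done p′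
  done-mono le (q , q≤ , d) = q , ≤-trans q≤ le , d

  at-done : ∀ p r c → At p r c → uncoloured c ≡ 0 → Done p
  at-done p r c (eq , _) e = p , ≤-refl , trans (cong done eq) (uncoloured-done c e)

  at-next : ∀ p r c q r′ c′ → At p r c → iter q (startRound Δ r c) ≡ startRound Δ r′ c′ → Invariant (startRound Δ r′ c′) → At (p + q) r′ c′
  at-next p r c q r′ c′ (eq , _) eq′ inv = trans (iter-+ p q start) (trans (cong (iter q) eq) eq′) , inv

  sampled-step : ∀ p r c → At p r c → r < R → Σ (Vec (Maybe ℕ) n) λ c′ → At (p + 2) (suc r) c′ × z * uncoloured c′ ≤ (suc g + g) * uncoloured c
  sampled-step p r c at r<R = c′ , at-next p r c 2 (suc r) c′ at (proj₁ (proj₂ out)) (proj₁ (proj₂ (proj₂ out))) ,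
      sampled-shrink (uncoloured c) (uncoloured c′) (subst (λ σ → slack σ * (C * uncoloured c′) ≤ suc (slack σ) * (uncoloured c * Δ)) (spec-sampled r r<R) (proj₂ (proj₂ (proj₂ out))))
    where
    isS = cong sampled (spec-sampled r r<R)
    so = spec-sampling r isS
    out = SampledRound.wholeRound r isS (proj₁ so) (proj₁ (proj₂ so)) λ′ (proj₁ (proj₂ (proj₂ so))) few-tests (proj₂ (proj₂ (proj₂ so))) c (proj₂ at)
    c′ = proj₁ out

  relevant<2^L : ∀ (f : Edge n → Bool) → cnt f s < 2 ^ L
  relevant<2^L f = ≤-<-trans (≤-trans (cnt≤length f s) length≤n²) n²<2^L

  module SketchedStep (e : ℕ) (0<e : 0 < e) where
    open Sketching e 0<e

    price : ℕ
    price = 2 * suc D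

    module _ (p r : ℕ) (c : Vec (Maybe ℕ) n) (at : At p r c) (eq : spec Δ r ≡ sketchedSpec Δ e) where

      unsampled : sampled (spec Δ r) ≡ false
      unsampled = cong sampled eq

      u : ℕ
      u = uncoloured c

      approximate : 0 < u → u * 2 ^ (4 * e) ≤ n → ∀ j bl ca (inv : Invariant (mem Δ r j choose c bl ca)) → blocks bl ≤ u →
                    d * Choose.Sketched.failures r j c bl ca inv unsampled ≤ X * u
      approximate 0<u fit j bl ca inv bl≤ = ≤-trans (gap-bound j F (blocks bl) (subst (λ x → x * (F * (size (sketchedSpec Δ e) ∸ Δ)) ≤ Γ (sketchedSpec Δ e) * (10 * suc (β (sketchedSpec Δ e) j) * (L * blocks bl)))
            (suc-precision e) (subst (λ σ → suc (precision σ) * (F * (size σ ∸ Δ)) ≤ Γ σ * (10 * suc (β σ j) * (L * blocks bl))) eq raw))) (*-monoʳ-≤ X bl≤)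
        where
        F = Choose.Sketched.failures r j c bl ca inv unsampled
        raw = Choose.Sketched.few-failures r j c bl ca inv unsampled (c₀ * (q * q) * d) κ
          (subst (λ σ → suc (precision σ) * suc (precision σ) ≡ 2 * (c₀ * (q * q) * d)) (sym eq) (trans (cong₂ _*_ (suc-precision e) (suc-precision e)) dd))
          (subst (λ σ → 0 < precision σ) (sym eq) (≤-pred (subst (2 ≤_) (sym (suc-precision e)) (0<quality e))))
          (subst (λ σ → 2 * β σ j ≤ 2 ^ κ) (sym eq) (2β≤ j))
          (subst (λ σ → suc (precision σ) * suc (precision σ) * (3 + κ * blocks bl) ≤ N) (sym eq)
            (subst (λ x → x * x * (3 + κ * blocks bl) ≤ N) (sym (suc-precision e)) (buffer u 0<u fit (blocks bl) bl≤)))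
          (relevant<2^L (rel (mem Δ r j choose c bl ca)))

      exact : u * Δ < N → ∀ j bl ca (inv : Invariant (mem Δ r j choose c bl ca)) → blocks bl ≤ u → 1 * Choose.Sketched.failures r j c bl ca inv unsampled ≤ 0
      exact lt j bl ca inv bl≤ = ≤-reflexive (trans (*-identityˡ _)
        (Choose.Sketched.no-failures r j c bl ca inv unsampled _ refl (≤-<-trans (*-monoˡ-≤ Δ bl≤) lt)))

      shrink-step : 0 < u → u * 2 ^ (4 * e) ≤ n → Σ (Vec (Maybe ℕ) n) λ c′ → At (p + price) (suc r) c′ × q * uncoloured c′ ≤ u
      shrink-step 0<u fit = c′ , at-next p r c price (suc r) c′ at (subst (λ σ → iter (2 * suc (depth σ)) (startRound Δ r c) ≡ startRound Δ (suc r) c′) eq (proj₁ (proj₂ out))) (proj₁ (proj₂ (proj₂ out))) ,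
          sketched-shrink u (uncoloured c′) (subst (λ σ → d * uncoloured c′ ≤ suc (depth σ) * (X * u)) eq (proj₂ (proj₂ (proj₂ out))))
        where
        out = SketchedRound.wholeRound r c unsampled u d (X * u) (approximate 0<u fit) (proj₂ at) ≤-refl
        c′ = proj₁ out

      final-step : u * Δ < N → Σ (Vec (Maybe ℕ) n) λ c′ → At (p + price) (suc r) c′ × uncoloured c′ ≡ 0
      final-step lt = c′ , at-next p r c price (suc r) c′ at (subst (λ σ → iter (2 * suc (depth σ)) (startRound Δ r c) ≡ startRound Δ (suc r) c′) eq (proj₁ (proj₂ out))) (proj₁ (proj₂ (proj₂ out))) ,
          n≤0⇒n≡0 (≤-trans (≤-reflexive (sym (*-identityˡ _))) (≤-trans (proj₂ (proj₂ (proj₂ out))) (≤-reflexive (*-zeroʳ (suc (depth (spec Δ r)))))))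
        where
        out = SketchedRound.wholeRound r c unsampled u 1 0 (exact lt) (proj₂ at) ≤-refl
        c′ = proj₁ out

  -- The sampled phase

  uncoloured≤n : ∀ c → uncoloured c ≤ n
  uncoloured≤n c = ≤-trans (∑-mono (allFin n) (λ v → ⟦⟧≤1 (not (isJust (lookup c v))))) (≤-reflexive (trans (∑-const (allFin n) 1) (trans (*-identityʳ _) (length-allFin n))))

  x : ℕ
  x = suc g + g

  z≡ : z ≡ suc x
  z≡ = l g where l : ∀ g → 2 * suc g ≡ suc (suc g + g)
                 l = solve-∀

  sampled-phase : ∀ i → i ≤ R → Σ (Vec (Maybe ℕ) n) λ c → At (1 + 2 * i) i c × z ^ i * uncoloured c ≤ x ^ i * n
  sampled-phase zero i≤R = blank , (first-pass , first-invariant) , *-monoʳ-≤ 1 (uncoloured≤n blank)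
  sampled-phase (suc i) i<R = c′ , subst (λ p → At p (suc i) c′) (l₁ i) at′ , (begin
    z * z ^ i * uncoloured c′        ≡⟨ l₂ z (z ^ i) (uncoloured c′) ⟩
    z ^ i * (z * uncoloured c′)      ≤⟨ *-monoʳ-≤ (z ^ i) h′ ⟩
    z ^ i * (x * uncoloured c)       ≡⟨ l₃ (z ^ i) x (uncoloured c) ⟩
    x * (z ^ i * uncoloured c)       ≤⟨ *-monoʳ-≤ x h ⟩
    x * (x ^ i * n)                  ≡⟨ sym (*-assoc x (x ^ i) n) ⟩
    x * x ^ i * n                    ∎)
    where
    open ≤-Reasoning
    prev = sampled-phase i (<⇒≤ i<R)
    c = proj₁ prev
    h = proj₂ (proj₂ prev)
    next = sampled-step (1 + 2 * i) i c (proj₁ (proj₂ prev)) i<R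
    c′ = proj₁ next
    at′ = proj₁ (proj₂ next)
    h′ = proj₂ (proj₂ next)
    l₁ : ∀ i → 1 + 2 * i + 2 ≡ 1 + 2 * suc i
    l₁ = solve-∀
    l₂ : ∀ a b c → a * b * c ≡ b * (a * c)
    l₂ = solve-∀
    l₃ : ∀ a b c → a * (b * c) ≡ b * (a * c)
    l₃ = solve-∀

  -- With `z = x + 1` this is `(1 + 1/x)^z ≥ 1 + z/x ≥ 2`.
  halving : 2 * x ^ z ≤ z ^ z
  halving = *-cancelʳ-≤ _ _ x (begin
    2 * x ^ z * x          ≡⟨ l₁ (x ^ z) x ⟩
    x ^ z * (x + x)        ≤⟨ *-monoʳ-≤ (x ^ z) (+-monoʳ-≤ x (≤-trans (n≤1+n x) (≤-reflexive (sym z≡)))) ⟩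
    x ^ z * (x + z)        ≤⟨ bernoulli x z ⟩
    suc x ^ z * x          ≡⟨ cong (λ y → y ^ z * x) (sym z≡) ⟩
    z ^ z * x              ∎)
    where
    open ≤-Reasoning
    l₁ : ∀ p x → 2 * p * x ≡ p * (x + x)
    l₁ = solve-∀

  after-sampling : Reached (1 + 2 * R) R (4 * t)
  after-sampling = c , proj₁ (proj₂ phase) , *-cancelˡ-≤ (x ^ R) {{m^n≢0 x R}} (begin
    x ^ R * (u * 2 ^ (4 * t))                ≡⟨ cong (λ y → y * (u * 2 ^ (4 * t))) (sym (^-*-assoc x z (4 * t))) ⟩
    (x ^ z) ^ (4 * t) * (u * 2 ^ (4 * t))    ≡⟨ l₁ ((x ^ z) ^ (4 * t)) u (2 ^ (4 * t)) ⟩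
    2 ^ (4 * t) * (x ^ z) ^ (4 * t) * u      ≡⟨ cong (_* u) (sym (*-^ 2 (x ^ z) (4 * t))) ⟩
    (2 * x ^ z) ^ (4 * t) * u                ≤⟨ *-monoˡ-≤ u (^-monoˡ-≤ (4 * t) halving) ⟩
    (z ^ z) ^ (4 * t) * u                    ≡⟨ cong (_* u) (^-*-assoc z z (4 * t)) ⟩
    z ^ R * u                                ≤⟨ h ⟩
    x ^ R * n                                ∎)
    where
    open ≤-Reasoning
    phase = sampled-phase R ≤-refl
    c = proj₁ phase
    h = proj₂ (proj₂ phase)
    u = uncoloured c
    l₁ : ∀ a b c → a * (b * c) ≡ c * a * b
    l₁ = solve-∀

  -- The sketched phase

  e : ℕ → ℕ
  e j = 2 ^ j * t

  0<e : ∀ j → 0 < e j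
  0<e j = *-mono-≤ (m^n>0 2 j) 0<t

  deep : ℕ → ℕ
  deep j = Sketching.D (e j) (0<e j)

  price : ℕ → ℕ
  price j = 2 * suc (deep j)

  spec-block : ∀ j i → i < 4 → spec Δ (R + (j * 4 + i)) ≡ sketchedSpec Δ (e j)
  spec-block j i i<4 = trans (spec-sketched (R + (j * 4 + i)) (m≤m+n R _))
    (cong (λ y → sketchedSpec Δ (2 ^ y * t)) (trans (cong (_/ 4) (m+n∸m≡n R (j * 4 + i))) (÷-digit j 4 i i<4)))

  -- Of the four rounds `i` are over and `k` remain. Each adds `e j` to the exponent, so `4 e`
  -- becomes `8 e`, the starting point for the doubled exponent. An empty uncoloured set ends the
  -- run early, since `buffer` needs a positive size.
  four : ∀ j k i → i + k ≡ 4 → ∀ p c → At p (R + (j * 4 + i)) c → uncoloured c * 2 ^ (4 * e j + i * e j) ≤ n →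
         Done (p + k * price j) ⊎ Reached (p + k * price j) (R + (j * 4 + 4)) (4 * e j + 4 * e j)
  four j zero    i i≡4 p c at fit = inj₂ (c , subst₂ (λ p i → At p (R + (j * 4 + i)) c) (sym (+-identityʳ p)) i≡ at ,
                                              subst (λ i → uncoloured c * 2 ^ (4 * e j + i * e j) ≤ n) i≡ fit)
    where i≡ : i ≡ 4
          i≡ = trans (sym (+-identityʳ i)) i≡4
  four j (suc k) i i+k p c at fit = cases (uncoloured c ≟ℕ 0)
   where
   cases : Dec (uncoloured c ≡ 0) → Done (p + suc k * price j) ⊎ Reached (p + suc k * price j) (R + (j * 4 + 4)) (4 * e j + 4 * e j)
   cases (yes u≡0) = inj₁ (done-mono (m≤m+n p _) (at-done p (R + (j * 4 + i)) c at u≡0))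
   cases (no u≢0) = subst (λ p → Done p ⊎ Reached p (R + (j * 4 + 4)) (4 * e j + 4 * e j)) (+-assoc p (price j) (k * price j))
      (four j k (suc i) (trans (sym (+-suc i k)) i+k) (p + price j) c′ (subst (λ r → At (p + price j) r c′) (l₁ R (j * 4) i) (proj₁ (proj₂ st))) fit′)
    where
    open ≤-Reasoning
    i<4 : i < 4
    i<4 = subst (i <_) i+k (m<m+n i (s≤s z≤n))
    u = uncoloured c
    le : u * 2 ^ (4 * e j) ≤ n
    le = ≤-trans (*-monoʳ-≤ u (^-monoʳ-≤ 2 (m≤m+n (4 * e j) (i * e j)))) fit
    st = SketchedStep.shrink-step (e j) (0<e j) p (R + (j * 4 + i)) c at (spec-block j i i<4) (n≢0⇒n>0 u≢0) le
    c′ = proj₁ st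
    l₁ : ∀ a b i → suc (a + (b + i)) ≡ a + (b + suc i)
    l₁ = solve-∀
    l₂ : ∀ a i e → a + suc i * e ≡ e + (a + i * e)
    l₂ = solve-∀
    l₃ : ∀ u q y → u * (q * y) ≡ q * u * y
    l₃ = solve-∀
    fit′ : uncoloured c′ * 2 ^ (4 * e j + suc i * e j) ≤ n
    fit′ = begin
      uncoloured c′ * 2 ^ (4 * e j + suc i * e j)                 ≡⟨ cong (λ y → uncoloured c′ * 2 ^ y) (l₂ (4 * e j) i (e j)) ⟩
      uncoloured c′ * 2 ^ (e j + (4 * e j + i * e j))             ≡⟨ cong (uncoloured c′ *_) (^-distribˡ-+-* 2 (e j) (4 * e j + i * e j)) ⟩
      uncoloured c′ * (2 ^ e j * 2 ^ (4 * e j + i * e j))         ≡⟨ l₃ (uncoloured c′) (2 ^ e j) _ ⟩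
      2 ^ e j * uncoloured c′ * 2 ^ (4 * e j + i * e j)           ≤⟨ *-monoˡ-≤ _ (proj₂ (proj₂ st)) ⟩
      u * 2 ^ (4 * e j + i * e j)                                 ≤⟨ fit ⟩
      n                                                           ∎

  total : ℕ → ℕ
  total zero    = 1 + 2 * R
  total (suc j) = total j + 4 * price j

  sketched-phase : ∀ j → Done (total j) ⊎ Reached (total j) (R + j * 4) (4 * e j)
  sketched-phase zero = inj₂ (c , subst (λ r → At (1 + 2 * R) r c) (sym (+-identityʳ R)) at , subst (λ y → uncoloured c * 2 ^ (4 * y) ≤ n) (sym (+-identityʳ t)) h)
    where c  = proj₁ after-sampling
          at = proj₁ (proj₂ after-sampling)
          h  = proj₂ (proj₂ after-sampling)
  sketched-phase (suc j) = cases (sketched-phase j)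
    where
    l : ∀ y t → 4 * (y * t) + 4 * (y * t) ≡ 4 * (2 * y * t)
    l = solve-∀
    Next : Set
    Next = Done (total (suc j)) ⊎ Reached (total (suc j)) (R + suc j * 4) (4 * e (suc j))
    after : Done (total (suc j)) ⊎ Reached (total (suc j)) (R + (j * 4 + 4)) (4 * e j + 4 * e j) → Next
    after (inj₁ dn)              = inj₁ dn
    after (inj₂ (c′ , at′ , h′)) = inj₂ (c′ , subst (λ y → At (total (suc j)) (R + y) c′) (+-comm (j * 4) 4) at′ , subst (λ y → uncoloured c′ * 2 ^ y ≤ n) (l (2 ^ j) t) h′)
    cases : Done (total j) ⊎ Reached (total j) (R + j * 4) (4 * e j) → Next
    cases (inj₁ dn)           = inj₁ (done-mono (m≤m+n (total j) _) dn)
    cases (inj₂ (c , at , h)) = after (four j 4 0 refl (total j) c (subst (λ y → At (total j) (R + y) c) (sym (+-identityʳ (j * 4))) at) (subst (λ y → uncoloured c * 2 ^ y ≤ n) (sym (+-identityʳ (4 * e j))) h))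

  -- After `t` doublings the exponent `2^t t` is at least `t²`, hence at least `log Δ`. So
  -- `uncoloured * Δ ≤ n`, and the last round can be lossless.
  Δ≤2^ : Δ ≤ 2 ^ (4 * e t)
  Δ≤2^ = ≤-trans (<⇒≤ (n<2^[1+log] Δ)) (^-monoʳ-≤ 2 (begin
    suc ⌊log₂ Δ ⌋          ≤⟨ s≤s log≤t² ⟩
    1 + t * t              ≤⟨ +-monoˡ-≤ (t * t) (*-mono-≤ 0<t 0<t) ⟩
    t * t + t * t          ≤⟨ m≤m+n _ (2 * (t * t)) ⟩
    t * t + t * t + 2 * (t * t) ≡⟨ l (t * t) ⟩
    4 * (t * t)            ≤⟨ *-monoʳ-≤ 4 (*-monoˡ-≤ t (<⇒≤ (n<2^n t))) ⟩
    4 * (2 ^ t * t)        ∎))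
    where
    open ≤-Reasoning
    l : ∀ y → y + y + 2 * y ≡ 4 * y
    l = solve-∀

  n<N : n < N
  n<N = m≤n*m (suc n) (2 * c₀ * (2 * c₀) * ((7 + b) * ℓ)) {{>-nonZero (*-mono-≤ {1} {2 * c₀ * (2 * c₀)} {1} (*-mono-≤ {1} {2 * c₀} {1} 0<2c 0<2c) (*-mono-≤ {1} {7 + b} {1} (s≤s z≤n) 0<ℓ))}}
    where 0<2c : 0 < 2 * c₀
          0<2c = ≤-trans 0<c₀ (m≤m+n c₀ (c₀ + 0))

  finishes : Done (total t + price t)
  finishes = cases (sketched-phase t)
    where
    cases : Done (total t) ⊎ Reached (total t) (R + t * 4) (4 * e t) → Done (total t + price t)
    cases (inj₁ dn)           = done-mono (m≤m+n (total t) _) dn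
    cases (inj₂ (c , at , h)) = at-done (total t + price t) (suc (R + (t * 4 + 0))) (proj₁ st) (proj₁ (proj₂ st)) (proj₂ (proj₂ st))
      where
      st = SketchedStep.final-step (e t) (0<e t) (total t) (R + (t * 4 + 0)) c (subst (λ y → At (total t) (R + y) c) (sym (+-identityʳ (t * 4))) at)
             (spec-block t 0 (s≤s z≤n)) (≤-<-trans (≤-trans (*-monoʳ-≤ (uncoloured c) Δ≤2^) h) n<N)

  -- A depth `D` at exponent `2^j t` satisfies `2^j t D ≤ log Δ ≤ t²`; one factor `t` cancels.
  2^j*deep≤t : ∀ j → 2 ^ j * deep j ≤ t
  2^j*deep≤t j = *-cancelʳ-≤ _ _ t {{>-nonZero 0<t}} (≤-trans (≤-reflexive (l (2 ^ j) (deep j) t)) (≤-trans (Sketching.sD≤log (e j) (0<e j)) log≤t²))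
    where l : ∀ y d t → y * d * t ≡ y * t * d
          l = solve-∀

  depths : ℕ → ℕ
  depths zero    = 0
  depths (suc j) = depths j + deep j

  -- The geometric sum in the form `depths j ≤ 2 t (1 - 2^(-j))`, strong enough for induction.
  depths-geometric : ∀ j → 2 ^ j * depths j + 2 * t ≤ 2 * t * 2 ^ j
  depths-geometric zero    = ≤-reflexive (l t)
    where l : ∀ t → 1 * 0 + 2 * t ≡ 2 * t * 1
          l = solve-∀
  depths-geometric (suc j) = begin
    2 * 2 ^ j * (depths j + deep j) + 2 * t                   ≡⟨ l₁ (2 ^ j) (depths j) (deep j) t ⟩
    2 * (2 ^ j * depths j) + 2 * (2 ^ j * deep j) + 2 * t     ≤⟨ +-monoˡ-≤ (2 * t) (+-monoʳ-≤ (2 * (2 ^ j * depths j)) (*-monoʳ-≤ 2 (2^j*deep≤t j))) ⟩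
    2 * (2 ^ j * depths j) + 2 * t + 2 * t                    ≡⟨ l₂ (2 ^ j * depths j) t ⟩
    2 * (2 ^ j * depths j + 2 * t)                            ≤⟨ *-monoʳ-≤ 2 (depths-geometric j) ⟩
    2 * (2 * t * 2 ^ j)                                       ≡⟨ l₃ t (2 ^ j) ⟩
    2 * t * (2 * 2 ^ j)                                       ∎
    where
    open ≤-Reasoning
    l₁ : ∀ y s d t → 2 * y * (s + d) + 2 * t ≡ 2 * (y * s) + 2 * (y * d) + 2 * t
    l₁ = solve-∀
    l₂ : ∀ s t → 2 * s + 2 * t + 2 * t ≡ 2 * (s + 2 * t)
    l₂ = solve-∀
    l₃ : ∀ t y → 2 * (2 * t * y) ≡ 2 * t * (2 * y)
    l₃ = solve-∀

  depths≤2t : ∀ j → depths j ≤ 2 * t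
  depths≤2t j = *-cancelˡ-≤ (2 ^ j) {{m^n≢0 2 j}} (≤-trans (m≤m+n _ (2 * t)) (≤-trans (depths-geometric j) (≤-reflexive (*-comm (2 * t) (2 ^ j)))))

  total≡ : ∀ j → total j ≡ 1 + 2 * R + 8 * (j + depths j)
  total≡ zero    = sym (+-identityʳ _)
  total≡ (suc j) = trans (cong (_+ 4 * price j) (total≡ j)) (l (1 + 2 * R) j (depths j) (deep j))
    where l : ∀ r j s d → r + 8 * (j + s) + 4 * (2 * suc d) ≡ r + 8 * (suc j + (s + d))
          l = solve-∀

  -- One pass finds the degrees and `2 R` belong to sampled rounds. The four rounds for each of `t`
  -- exponents take `8 (t + 2 t)`, as a round takes `2 (D + 1)` passes and the depths sum to at most
  -- `2 t`. The lossless round takes at most `2 (t + 1)`.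
  passes : ℕ
  passes = 2 * R + 26 * t + 3

  total≤ : total t + price t ≤ passes
  total≤ = begin
    total t + price t                                  ≡⟨ cong (_+ price t) (total≡ t) ⟩
    1 + 2 * R + 8 * (t + depths t) + 2 * suc (deep t) ≤⟨ +-mono-≤ (+-monoʳ-≤ (1 + 2 * R) (*-monoʳ-≤ 8 (+-monoʳ-≤ t (depths≤2t t)))) (*-monoʳ-≤ 2 (s≤s deep≤t)) ⟩
    1 + 2 * R + 8 * (t + 2 * t) + 2 * suc t           ≡⟨ l R t ⟩
    passes                                            ∎
    where
    open ≤-Reasoning
    l : ∀ R t → 1 + 2 * R + 8 * (t + 2 * t) + 2 * suc t ≡ 2 * R + 26 * t + 3
    l = solve-∀
    deep≤t : deep t ≤ t
    deep≤t = ≤-trans (m≤n*m (deep t) (2 ^ t) {{m^n≢0 2 t}}) (2^j*deep≤t t)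

  -- `r` stands for any upper bound of the square root. Since `z a ≤ 8 b`, the sampled rounds
  -- contribute `64 b t` and the sketched ones `26 b t`, which together give the 90.
  passes-bound : ∀ p r → p ≤ passes → ⌊log₂ Δ ⌋ ≤ r * r → p * a ≤ 90 * (b * r + a)
  passes-bound p r p≤ log≤ = begin
    p * a                                              ≤⟨ *-monoˡ-≤ a p≤ ⟩
    (2 * (z * (4 * t)) + 26 * t + 3) * a               ≡⟨ l₁ z t a ⟩
    8 * t * (z * a) + 26 * t * a + 3 * a               ≤⟨ +-monoˡ-≤ (3 * a) (+-mono-≤ (*-monoʳ-≤ (8 * t) za≤8b) (*-monoʳ-≤ (26 * t) (<⇒≤ a<b))) ⟩
    8 * t * (8 * b) + 26 * t * b + 3 * a               ≡⟨ l₂ t b a ⟩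
    90 * (b * t) + 3 * a                               ≤⟨ +-mono-≤ (*-monoʳ-≤ 90 (*-monoʳ-≤ b (⌈√⌉-least ⌊log₂ Δ ⌋ r log≤))) (*-monoˡ-≤ a (s≤s (s≤s (s≤s (z≤n {87}))))) ⟩
    90 * (b * r) + 90 * a                              ≡⟨ sym (*-distribˡ-+ 90 (b * r) a) ⟩
    90 * (b * r + a)                                   ∎
    where
    open ≤-Reasoning
    l₁ : ∀ z t a → (2 * (z * (4 * t)) + 26 * t + 3) * a ≡ 8 * t * (z * a) + 26 * t * a + 3 * a
    l₁ = solve-∀
    l₂ : ∀ t b a → 8 * t * (8 * b) + 26 * t * b + 3 * a ≡ 90 * (b * t) + 3 * a
    l₂ = solve-∀

-- Space

-- The classes polylog(n) and n polylog(n); their closure properties replace an explicit computation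
-- of the space bound.
Small Big : (ℕ → ℕ) → Set
Small f = Σ ℕ λ c → Σ ℕ λ k → ∀ n → f n ≤ c * bitLength n ^ k
Big f   = Σ ℕ λ c → Σ ℕ λ k → ∀ n → f n ≤ c * (suc n * bitLength n ^ k)

pow-mono : ∀ n {k k′} → k ≤ k′ → bitLength n ^ k ≤ bitLength n ^ k′
pow-mono n = ^-monoʳ-≤ (bitLength n)

small-const : ∀ c → Small (λ _ → c)
small-const c = c , 0 , λ n → ≤-reflexive (sym (*-identityʳ c))

small-bitLength : Small bitLength
small-bitLength = 1 , 1 , λ n → ≤-reflexive (sym (trans (*-identityˡ _) (*-identityʳ _)))

small-+ : ∀ {f g} → Small f → Small g → Small (λ n → f n + g n)
small-+ (c , k , h) (c′ , k′ , h′) = c + c′ , k + k′ , λ n → ≤-trans (+-mono-≤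
  (≤-trans (h n) (*-monoʳ-≤ c (pow-mono n (m≤m+n k k′)))) (≤-trans (h′ n) (*-monoʳ-≤ c′ (pow-mono n (m≤n+m k′ k))))) (≤-reflexive (sym (*-distribʳ-+ (bitLength n ^ (k + k′)) c c′)))

small-* : ∀ {f g} → Small f → Small g → Small (λ n → f n * g n)
small-* (c , k , h) (c′ , k′ , h′) = c * c′ , k + k′ , λ n → ≤-trans (*-mono-≤ (h n) (h′ n))
  (≤-reflexive (trans (l c (bitLength n ^ k) c′ (bitLength n ^ k′)) (cong (c * c′ *_) (sym (^-distribˡ-+-* (bitLength n) k k′)))))
  where l : ∀ a b c d → a * b * (c * d) ≡ a * c * (b * d)
        l = solve-∀

big-suc : Big suc
big-suc = 1 , 0 , λ n → ≤-reflexive (sym (trans (*-identityˡ _) (*-identityʳ _)))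

big-mono : ∀ {f g} → (∀ n → f n ≤ g n) → Big g → Big f
big-mono le (c , k , h) = c , k , λ n → ≤-trans (le n) (h n)

big-n : Big (λ n → n)
big-n = big-mono n≤1+n big-suc

small⇒big : ∀ {f} → Small f → Big f
small⇒big (c , k , h) = c , k , λ n → ≤-trans (h n) (*-monoʳ-≤ c (m≤n*m (bitLength n ^ k) (suc n)))

big-+ : ∀ {f g} → Big f → Big g → Big (λ n → f n + g n)
big-+ (c , k , h) (c′ , k′ , h′) = c + c′ , k + k′ , λ n → ≤-trans (+-mono-≤
  (≤-trans (h n) (*-monoʳ-≤ c (*-monoʳ-≤ (suc n) (pow-mono n (m≤m+n k k′))))) (≤-trans (h′ n) (*-monoʳ-≤ c′ (*-monoʳ-≤ (suc n) (pow-mono n (m≤n+m k′ k))))))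
  (≤-reflexive (sym (*-distribʳ-+ (suc n * bitLength n ^ (k + k′)) c c′)))

small-*-big : ∀ {f g} → Small f → Big g → Big (λ n → f n * g n)
small-*-big (c , k , h) (c′ , k′ , h′) = c * c′ , k + k′ , λ n → ≤-trans (*-mono-≤ (h n) (h′ n))
  (≤-reflexive (trans (l c (bitLength n ^ k) c′ (suc n) (bitLength n ^ k′)) (cong (λ x → c * c′ * (suc n * x)) (sym (^-distribˡ-+-* (bitLength n) k k′)))))
  where l : ∀ a b c s d → a * b * (c * (s * d)) ≡ a * c * (s * (b * d))
        l = solve-∀

big-*-small : ∀ {f g} → Big f → Small g → Big (λ n → f n * g n)
big-*-small {f} {g} F G = big-mono (λ n → ≤-reflexive (*-comm (f n) (g n))) (small-*-big G F)

module Space (a b : ℕ) (0<a : 0 < a) (a<b : a < b) where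

  module P (n : ℕ) = Parameters a b n 0<a a<b

  -- The value is the same for every `n`, so any argument may be taken.
  z : ℕ
  z = P.z 0

  -- `2 * bitLength n` bits hold every counter, as these stay below `n² + 1`, and every colour. The
  -- remaining summand bounds the number of passes, so that the round number lies below `2^width`.
  width : ℕ → ℕ
  width n = 2 * bitLength n + (8 * (z * bitLength n) + 26 * bitLength n + 3)

  memorySize workSize space : ℕ → ℕ
  memorySize n = width n + (width n + (width n + (2 + (n * suc (width n) + (n * suc (width n) + n * width n)))))
  workSize n   = n * width n + (suc (P.mb n) * width n + P.L n * (P.N n * suc (width n + width n)))
  space n      = memorySize n + workSize n

  small-width : Small width
  small-width = small-+ (small-* (small-const 2) small-bitLength)
    (small-+ (small-+ (small-* (small-const 8) (small-* (small-const z) small-bitLength)) (small-* (small-const 26) small-bitLength)) (small-const 3))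

  small-c₀ : Small P.c₀
  small-c₀ = small-* (small-const (150 * (b * b))) (small-* (small-* small-bitLength small-bitLength) small-bitLength)

  big-N : Big P.N
  big-N = small-*-big (small-* (small-* (small-* (small-const 2) small-c₀) (small-* (small-const 2) small-c₀)) (small-* (small-const (7 + b)) small-bitLength)) big-suc

  big-mb : Big P.mb
  big-mb = small-*-big (small-const (2 * z)) (big-*-small (small-*-big (small-const 2) big-n)
    (small-+ (small-const (1 + 2 * z)) (small-* (small-const (2 * (2 * z))) (small-+ (small-const 2) (small-* (small-const 2) small-bitLength)))))

  big-space′ : Big space
  big-space′ = big-+
    (big-+ w (big-+ w (big-+ w (big-+ (small⇒big (small-const 2)) (big-+ nw⁺ (big-+ nw⁺ nw))))))
    (big-+ nw (big-+ (big-*-small (big-+ (small⇒big (small-const 1)) big-mb) small-width)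
      (small-*-big (small-* (small-const 2) small-bitLength) (big-*-small big-N (small-+ (small-const 1) (small-+ small-width small-width))))))
    where
    w   = small⇒big small-width
    nw  = big-*-small big-n small-width
    nw⁺ = big-*-small big-n (small-+ (small-const 1) small-width)

  abstract
    big-space : Big space
    big-space = big-space′

-- Encoding of the memory

modeCode : Mode → ℕ
modeCode degrees = 0
modeCode choose  = 1
modeCode filter  = 2

codeMode : ℕ → Maybe Mode
codeMode 0 = just degrees
codeMode 1 = just choose
codeMode 2 = just filter
codeMode _ = nothing

modeC : Code Mode (λ _ → ⊤) 2
modeC = retractC modeCode codeMode (λ { degrees _ → refl ; choose _ → refl ; filter _ → refl })
  (λ { degrees _ → s≤s z≤n ; choose _ → s≤s (s≤s z≤n) ; filter _ → s≤s (s≤s (s≤s z≤n)) }) (natC 2)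

module Encoding (n L N mb ω : ℕ) (n≤2^ω : n ≤ 2 ^ ω) where

  Fits : ℕ → Set
  Fits x = x < 2 ^ ω

  record ValidMemory (m : Memory n) : Set where
    field
      maxdeg-fits : Fits (maxdeg m)
      round-fits  : Fits (round m)
      level-fits  : Fits (level m)
      col-fits    : VAll.All (MaybeAll Fits) (col m)
      blk-fits    : VAll.All (MaybeAll Fits) (blk m)
      cand-fits   : VAll.All Fits (cand m)
  open ValidMemory public

  record ValidWorking (w : Working n L mb) : Set where
    field
      load-fits   : VAll.All Fits (load w)
      cost-fits   : VAll.All Fits (cost w)
      sketch-fits : VAll.All (λ xs → length xs < N) (sketch w)
  open ValidWorking public

  memoryC : Code (Memory n) ValidMemory (ω + (ω + (ω + (2 + (n * suc ω + (n * suc ω + n * ω))))))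
  memoryC = retractC (λ m → maxdeg m , round m , level m , mode m , col m , blk m , cand m)
    (λ { (d , r , l , mo , c , bl , ca) → just (mem d r l mo c bl ca) }) (λ m _ → refl)
    (λ m v → maxdeg-fits v , round-fits v , level-fits v , tt , col-fits v , blk-fits v , cand-fits v)
    (pairC (natC ω) (pairC (natC ω) (pairC (natC ω) (pairC modeC (pairC (vecC (maybeC (natC ω)) n) (pairC (vecC (maybeC (natC ω)) n) (vecC (natC ω) n)))))))

  edgeC : Code (Edge n) ((λ _ → ⊤) ⊗ (λ _ → ⊤)) (ω + ω)
  edgeC = pairC (finC n ω n≤2^ω) (finC n ω n≤2^ω)

  workingC : Code (Working n L mb) ValidWorking (n * ω + (suc mb * ω + L * (N * suc (ω + ω))))
  workingC = retractC (λ w → load w , cost w , sketch w) (λ { (l , c , sk) → just (working l c sk) }) (λ w _ → refl)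
    (λ w v → load-fits v , cost-fits v , VAll.map (λ {xs} lt → <⇒≤ lt , LAll.universal (λ _ → tt , tt) xs) (sketch-fits v))
    (pairC (vecC (natC ω) n) (pairC (vecC (natC ω) (suc mb)) (vecC (listC edgeC N) L)))

-- The machine as a streaming algorithm on bit strings

module Final (a b : ℕ) (0<a : 0 < a) (a<b : a < b) (n : ℕ) where

  open Space a b 0<a a<b using (width; space)
  open Parameters a b n 0<a a<b using (ℓ; L; N; mb; spec; n<2^ℓ)

  ω : ℕ
  ω = width n

  2ℓ≤ω : 2 * ℓ ≤ ω
  2ℓ≤ω = m≤m+n (2 * ℓ) _

  fits : ∀ {x} → x < 2 ^ (2 * ℓ) → x < 2 ^ ω
  fits lt = <-≤-trans lt (^-monoʳ-≤ 2 2ℓ≤ω)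

  ℓ≤2ℓ : ℓ ≤ 2 * ℓ
  ℓ≤2ℓ = m≤m+n ℓ (ℓ + 0)

  n≤2^ω : n ≤ 2 ^ ω
  n≤2^ω = <⇒≤ (fits (<-≤-trans n<2^ℓ (^-monoʳ-≤ 2 ℓ≤2ℓ)))

  open Encoding n L N mb ω n≤2^ω

  open Algorithm n L N mb spec using (machine; run-load; run-cost; run-sketch; counted; charge; rel; halve)

  code : Code (Memory n × Working n L mb) (ValidMemory ⊗ ValidWorking) (space n)
  code = pairC memoryC workingC

  module Sim = Simulation machine code

  module Run (s : List (Edge n)) (simple : SimpleStream s) (b≤aΔ : b ≤ a * maxDeg s) where

    open Schedule a b n 0<a a<b s simple b≤aΔ hiding (ℓ; L; N; mb; spec; n<2^ℓ; machine; run-load; run-cost; run-sketch; counted; charge; rel; halve)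

    inc≤2 : ∀ v (e : Edge n) → inc v e ≤ 2
    inc≤2 v e = +-mono-≤ (⟦⟧≤1 (v == proj₁ e)) (⟦⟧≤1 (v == proj₂ e))

    -- An edge adds at most 2 to a counter, and `2 |s| ≤ n²` in a simple stream.
    counter-fits : ∀ xs ys → xs ++ ys ≡ s → (f : Edge n → ℕ) → (∀ e → f e ≤ 2) → Fits (∑ xs f)
    counter-fits xs ys eq f h = fits (≤-<-trans (begin
      ∑ xs f                ≤⟨ ∑-mono xs h ⟩
      ∑ xs (λ _ → 2)        ≡⟨ trans (∑-const xs 2) (*-comm (length xs) 2) ⟩
      2 * length xs         ≤⟨ *-monoʳ-≤ 2 (≤-trans (m≤m+n (length xs) (length ys)) (≤-reflexive (trans (sym (length-++ xs)) (cong length eq)))) ⟩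
      2 * length s          ≤⟨ 2*length≤n² ⟩
      n * n                 ∎) n²<2^L)
      where open ≤-Reasoning

    replicate-short : ∀ j → VAll.All (λ xs → length xs < N) (replicate {A = List (Edge n)} j [])
    replicate-short zero    = VAll.[]
    replicate-short (suc j) = ≤-<-trans z≤n n<N VAll.∷ replicate-short j

    valid-working : ∀ m xs ys → ValidMemory m → xs ++ ys ≡ s → ValidWorking (Sim.run m xs)
    valid-working m xs ys _ eq = record
      { load-fits   = VAllP.lookup⁻ (λ v → subst Fits (sym (run-load m xs v)) (counter-fits xs ys eq _
                        (λ e → *-mono-≤ (inc≤2 v e) (⟦⟧≤1 (counted m e)))))
      ; cost-fits   = VAllP.lookup⁻ (λ i → subst Fits (sym (run-cost m xs i)) (counter-fits xs ys eq (charge m i)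
                        (λ e → *-mono-≤ (+-mono-≤ (⟦⟧≤1 (active m (proj₁ e))) (⟦⟧≤1 (active m (proj₂ e)))) (⟦⟧≤1 (rel m e ∧ mono (placement m (sample m i)) e)))))
      ; sketch-fits = subst (VAll.All (λ xs → length xs < N)) (sym (run-sketch m xs))
                        (Sketch.sketchFrom-short (halve m) N (rel m) xs (replicate L []) (≤-<-trans z≤n n<N) (replicate-short L))
      }

    iterate≡ : ∀ p m → Sim.iterate s p m ≡ iter p m
    iterate≡ zero    m = refl
    iterate≡ (suc p) m = iterate≡ p (pass s m)

    memory≡ : ∀ p → Sim.memory s p ≡ iter p start
    memory≡ p = trans (Sim.memory-iterate s p) (iterate≡ p start)

    C-fits : ∀ {x} → x < C → Fits x
    C-fits lt = fits (<-trans lt (begin-strict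
      C               ≤⟨ C≤2n ⟩
      2 * n           <⟨ *-monoʳ-< 2 n<2^ℓ ⟩
      2 ^ suc ℓ       ≤⟨ ^-monoʳ-≤ 2 (+-mono-≤ 0<ℓ (≤-reflexive (sym (+-identityʳ ℓ)))) ⟩
      2 ^ (2 * ℓ)     ∎))
      where open ≤-Reasoning

    passes-fit : ∀ {x} → x ≤ passes → Fits x
    passes-fit {x} le = ≤-<-trans le (<-≤-trans (n<2^n passes) (^-monoʳ-≤ 2 (≤-trans bound (m≤n+m _ (2 * ℓ)))))
      where
      open ≤-Reasoning
      l : ∀ z t → 2 * (z * (4 * t)) ≡ 8 * (z * t)
      l = solve-∀
      bound : passes ≤ 8 * (z * ℓ) + 26 * ℓ + 3
      bound = +-monoˡ-≤ 3 (+-mono-≤ (≤-trans (≤-reflexive (l z t)) (*-monoʳ-≤ 8 (*-monoʳ-≤ z t≤ℓ))) (*-monoʳ-≤ 26 t≤ℓ))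

    depth-fits : ∀ r → Fits (depth (spec Δ r))
    depth-fits r = cases (sampledRounds Δ ≤? r)
      where
      cases : Dec (sampledRounds Δ ≤ r) → Fits (depth (spec Δ r))
      cases (no ≰)  = subst (λ σ → Fits (depth σ)) (sym (spec-sampled r (≰⇒> ≰))) (m^n>0 2 ω)
      cases (yes ≤) = subst (λ σ → Fits (depth σ)) (sym (spec-sketched r ≤))
        (fits (<-≤-trans (<-trans (≤-trans (n≤1+n _) (Sketching.D+2≤ℓ (exponent Δ r) (0<exponent r))) (n<2^n ℓ)) (^-monoʳ-≤ 2 ℓ≤2ℓ)))

    maybe-fits : ∀ (v : Vec (Maybe ℕ) n) → (∀ i {y} → lookup v i ≡ just y → Fits y) → VAll.All (MaybeAll Fits) v
    maybe-fits v h = VAllP.lookup⁻ (λ i → pt (lookup v i) (h i))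
      where
      pt : ∀ x → (∀ {y} → x ≡ just y → Fits y) → MaybeAll Fits x
      pt nothing  h = none
      pt (just y) h = some (h refl)

    blk-fits′ : ∀ {m} → Invariant m → ∀ v {B} → lookup (blk m) v ≡ just B → Fits B
    blk-fits′ {m} inv v {B} e = C-fits (≤-trans (≤-trans (m≤m*n (suc B) (k⁺ m) {{>-nonZero (0<K (ok inv) (suc (level m)))}}) (inside inv v e)) (size≤C (ok inv)))

    cand-fits′ : ∀ m → Invariant m → Candidate m → ∀ v → Fits (lookup (cand m) v)
    cand-fits′ m inv cok v = cases (lookup (blk m) v) (lookup (col m) v) refl refl
      where
      cases : ∀ B y → lookup (blk m) v ≡ B → lookup (col m) v ≡ y → Fits (lookup (cand m) v)
      cases (just B) y eB _ = C-fits (≤-trans (≤-trans (m≤m*n _ (k m) {{>-nonZero (0<K (ok inv) (level m))}})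
        (Step.child-inside m inv cok (λ _ → true) v (cong (λ B → keep B true (lookup (cand m) v)) eB))) (size≤C (ok inv)))
      cases nothing (just y) eB ey = C-fits (≤-<-trans (≤-trans (≤-reflexive (fixed cok v eB ey)) (÷≤ y (k m))) (bounded inv v ey))
        where ÷≤ : ∀ y k → y ÷ k ≤ y
              ÷≤ y zero    = z≤n
              ÷≤ y (suc k) = m/n≤m y (suc k)
      cases nothing nothing eB ey = subst Fits (sym (idle cok v eB ey)) (m^n>0 2 ω)

    Δ-fits : Fits Δ
    Δ-fits = C-fits (m<m+n Δ 0<w)

    zeros-fit : VAll.All Fits (replicate n 0)
    zeros-fit = VAllP.lookup⁻ (λ i → subst Fits (sym (lookup-replicate i 0)) (m^n>0 2 ω))

    good-valid : ∀ {m} → Good m → Fits (round m) → ValidMemory m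
    good-valid initial rf = record { maxdeg-fits = m^n>0 2 ω ; round-fits = rf ; level-fits = m^n>0 2 ω
      ; col-fits = maybe-fits blank (λ i e → blank-lookup i e) ; blk-fits = maybe-fits blank (λ i e → blank-lookup i e) ; cand-fits = zeros-fit }
    good-valid (choosing r j c bl inv j≤) rf = record { maxdeg-fits = Δ-fits ; round-fits = rf ; level-fits = ≤-<-trans j≤ (depth-fits r)
      ; col-fits = maybe-fits c (λ i e → C-fits (bounded inv i e)) ; blk-fits = maybe-fits bl (blk-fits′ inv) ; cand-fits = zeros-fit }
    good-valid (filtering r j c bl ca inv cok j≤) rf = record { maxdeg-fits = Δ-fits ; round-fits = rf ; level-fits = ≤-<-trans j≤ (depth-fits r)
      ; col-fits = maybe-fits c (λ i e → C-fits (bounded inv i e)) ; blk-fits = maybe-fits bl (blk-fits′ inv) ; cand-fits = VAllP.lookup⁻ (cand-fits′ (mem Δ r j filter c bl ca) inv cok) }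

    abstract
      -- The colouring may be complete before the scheduled end; the halting time is the first pass
      -- after which it is.
      halting : Σ ℕ λ p → p ≤ passes × done (iter p start) ≡ true × (∀ q → q < p → done (iter q start) ≡ false)
      halting = let (p , p≤ , dn , below) = least (λ p → done (iter p start)) (proj₁ finishes) (proj₂ (proj₂ finishes)) in
                p , ≤-trans p≤ (≤-trans (proj₁ (proj₂ finishes)) total≤) , dn , below

    valid-memory : ∀ q → q ≤ passes → ValidMemory (Sim.memory s q)
    valid-memory q q≤ = subst ValidMemory (sym (memory≡ q)) (good-valid (good-iter q) (passes-fit (≤-trans (round-iter q) q≤)))

    state≡ : ∀ q → q ≤ passes → proj₁ (Sim.state (afterPasses Sim.algorithm s q)) ≡ iter q start
    state≡ q q≤ = trans (Sim.simulates-state s valid-working q (λ q′ q′≤ → valid-memory q′ (≤-trans q′≤ q≤))) (memory≡ q)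

    halted≡ : ∀ q → q ≤ passes → halted Sim.algorithm (afterPasses Sim.algorithm s q) ≡ done (iter q start)
    halted≡ q q≤ = cong done (state≡ q q≤)

    halts : ∀ p → p ≤ passes → done (iter p start) ≡ true → (∀ q → q < p → done (iter q start) ≡ false) → HaltsAfter Sim.algorithm s p
    halts p p≤ dn below = trans (halted≡ p p≤) dn , λ q q<p → trans (halted≡ q (≤-trans (<⇒≤ q<p) p≤)) (below q q<p)

    coloured : ∀ p → p ≤ passes → done (iter p start) ≡ true → ProperColoring s a b (maxDeg s) (output Sim.algorithm (afterPasses Sim.algorithm s p))
    coloured p p≤ dn = subst (λ m → ProperColoring s a b (maxDeg s) (λ v → fromMaybe 0 (lookup (col m) v))) (sym (state≡ p p≤))
      (good-coloring a b C*b≤ (good-iter p) dn)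

    result : Σ ℕ λ p → HaltsAfter Sim.algorithm s p × (∀ r → ⌊log₂ (maxDeg s) ⌋ ≤ r * r → p * a ≤ 90 * (b * r + a)) ×
             ProperColoring s a b (maxDeg s) (output Sim.algorithm (afterPasses Sim.algorithm s p))
    result = let (p , p≤ , dn , below) = halting in p , halts p p≤ dn below , (λ r → passes-bound p r p≤) , coloured p p≤ dn

-- Here η is `a / b`, and the real square root is replaced by every integer `r` with `log Δ ≤ r²`,
-- rounded down. The condition `b ≤ a * maxDeg s` says that `η Δ ≥ 1`: otherwise only `Δ` colours
-- would be available, and complete graphs have no such colouring.
theorem1p1 : Σ ℕ λ c → (a b : ℕ) → 0 < a → a < b →
    Σ ℕ λ c′ → Σ ℕ λ k →
    (n : ℕ) → Σ ℕ λ S →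
    S ≤ c′ * (suc n * (suc ⌈log₂ (suc n) ⌉ ^ k)) ×
    Σ (StreamAlg n S) λ A →
    (s : List (Edge n)) → SimpleStream s → b ≤ a * maxDeg s →
    Σ ℕ λ p →
    HaltsAfter A s p ×
    (∀ r → ⌊log₂ (maxDeg s) ⌋ ≤ r * r → p * a ≤ c * (b * r + a)) ×
    ProperColoring s a b (maxDeg s) (output A (afterPasses A s p))
theorem1p1 = 90 , λ a b 0<a a<b →
  let (c′ , k , bound) = Space.big-space a b 0<a a<b
  in c′ , k , λ n → Space.space a b 0<a a<b n , bound n , Final.Sim.algorithm a b 0<a a<b n , Final.Run.result a b 0<a a<b n
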